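{- The following two statements are equivalent: (i) For every skew partition $\lambda/\mu$, $\mathrm{rank}(\lambda/\mu)=\mathrm{zrank}(\lambda/\mu)$. (ii) Every restricted Cauchy matrix is nonsingular.
   Context: For a skew partition $\lambda/\mu$, $\mathrm{rank}(\lambda/\mu)$ is the smallest number $r$ such that the diagram of $\lambda/\mu$ is a disjoint union of $r$ border strips (a border strip being a connected skew shape with no $2\times 2$ square). Let $s_{\lambda/\mu}(1^t)$ denote the skew Schur function $s_{\lambda/\mu}$ evaluated at $x_1=\cdots=x_t=1$, $x_i=0$ for $i>t$ (a polynomial in $t$); $\mathrm{zrank}(\lambda/\mu)$ is the largest $e$ such that $t^e$ divides $s_{\lambda/\mu}(1^t)$. Restricted Cauchy matrix: let $a=(a_1,\ldots,a_n)$ and $b=(b_1,\ldots,b_n)$ be integer sequences with $a$ strictly decreasing, $b$ strictly increasing, $a_i>b_{n+1-i}$ for all $i$, and $a_i\ne b_j$ for all $i,j$. Define $C(a,b)=(c_{ij})_{i,j=1}^n$ by $c_{ij}=1/(a_i-b_j)$ if $a_i>b_j$ and $c_{ij}=0$ if $a_i<b_j$. A matrix is a restricted Cauchy matrix if it equals $C(a,b)$ for some such $a,b$. A matrix is nonsingular if its determinant is nonzero. -}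

module Defs where

open import Data.Nat as ℕ using (ℕ; zero; suc; _≤_; _<_; _∸_; _<ᵇ_; _≤ᵇ_; _^_)
open import Data.Integer as ℤ using (ℤ; +_; -[1+_])
open import Data.Rational as ℚ using (ℚ; 0ℚ; 1ℚ)
open import Data.Fin as Fin using (Fin; punchIn; opposite)
open import Data.List using (List; []; _∷_; [_]; map; concatMap; upTo; filterᵇ; length)
open import Data.Bool using (Bool; true; false; _∧_; if_then_else_)
open import Data.Product using (Σ; ∃; _×_; _,_)
open import Data.Sum using (_⊎_)
open import Relation.Nullary using (¬_; yes; no)
open import Relation.Binary.PropositionalEquality using (_≡_)

-- A partition is a list of naturals, read with zero padding (p ! i = p_i).
_!_ : List ℕ → ℕ → ℕ
[] ! i = 0
(x ∷ xs) ! zero = x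
(x ∷ xs) ! suc i = xs ! i

IsPartition : List ℕ → Set
IsPartition p = ∀ i → p ! suc i ≤ p ! i

_⊆ₚ_ : List ℕ → List ℕ → Set
mu ⊆ₚ la = ∀ i → mu ! i ≤ la ! i

IsSkewPartition : List ℕ → List ℕ → Set
IsSkewPartition la mu = IsPartition la × IsPartition mu × mu ⊆ₚ la

-- cells (row i, column j), 0-indexed
Cell : Set
Cell = ℕ × ℕ

InSkew : List ℕ → List ℕ → Cell → Set
InSkew la mu (i , j) = mu ! i ≤ j × j < la ! i

Adj : Cell → Cell → Set
Adj (i , j) (i' , j') =
  (i ≡ i' × (suc j ≡ j' ⊎ j ≡ suc j')) ⊎ (j ≡ j' × (suc i ≡ i' ⊎ i ≡ suc i'))

data Path (S : Cell → Set) : Cell → Cell → Set where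
  here : ∀ {c} → Path S c c
  step : ∀ {c d e} → Adj c d → S d → Path S d e → Path S c e

Connected : (Cell → Set) → Set
Connected S = ∀ c d → S c → S d → Path S c d

No2x2 : (Cell → Set) → Set
No2x2 S = ∀ i j →
  ¬ (S (i , j) × S (suc i , j) × S (i , suc j) × S (suc i , suc j))

IsSkewShape : (Cell → Set) → Set
IsSkewShape S = Σ (List ℕ) λ nu → Σ (List ℕ) λ rho →
  IsSkewPartition nu rho × (∀ c → (S c → InSkew nu rho c) × (InSkew nu rho c → S c))

IsBorderStrip : (Cell → Set) → Set
IsBorderStrip S = (∃ λ c → S c) × IsSkewShape S × Connected S × No2x2 S

-- the diagram of λ/μ is a disjoint union of r border strips:
-- a labelling of its cells by 0..r-1 whose label classes are border strips
BorderStripDecomp : List ℕ → List ℕ → ℕ → Set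
BorderStripDecomp la mu r = Σ (Cell → ℕ) λ col →
  (∀ c → InSkew la mu c → col c < r) ×
  (∀ k → k < r → IsBorderStrip (λ c → InSkew la mu c × col c ≡ k))

IsRank : List ℕ → List ℕ → ℕ → Set
IsRank la mu r = BorderStripDecomp la mu r × (∀ s → BorderStripDecomp la mu s → r ≤ s)

-- s_{λ/μ}(1^t) = number of SSYT of shape λ/μ with entries in {1,…,t}

lookupL : List (List ℕ) → ℕ → List ℕ
lookupL [] i = []
lookupL (r ∷ rs) zero = r
lookupL (r ∷ rs) (suc i) = lookupL rs i

words : ℕ → ℕ → List (List ℕ)
words t zero = [ [] ]
words t (suc k) = concatMap (λ x → map (x ∷_) (words t k)) (map suc (upTo t))

fillings : ℕ → List ℕ → List (List (List ℕ))
fillings t [] = [ [] ]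
fillings t (k ∷ ks) = concatMap (λ r → map (r ∷_) (fillings t ks)) (words t k)

rowLengths : List ℕ → List ℕ → List ℕ
rowLengths la mu = map (λ i → la ! i ∸ mu ! i) (upTo (length la))

weaklyIncᵇ : List ℕ → Bool
weaklyIncᵇ [] = true
weaklyIncᵇ (x ∷ []) = true
weaklyIncᵇ (x ∷ y ∷ xs) = (x ≤ᵇ y) ∧ weaklyIncᵇ (y ∷ xs)

inSkewᵇ : List ℕ → List ℕ → ℕ → ℕ → Bool
inSkewᵇ la mu i j = (mu ! i ≤ᵇ j) ∧ (j <ᵇ la ! i)

-- entry of a filling F (row i stores the cells mu_i, …, la_i - 1) at cell (i , j)
entry : List ℕ → List (List ℕ) → ℕ → ℕ → ℕ
entry mu F i j = lookupL F i ! (j ∸ mu ! i)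

allᵇ : {A : Set} → (A → Bool) → List A → Bool
allᵇ p [] = true
allᵇ p (x ∷ xs) = p x ∧ allᵇ p xs

isSSYTᵇ : List ℕ → List ℕ → List (List ℕ) → Bool
isSSYTᵇ la mu F =
  allᵇ weaklyIncᵇ F ∧
  allᵇ (λ i → allᵇ (λ j →
         if inSkewᵇ la mu i j ∧ inSkewᵇ la mu (suc i) j
         then entry mu F i j <ᵇ entry mu F (suc i) j
         else true)
       (upTo (la ! i)))
      (upTo (length la))

ssytCount : List ℕ → List ℕ → ℕ → ℕ
ssytCount la mu t = length (filterᵇ (isSSYTᵇ la mu) (fillings t (rowLengths la mu)))

evalPoly : List ℚ → ℚ → ℚ
evalPoly [] x = 0ℚ
evalPoly (c ∷ cs) x = c ℚ.+ x ℚ.* evalPoly cs x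

nat→ℚ : ℕ → ℚ
nat→ℚ n = (+ n) ℚ./ 1

-- t^e divides the polynomial s_{λ/μ}(1^t) in ℚ[t]:
-- s_{λ/μ}(1^t) = t^e · q(t) for some q ∈ ℚ[t]  (identity of polynomials,
-- equivalently of their values at all t ∈ ℕ)
TPowDivides : List ℕ → List ℕ → ℕ → Set
TPowDivides la mu e = Σ (List ℚ) λ q →
  ∀ t → nat→ℚ (t ^ e) ℚ.* evalPoly q (nat→ℚ t) ≡ nat→ℚ (ssytCount la mu t)

IsZrank : List ℕ → List ℕ → ℕ → Set
IsZrank la mu e = TPowDivides la mu e × (∀ f → TPowDivides la mu f → f ≤ e)

-- 1/d for an integer d (the value at 0 is irrelevant: only used for d > 0)
recip : ℤ → ℚ
recip (+ zero) = 0ℚ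
recip (+ suc k) = (+ 1) ℚ./ suc k
recip -[1+ k ] = -[1+ 0 ] ℚ./ suc k

cauchy : ∀ {n} → (Fin n → ℤ) → (Fin n → ℤ) → Fin n → Fin n → ℚ
cauchy a b i j with b j ℤ.<? a i
... | yes _ = recip (a i ℤ.- b j)
... | no _ = 0ℚ

sumℚ : ∀ n → (Fin n → ℚ) → ℚ
sumℚ zero f = 0ℚ
sumℚ (suc n) f = f Fin.zero ℚ.+ sumℚ n (λ i → f (Fin.suc i))

altSign : ℕ → ℚ
altSign zero = 1ℚ
altSign (suc k) = ℚ.- altSign k

det : ∀ n → (Fin n → Fin n → ℚ) → ℚ
det zero M = 1ℚ
det (suc n) M = sumℚ (suc n) λ j →
  altSign (Fin.toℕ j) ℚ.* M Fin.zero j ℚ.* det n (λ i k → M (Fin.suc i) (punchIn j k))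

RestrictedCauchyData : ∀ n → (Fin n → ℤ) → (Fin n → ℤ) → Set
RestrictedCauchyData n a b =
  (∀ i j → i Fin.< j → a j ℤ.< a i) ×
  (∀ i j → i Fin.< j → b i ℤ.< b j) ×
  (∀ i → b (opposite i) ℤ.< a i) ×             -- a_i > b_{n+1-i}  (0-indexed: b_{n-1-i})
  (∀ i j → ¬ (a i ≡ b j))

RankEqualsZrank : Set
RankEqualsZrank = ∀ la mu → IsSkewPartition la mu →
  ∀ r e → IsRank la mu r → IsZrank la mu e → r ≡ e

RestrictedCauchyNonsingular : Set
RestrictedCauchyNonsingular = ∀ n (a b : Fin n → ℤ) →
  RestrictedCauchyData n a b → ¬ (det n (cauchy a b) ≡ 0ℚ)

{-# OPTIONS --safe #-}

-- By the Jacobi–Trudi identity, s_{λ/μ}(1^t) is the determinant of the h_{A_i - B_j}(1^t), where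
-- A_i = λ_i - i and B_j = μ_j - j.  As h_k(1^t) = t/k + O(t²) for k > 0, while h_0 = 1, a row i
-- has order 1 at t = 0, unless A_i equals some B_j, when it has order 0.  So the determinant is
-- c t^r + O(t^{r+1}), where r is the number of unmatched A_i, and expanding along the matched
-- rows, whose constant terms are unit vectors, shows that c is up to sign the determinant of a
-- restricted Cauchy matrix.  On the other hand r is the rank: from the diagonal k - 1 to the
-- diagonal k = A_i unmatched the number of cells drops, so some strip ends there, and the strips
-- joining the starts B_j to the ends A_i in order form a decomposition.  Hence rank = zrank for
-- λ/μ exactly if c ≠ 0, and every restricted Cauchy matrix arises from some λ/μ.
module Submission where

open import Defs
open import Data.Bool using (Bool; true; false; _∧_; if_then_else_; T)
import Data.Bool.Properties as BoolP
open import Data.Empty using (⊥; ⊥-elim)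
open import Data.Fin as Fin using (Fin; toℕ; fromℕ<; opposite; punchIn)
import Data.Fin.Properties as FinP
open import Data.Integer as ℤ using (ℤ)
import Data.Integer.Properties as ℤP
import Data.Integer.Tactic.RingSolver as ℤSolver
open import Data.List using (List; []; _∷_; map; length; replicate; _++_; _∷ʳ_; concatMap; upTo; applyUpTo; filterᵇ)
import Data.List.Properties as ListP
open import Data.Nat as ℕ using (ℕ; zero; suc; z≤n; s≤s; _≤_; _<_; _∸_; _≤ᵇ_; _<ᵇ_)
import Data.Nat.Properties as ℕP
open import Data.Product using (Σ; ∃; _×_; _,_; proj₁; proj₂)
open import Data.Rational as ℚ using (ℚ; 0ℚ; 1ℚ)
import Data.Rational.Properties as ℚP
open import Data.Sum using (_⊎_; inj₁; inj₂)
open import Data.Unit using (tt)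
open import Function using (_∘_)
open import Function.Bundles using (Equivalence)
open import Level using (0ℓ)
open import Relation.Binary.Definitions using (tri<; tri≈; tri>)
open import Relation.Binary.PropositionalEquality
open import Relation.Nullary using (¬_; Dec; yes; no; contradiction)
open import Relation.Nullary.Decidable using (_×-dec_; ¬?; map′; dec⇒maybe)
open import Tactic.RingSolver using (solve-∀)
open import Tactic.RingSolver.Core.AlmostCommutativeRing using (AlmostCommutativeRing; fromCommutativeRing)

-- Jacobi-Trudi is itself proved, by induction on t: the count and the determinant obey the same
-- branching rule from t to t + 1. On the count the rule splits off the entries 1; on the
-- determinant it comes from telescoping the columns, and the surplus ν not contained in λ
-- contribute determinants with a large block of zeros.
--
-- The label of a cell in the strip decomposition has a simple source. Diagonal k meets exactly the
-- rows `allB k ≤ i < allA k`, where `allA` and `allB` count the ends and starts beyond k. Matched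
-- ends and starts contribute equally to both bounds, so subtracting their number from `i` gives a
-- label ℓ with `unmatchedB k ≤ ℓ < unmatchedA k`. Both bounds can only fall as k grows, so each
-- label occupies an interval of diagonals, with one cell on each.
--
-- The converse implication needs zrank to exist, yet it is a maximum over a predicate for which no
-- decision procedure is given. It is therefore obtained only under a double negation, which is
-- enough because nonsingularity is a negation.

ringℚ : AlmostCommutativeRing 0ℓ 0ℓ
ringℚ = fromCommutativeRing ℚP.+-*-commutativeRing (λ x → dec⇒maybe (0ℚ ℚP.≟ x))

-- Determinants of matrices indexed by ℕ

module Determinant where

  open import Data.Rational using (_+_; _*_; -_; _-_)

  sumTo : ℕ → (ℕ → ℚ) → ℚ
  sumTo zero f = 0ℚ
  sumTo (suc n) f = f 0 + sumTo n (f ∘ suc)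

  sumTo-cong : ∀ n {f g} → (∀ i → i < n → f i ≡ g i) → sumTo n f ≡ sumTo n g
  sumTo-cong zero e = refl
  sumTo-cong (suc n) e = cong₂ _+_ (e 0 (s≤s z≤n)) (sumTo-cong n λ i i<n → e (suc i) (s≤s i<n))

  sumTo-zero : ∀ n {f} → (∀ i → i < n → f i ≡ 0ℚ) → sumTo n f ≡ 0ℚ
  sumTo-zero zero e = refl
  sumTo-zero (suc n) e =
    trans (cong₂ _+_ (e 0 (s≤s z≤n)) (sumTo-zero n λ i i<n → e (suc i) (s≤s i<n))) (ℚP.+-identityˡ 0ℚ)

  +-interchange : ∀ a b c d → (a + b) + (c + d) ≡ (a + c) + (b + d)
  +-interchange = solve-∀ ringℚ

  sumTo-+ : ∀ n f g → sumTo n (λ i → f i + g i) ≡ sumTo n f + sumTo n g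
  sumTo-+ zero f g = refl
  sumTo-+ (suc n) f g =
    trans (cong (f 0 + g 0 +_) (sumTo-+ n (f ∘ suc) (g ∘ suc))) (+-interchange (f 0) (g 0) _ _)

  sumTo-*ˡ : ∀ n c f → sumTo n (λ i → c * f i) ≡ c * sumTo n f
  sumTo-*ˡ zero c f = sym (ℚP.*-zeroʳ c)
  sumTo-*ˡ (suc n) c f =
    trans (cong (c * f 0 +_) (sumTo-*ˡ n c (f ∘ suc))) (sym (ℚP.*-distribˡ-+ c (f 0) _))

  sumTo-swap : ∀ m n (f : ℕ → ℕ → ℚ) →
    sumTo m (λ i → sumTo n (f i)) ≡ sumTo n (λ j → sumTo m (λ i → f i j))
  sumTo-swap zero n f = sym (sumTo-zero n λ _ _ → refl)
  sumTo-swap (suc m) n f =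
    trans (cong (sumTo n (f 0) +_) (sumTo-swap m n (f ∘ suc))) (sym (sumTo-+ n (f 0) _))

  sumTo-last : ∀ n f → sumTo (suc n) f ≡ sumTo n f + f n
  sumTo-last zero f = trans (ℚP.+-identityʳ (f 0)) (sym (ℚP.+-identityˡ (f 0)))
  sumTo-last (suc n) f =
    trans (cong (f 0 +_) (sumTo-last n (f ∘ suc))) (sym (ℚP.+-assoc (f 0) _ _))

  sumTo-reverse : ∀ n f → sumTo (suc n) f ≡ sumTo (suc n) (λ j → f (n ∸ j))
  sumTo-reverse zero f = refl
  sumTo-reverse (suc n) f = begin
    sumTo (suc (suc n)) f ≡⟨ sumTo-last (suc n) f ⟩
    sumTo (suc n) f + f (suc n) ≡⟨ cong (_+ f (suc n)) (sumTo-reverse n f) ⟩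
    sumTo (suc n) (λ j → f (n ∸ j)) + f (suc n) ≡⟨ ℚP.+-comm _ (f (suc n)) ⟩
    f (suc n) + sumTo (suc n) (λ j → f (n ∸ j)) ∎
    where open ≡-Reasoning

  -- `punchIn` without bounds: the increasing enumeration of the numbers other than the first
  -- argument.
  skip : ℕ → ℕ → ℕ
  skip zero k = suc k
  skip (suc j) zero = zero
  skip (suc j) (suc k) = suc (skip j k)

  skip-≥ : ∀ {j k} → j ≤ k → skip j k ≡ suc k
  skip-≥ z≤n = refl
  skip-≥ (s≤s p) = cong suc (skip-≥ p)

  skip-< : ∀ {j k} → k < j → skip j k ≡ k
  skip-< {suc j} {zero} p = refl
  skip-< {suc j} {suc k} (s≤s p) = cong suc (skip-< p)

  skip-≤ : ∀ j k → skip j k ≤ suc k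
  skip-≤ zero k = ℕP.≤-refl
  skip-≤ (suc j) zero = z≤n
  skip-≤ (suc j) (suc k) = s≤s (skip-≤ j k)

  skip-mono-< : ∀ j {k l} → k < l → skip j k < skip j l
  skip-mono-< zero p = s≤s p
  skip-mono-< (suc j) {zero} {suc l} p = s≤s z≤n
  skip-mono-< (suc j) {suc k} {suc l} (s≤s p) = s≤s (skip-mono-< j p)

  skip-≢ : ∀ j k → skip j k ≢ j
  skip-≢ (suc j) (suc k) e = skip-≢ j k (ℕP.suc-injective e)

  skip-injective : ∀ j {k l} → skip j k ≡ skip j l → k ≡ l
  skip-injective zero e = ℕP.suc-injective e
  skip-injective (suc j) {zero} {zero} e = refl
  skip-injective (suc j) {suc k} {suc l} e = cong suc (skip-injective j (ℕP.suc-injective e))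

  skip-bound : ∀ {n} j {k} → k < n → skip j k < suc n
  skip-bound j {k} k<n = s≤s (ℕP.≤-trans (skip-≤ j k) k<n)

  -- The cosimplicial identity: once the smaller of two deleted columns is gone, the larger has
  -- moved down by one, so both orders of deletion leave the same minor.
  skip-comm : ∀ {a b} c → a ≤ b → skip (suc b) (skip a c) ≡ skip a (skip b c)
  skip-comm c z≤n = refl
  skip-comm zero (s≤s p) = refl
  skip-comm (suc c) (s≤s p) = cong suc (skip-comm c p)

  unskip : ∀ j p → j ≢ p → Σ ℕ λ p' → skip j p' ≡ p × (∀ {n} → j < suc n → p < suc n → p' < n)
  unskip j p j≢p with ℕP.<-cmp j p
  ... | tri≈ _ e _ = ⊥-elim (j≢p e)
  unskip j (suc p) j≢p | tri< (s≤s j≤p) _ _ = p , skip-≥ j≤p , λ { _ (s≤s q) → q }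
  unskip j p j≢p | tri> _ _ p<j = p , skip-< p<j , λ { (s≤s j≤n) _ → ℕP.≤-trans p<j j≤n }

  sumTo-skip : ∀ n j f → j < suc n → f j ≡ 0ℚ → sumTo (suc n) f ≡ sumTo n (f ∘ skip j)
  sumTo-skip n zero f j<n e = trans (cong (_+ sumTo n (f ∘ suc)) e) (ℚP.+-identityˡ _)
  sumTo-skip (suc n) (suc j) f (s≤s j<n) e = cong (f 0 +_) (sumTo-skip n j (f ∘ suc) j<n e)

  sumTo-single : ∀ n p f → p < n → (∀ j → j < n → j ≢ p → f j ≡ 0ℚ) → sumTo n f ≡ f p
  sumTo-single (suc n) zero f p<n e =
    trans (cong (f 0 +_) (sumTo-zero n λ i i<n → e (suc i) (s≤s i<n) λ ())) (ℚP.+-identityʳ _)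
  sumTo-single (suc n) (suc p) f (s≤s p<n) e =
    trans (cong₂ _+_ (e 0 (s≤s z≤n) λ ())
      (sumTo-single n p (f ∘ suc) p<n λ j j<n j≢p → e (suc j) (s≤s j<n) (j≢p ∘ ℕP.suc-injective)))
      (ℚP.+-identityˡ _)

  sumTo-pair : ∀ n p f → suc p < n → (∀ j → j < n → j ≢ p → j ≢ suc p → f j ≡ 0ℚ) →
    f p + f (suc p) ≡ 0ℚ → sumTo n f ≡ 0ℚ
  sumTo-pair (suc (suc n)) zero f _ e e₂ =
    trans (sym (ℚP.+-assoc (f 0) (f 1) _))
      (trans (cong₂ _+_ e₂ (sumTo-zero n λ i i<n → e (suc (suc i)) (s≤s (s≤s i<n)) (λ ()) λ ()))
        (ℚP.+-identityˡ 0ℚ))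
  sumTo-pair (suc n) (suc p) f (s≤s p<n) e e₂ =
    trans (cong₂ _+_ (e 0 (s≤s z≤n) (λ ()) λ ())
      (sumTo-pair n p (f ∘ suc) p<n
        (λ j j<n a b → e (suc j) (s≤s j<n) (a ∘ ℕP.suc-injective) (b ∘ ℕP.suc-injective)) e₂))
      (ℚP.+-identityˡ 0ℚ)

  Matrix : Set
  Matrix = ℕ → ℕ → ℚ

  minor : ℕ → ℕ → Matrix → Matrix
  minor i j M r c = M (skip i r) (skip j c)

  -- The determinant det of a matrix indexed by ℕ, of which only the first n rows and columns count.
  dt : ℕ → Matrix → ℚ
  dt zero M = 1ℚ
  dt (suc n) M = sumTo (suc n) λ j → altSign j * M 0 j * dt n (minor 0 j M)

  cofactorTerm : ℕ → Matrix → ℕ → ℚ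
  cofactorTerm n M j = altSign j * M 0 j * dt n (minor 0 j M)

  dt-cong : ∀ n {M M' : Matrix} → (∀ i j → i < n → j < n → M i j ≡ M' i j) → dt n M ≡ dt n M'
  dt-cong zero e = refl
  dt-cong (suc n) e = sumTo-cong (suc n) λ j j<n →
    cong₂ (λ x y → altSign j * x * y) (e 0 j (s≤s z≤n) j<n)
      (dt-cong n λ i k i<n k<n → e (suc i) (skip j k) (s≤s i<n) (skip-bound j k<n))

  sumℚ≡sumTo : ∀ n (f : Fin n → ℚ) g → (∀ i → f i ≡ g (toℕ i)) → sumℚ n f ≡ sumTo n g
  sumℚ≡sumTo zero f g e = refl
  sumℚ≡sumTo (suc n) f g e = cong₂ _+_ (e Fin.zero) (sumℚ≡sumTo n (f ∘ Fin.suc) (g ∘ suc) (e ∘ Fin.suc))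

  toℕ-punchIn : ∀ {n} (j : Fin (suc n)) k → toℕ (punchIn j k) ≡ skip (toℕ j) (toℕ k)
  toℕ-punchIn Fin.zero k = refl
  toℕ-punchIn (Fin.suc j) Fin.zero = refl
  toℕ-punchIn (Fin.suc j) (Fin.suc k) = cong suc (toℕ-punchIn j k)

  det≡dt : ∀ n (M : Fin n → Fin n → ℚ) (M' : Matrix) →
    (∀ i j → M i j ≡ M' (toℕ i) (toℕ j)) → det n M ≡ dt n M'
  det≡dt zero M M' e = refl
  det≡dt (suc n) M M' e = sumℚ≡sumTo (suc n) _ (cofactorTerm n M') λ j →
    cong₂ (λ x y → altSign (toℕ j) * x * y) (e Fin.zero j)
      (det≡dt n _ (minor 0 (toℕ j) M') λ i k → trans (e (Fin.suc i) (punchIn j k)) (cong (M' (suc (toℕ i))) (toℕ-punchIn j k)))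

  -- Rows `i` to `n - 1` live on the `n - i - 1` columns beyond `i`, so they are dependent.
  -- Expansion along the first row preserves the block: deleting a column moves the others by at
  -- most one, which the drop from `suc i` to `i` absorbs.
  dt-zeroBlock : ∀ n M i → i < n → (∀ r c → i ≤ r → c ≤ i → M r c ≡ 0ℚ) → dt n M ≡ 0ℚ
  dt-zeroBlock (suc n) M zero _ z = sumTo-zero (suc n) {cofactorTerm n M} λ
    { zero _ → trans (cong (λ x → altSign 0 * x * dt n (minor 0 0 M)) (z 0 0 z≤n z≤n)) (ℚP.*-zeroˡ (dt n (minor 0 0 M)))
    ; (suc j) (s≤s j<n) → trans
        (cong (altSign (suc j) * M 0 (suc j) *_)
          (dt-zeroBlock n (minor 0 (suc j) M) 0 (ℕP.≤-trans (s≤s z≤n) j<n) λ { r .0 _ z≤n → z (suc r) 0 z≤n z≤n }))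
        (ℚP.*-zeroʳ (altSign (suc j) * M 0 (suc j))) }
  dt-zeroBlock (suc n) M (suc i) (s≤s i<n) z = sumTo-zero (suc n) {cofactorTerm n M} λ j _ → trans
    (cong (altSign j * M 0 j *_)
      (dt-zeroBlock n (minor 0 j M) i i<n λ r c i≤r c≤i →
        z (suc r) (skip j c) (s≤s i≤r) (ℕP.≤-trans (skip-≤ j c) (s≤s c≤i))))
    (ℚP.*-zeroʳ (altSign j * M 0 j))

  dt-zeroRow : ∀ n M i → i < n → (∀ c → c < n → M i c ≡ 0ℚ) → dt n M ≡ 0ℚ
  dt-zeroRow (suc n) M zero _ z = sumTo-zero (suc n) {cofactorTerm n M} λ j j<n →
    trans (cong (λ x → altSign j * x * dt n (minor 0 j M)) (z j j<n))
      (trans (cong (_* dt n (minor 0 j M)) (ℚP.*-zeroʳ (altSign j))) (ℚP.*-zeroˡ (dt n (minor 0 j M))))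
  dt-zeroRow (suc n) M (suc i) (s≤s i<n) z = sumTo-zero (suc n) {cofactorTerm n M} λ j _ → trans
    (cong (altSign j * M 0 j *_)
      (dt-zeroRow n (minor 0 j M) i i<n λ c c<n → z (skip j c) (skip-bound j c<n)))
    (ℚP.*-zeroʳ (altSign j * M 0 j))

  -- A cofactor of the first row either deletes column `p`, and then only the entry splits, or keeps
  -- it, and then only the minor splits.
  dt-+ : ∀ n (M U V : Matrix) p → p < n → (∀ i → M i p ≡ U i p + V i p) →
    (∀ i k → k ≢ p → M i k ≡ U i k) → (∀ i k → k ≢ p → M i k ≡ V i k) →
    dt n M ≡ dt n U + dt n V
  dt-+ (suc n) M U V p p<n eₚ eU eV = trans (sumTo-cong (suc n) term) (sumTo-+ (suc n) (cofactorTerm n U) (cofactorTerm n V))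
    where
    distrib : ∀ a x y d → a * (x + y) * d ≡ a * x * d + a * y * d
    distrib = solve-∀ ringℚ
    distribʳ : ∀ a d e → a * (d + e) ≡ a * d + a * e
    distribʳ = solve-∀ ringℚ
    term : ∀ j → j < suc n → altSign j * M 0 j * dt n (minor 0 j M) ≡
      altSign j * U 0 j * dt n (minor 0 j U) + altSign j * V 0 j * dt n (minor 0 j V)
    term j j<n with j ℕP.≟ p
    ... | yes refl = trans (cong (λ x → altSign j * x * dt n (minor 0 j M)) (eₚ 0))
      (trans (distrib (altSign j) (U 0 j) (V 0 j) _)
        (cong₂ (λ x y → altSign j * U 0 j * x + altSign j * V 0 j * y)
          (dt-cong n λ i k _ _ → eU (suc i) _ (skip-≢ j k))
          (dt-cong n λ i k _ _ → eV (suc i) _ (skip-≢ j k))))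
    ... | no j≢p with unskip j p j≢p
    ... | p' , refl , b = trans
      (cong (altSign j * M 0 j *_)
        (dt-+ n (minor 0 j M) (minor 0 j U) (minor 0 j V) p' (b j<n p<n) (λ i → eₚ (suc i))
          (λ i k k≢ → eU (suc i) _ (k≢ ∘ skip-injective j)) (λ i k k≢ → eV (suc i) _ (k≢ ∘ skip-injective j))))
      (trans (distribʳ (altSign j * M 0 j) _ _)
        (cong₂ (λ x y → altSign j * x * dt n (minor 0 j U) + altSign j * y * dt n (minor 0 j V))
          (eU 0 j j≢p) (eV 0 j j≢p)))

  -- Minors that keep both columns vanish by induction, as the columns stay adjacent; the two other
  -- minors are equal and carry opposite signs. Adjacency makes them equal without any permutation,
  -- and it is all that the telescoping of columns asks for.
  dt-alternating : ∀ n M p → suc p < n → (∀ i → M i p ≡ M i (suc p)) → dt n M ≡ 0ℚ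
  dt-alternating (suc n) M p p<n e = sumTo-pair (suc n) p (cofactorTerm n M) p<n off on
    where
    zeroFactor : ∀ j → dt n (minor 0 j M) ≡ 0ℚ → altSign j * M 0 j * dt n (minor 0 j M) ≡ 0ℚ
    zeroFactor j z = trans (cong (altSign j * M 0 j *_) z) (ℚP.*-zeroʳ (altSign j * M 0 j))
    off : ∀ j → j < suc n → j ≢ p → j ≢ suc p → altSign j * M 0 j * dt n (minor 0 j M) ≡ 0ℚ
    off j j<n j≢p j≢sp with ℕP.<-cmp j p
    ... | tri≈ _ eq _ = ⊥-elim (j≢p eq)
    off j j<n j≢p j≢sp | tri< j<p@(s≤s {_} {q} j≤q) _ _ = zeroFactor j
      (dt-alternating n (minor 0 j M) q (ℕ.s≤s⁻¹ p<n) λ i →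
        trans (cong (M (suc i)) (skip-≥ j≤q))
          (trans (e (suc i)) (sym (cong (M (suc i)) (skip-≥ (ℕP.m≤n⇒m≤1+n j≤q))))))
    off j j<n j≢p j≢sp | tri> _ _ p<j = zeroFactor j
      (dt-alternating n (minor 0 j M) p (ℕP.≤-trans sp<j (ℕ.s≤s⁻¹ j<n)) λ i →
        trans (cong (M (suc i)) (skip-< p<j))
          (trans (e (suc i)) (sym (cong (M (suc i)) (skip-< sp<j)))))
      where
      sp<j : suc p < j
      sp<j = ℕP.≤∧≢⇒< p<j (j≢sp ∘ sym)
    cancel : ∀ a x d → a * x * d + - a * x * d ≡ 0ℚ
    cancel = solve-∀ ringℚ
    sameColumn : ∀ i k → M (suc i) (skip p k) ≡ M (suc i) (skip (suc p) k)
    sameColumn i k with ℕP.<-cmp k p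
    ... | tri< k<p _ _ = cong (M (suc i)) (trans (skip-< k<p) (sym (skip-< (ℕP.m≤n⇒m≤1+n k<p))))
    ... | tri≈ _ refl _ = trans (cong (M (suc i)) (skip-≥ (ℕP.≤-refl {k})))
      (trans (sym (e (suc i))) (cong (M (suc i)) (sym (skip-< (ℕP.n<1+n k)))))
    ... | tri> _ _ p<k = cong (M (suc i)) (trans (skip-≥ (ℕP.<⇒≤ p<k)) (sym (skip-≥ p<k)))
    on : altSign p * M 0 p * dt n (minor 0 p M) + altSign (suc p) * M 0 (suc p) * dt n (minor 0 (suc p) M) ≡ 0ℚ
    on = trans
      (cong₂ (λ x y → altSign p * M 0 p * dt n (minor 0 p M) + altSign (suc p) * x * y)
        (sym (e 0)) (sym (dt-cong n λ i k _ _ → sameColumn i k)))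
      (cancel (altSign p) (M 0 p) _)

  altSign-+ : ∀ m n → altSign (m ℕ.+ n) ≡ altSign m * altSign n
  altSign-+ zero n = sym (ℚP.*-identityˡ (altSign n))
  altSign-+ (suc m) n = trans (cong -_ (altSign-+ m n)) (ℚP.neg-distribˡ-* (altSign m) (altSign n))

  altSign² : ∀ n → altSign n * altSign n ≡ 1ℚ
  altSign² zero = refl
  altSign² (suc n) = trans (negsq (altSign n)) (altSign² n)
    where
    negsq : ∀ a → - a * - a ≡ a * a
    negsq = solve-∀ ringℚ

  -- `dt` expands only along row 0, so a lower unit row is reached by induction: it survives in
  -- every minor of row 0 except the one that deletes column `j`, which has a zero row.
  dt-unitRow : ∀ n M i j → i < suc n → j < suc n → M i j ≡ 1ℚ → (∀ k → k < suc n → k ≢ j → M i k ≡ 0ℚ) →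
    dt (suc n) M ≡ altSign (i ℕ.+ j) * dt n (minor i j M)
  dt-unitRow n M zero j _ j<n one zs = trans
    (sumTo-single (suc n) j (cofactorTerm n M) j<n λ k k<n k≢j →
      trans (cong (λ x → altSign k * x * dt n (minor 0 k M)) (zs k k<n k≢j))
        (trans (cong (_* dt n (minor 0 k M)) (ℚP.*-zeroʳ (altSign k))) (ℚP.*-zeroˡ (dt n (minor 0 k M)))))
    (cong (_* dt n (minor 0 j M)) (trans (cong (altSign j *_) one) (ℚP.*-identityʳ (altSign j))))
  dt-unitRow zero M (suc i) j (s≤s ()) _ _ _
  dt-unitRow (suc n) M (suc i) j (s≤s i<n) j<n one zs = trans
    (sumTo-skip (suc n) j (cofactorTerm (suc n) M) j<n
      (trans (cong (altSign j * M 0 j *_)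
        (dt-zeroRow (suc n) (minor 0 j M) i i<n λ c c<n → zs _ (skip-bound j c<n) (skip-≢ j c))) (ℚP.*-zeroʳ (altSign j * M 0 j))))
    (trans (sumTo-cong (suc n) term) (sumTo-*ˡ (suc n) (altSign (suc i ℕ.+ j)) (cofactorTerm n (minor (suc i) j M))))
    where
    rearr₁ : ∀ sl m si sj d → sl * m * (si * sj * d) ≡ - (si * (- sj)) * (sl * m * d)
    rearr₁ = solve-∀ ringℚ
    rearr₂ : ∀ sl m si sj d → (- sl) * m * (si * sj * d) ≡ - (si * sj) * (sl * m * d)
    rearr₂ = solve-∀ ringℚ
    term : ∀ l → l < suc n →
      altSign (skip j l) * M 0 (skip j l) * dt (suc n) (minor 0 (skip j l) M) ≡
      altSign (suc i ℕ.+ j) * (altSign l * M 0 (skip j l) * dt n (minor 0 l (minor (suc i) j M)))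
    term l l<n with l ℕP.<? j
    -- Deleting a column `l < j` moves the unit entry to column `j'`, which costs a sign; for
    -- `l ≥ j`, below, the deleted column is `suc l` and the sign sits in `altSign (suc l)`.
    term l l<n | yes l<j@(s≤s {_} {j'} l≤j') = begin
      altSign (skip j l) * M 0 (skip j l) * dt (suc n) (minor 0 (skip j l) M)
        ≡⟨ cong₂ _*_ (cong (λ x → altSign x * M 0 (skip j l)) (skip-< l<j)) (cong (λ x → dt (suc n) (minor 0 x M)) (skip-< l<j)) ⟩
      altSign l * M 0 (skip j l) * dt (suc n) (minor 0 l M)
        ≡⟨ cong (altSign l * M 0 (skip j l) *_)
            (dt-unitRow n (minor 0 l M) i j' i<n (ℕ.s≤s⁻¹ j<n) (trans (cong (M (suc i)) (skip-≥ l≤j')) one)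
              λ k k<n k≢j' → zs _ (skip-bound l k<n) λ eq → k≢j' (skip-injective l (trans eq (sym (skip-≥ l≤j'))))) ⟩
      altSign l * M 0 (skip j l) * (altSign (i ℕ.+ j') * dt n (minor i j' (minor 0 l M)))
        ≡⟨ cong₂ (λ x y → altSign l * M 0 (skip j l) * (x * y)) (altSign-+ i j')
            (dt-cong n λ r c _ _ → cong (M (suc (skip i r))) (sym (skip-comm c l≤j'))) ⟩
      altSign l * M 0 (skip j l) * (altSign i * altSign j' * dt n (minor 0 l (minor (suc i) j M)))
        ≡⟨ rearr₁ (altSign l) (M 0 (skip j l)) (altSign i) (altSign j') _ ⟩
      - (altSign i * altSign j) * (altSign l * M 0 (skip j l) * dt n (minor 0 l (minor (suc i) j M)))
        ≡⟨ cong (λ x → - x * (altSign l * M 0 (skip j l) * dt n (minor 0 l (minor (suc i) j M)))) (sym (altSign-+ i j)) ⟩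
      altSign (suc i ℕ.+ j) * (altSign l * M 0 (skip j l) * dt n (minor 0 l (minor (suc i) j M))) ∎
      where open ≡-Reasoning
    term l l<n | no l≮j = begin
      altSign (skip j l) * M 0 (skip j l) * dt (suc n) (minor 0 (skip j l) M)
        ≡⟨ cong₂ _*_ (cong (λ x → altSign x * M 0 (skip j l)) (skip-≥ j≤l)) (cong (λ x → dt (suc n) (minor 0 x M)) (skip-≥ j≤l)) ⟩
      - altSign l * M 0 (skip j l) * dt (suc n) (minor 0 (suc l) M)
        ≡⟨ cong (- altSign l * M 0 (skip j l) *_)
            (dt-unitRow n (minor 0 (suc l) M) i j i<n (ℕP.≤-trans (s≤s j≤l) l<n) (trans (cong (M (suc i)) (skip-< (s≤s j≤l))) one)
              λ k k<n k≢j → zs _ (skip-bound (suc l) k<n) λ eq → k≢j (skip-injective (suc l) (trans eq (sym (skip-< (s≤s j≤l)))))) ⟩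
      - altSign l * M 0 (skip j l) * (altSign (i ℕ.+ j) * dt n (minor i j (minor 0 (suc l) M)))
        ≡⟨ cong₂ (λ x y → - altSign l * M 0 (skip j l) * (x * y)) (altSign-+ i j)
            (dt-cong n λ r c _ _ → cong (M (suc (skip i r))) (skip-comm c j≤l)) ⟩
      - altSign l * M 0 (skip j l) * (altSign i * altSign j * dt n (minor 0 l (minor (suc i) j M)))
        ≡⟨ rearr₂ (altSign l) (M 0 (skip j l)) (altSign i) (altSign j) _ ⟩
      - (altSign i * altSign j) * (altSign l * M 0 (skip j l) * dt n (minor 0 l (minor (suc i) j M)))
        ≡⟨ cong (λ x → - x * (altSign l * M 0 (skip j l) * dt n (minor 0 l (minor (suc i) j M)))) (sym (altSign-+ i j)) ⟩
      altSign (suc i ℕ.+ j) * (altSign l * M 0 (skip j l) * dt n (minor 0 l (minor (suc i) j M))) ∎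
      where
      open ≡-Reasoning
      j≤l : j ≤ l
      j≤l = ℕP.≮⇒≥ l≮j

  skip-reverse : ∀ n j k → j ≤ n → k < n → n ∸ skip j k ≡ skip (n ∸ j) (n ∸ suc k)
  skip-reverse n j k j≤n k<n with k ℕP.<? j
  ... | yes k<j = trans (cong (n ∸_) (skip-< k<j)) (trans (ℕP.+-∸-assoc 1 k<n) (sym (skip-≥ (ℕP.∸-monoʳ-≤ n k<j))))
  ... | no k≮j = trans (cong (n ∸_) (skip-≥ j≤k)) (sym (skip-< (ℕP.∸-monoʳ-< (s≤s j≤k) k<n)))
    where
    j≤k = ℕP.≮⇒≥ k≮j

  -- The sign of the order-reversing permutation of `n` columns, with exponent 0 + 1 + ... + (n -
  -- 1).
  reverseSign : ℕ → ℚ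
  reverseSign zero = 1ℚ
  reverseSign (suc n) = altSign n * reverseSign n

  dt-reverse : ∀ n M → dt n (λ i j → M i (n ∸ suc j)) ≡ reverseSign n * dt n M
  dt-reverse zero M = refl
  dt-reverse (suc n) M = begin
    sumTo (suc n) (λ j → altSign j * M 0 (n ∸ j) * dt n (λ i k → M (suc i) (n ∸ skip j k)))
      ≡⟨ sumTo-cong (suc n) term ⟩
    sumTo (suc n) (λ j → altSign n * reverseSign n * (altSign (n ∸ j) * M 0 (n ∸ j) * dt n (minor 0 (n ∸ j) M)))
      ≡⟨ sumTo-*ˡ (suc n) (altSign n * reverseSign n) (λ j → cofactorTerm n M (n ∸ j)) ⟩
    altSign n * reverseSign n * sumTo (suc n) (λ j → altSign (n ∸ j) * M 0 (n ∸ j) * dt n (minor 0 (n ∸ j) M))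
      ≡⟨ cong (altSign n * reverseSign n *_) (sym (sumTo-reverse n (λ j → altSign j * M 0 j * dt n (minor 0 j M)))) ⟩
    altSign n * reverseSign n * dt (suc n) M ∎
    where
    open ≡-Reasoning
    rearr : ∀ sj ε sk m d → sj * m * (ε * d) * (sk * sk) ≡ sj * sk * ε * (sk * m * d)
    rearr = solve-∀ ringℚ
    term : ∀ j → j < suc n → altSign j * M 0 (n ∸ j) * dt n (λ i k → M (suc i) (n ∸ skip j k)) ≡
      altSign n * reverseSign n * (altSign (n ∸ j) * M 0 (n ∸ j) * dt n (minor 0 (n ∸ j) M))
    term j (s≤s j≤n) = begin
      altSign j * M 0 (n ∸ j) * dt n (λ i k → M (suc i) (n ∸ skip j k))
        ≡⟨ cong (altSign j * M 0 (n ∸ j) *_)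
            (trans (dt-cong n λ i k _ k<n → cong (M (suc i)) (skip-reverse n j k j≤n k<n))
              (dt-reverse n (minor 0 (n ∸ j) M))) ⟩
      altSign j * M 0 (n ∸ j) * (reverseSign n * dt n (minor 0 (n ∸ j) M))
        ≡⟨ sym (ℚP.*-identityʳ _) ⟩
      altSign j * M 0 (n ∸ j) * (reverseSign n * dt n (minor 0 (n ∸ j) M)) * 1ℚ
        -- `altSign (n ∸ j)` is inserted twice: one copy joins `altSign j` to give `altSign n`, the
        -- other is the sign of the reflected cofactor.
        ≡⟨ cong (altSign j * M 0 (n ∸ j) * (reverseSign n * dt n (minor 0 (n ∸ j) M)) *_) (sym (altSign² (n ∸ j))) ⟩
      altSign j * M 0 (n ∸ j) * (reverseSign n * dt n (minor 0 (n ∸ j) M)) * (altSign (n ∸ j) * altSign (n ∸ j))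
        ≡⟨ rearr (altSign j) (reverseSign n) (altSign (n ∸ j)) _ _ ⟩
      altSign j * altSign (n ∸ j) * reverseSign n * (altSign (n ∸ j) * M 0 (n ∸ j) * dt n (minor 0 (n ∸ j) M))
        ≡⟨ cong (λ x → x * reverseSign n * (altSign (n ∸ j) * M 0 (n ∸ j) * dt n (minor 0 (n ∸ j) M)))
            (trans (sym (altSign-+ j (n ∸ j))) (cong altSign (ℕP.m+[n∸m]≡n j≤n))) ⟩
      altSign n * reverseSign n * (altSign (n ∸ j) * M 0 (n ∸ j) * dt n (minor 0 (n ∸ j) M)) ∎

  reverseSign² : ∀ n → reverseSign n * reverseSign n ≡ 1ℚ
  reverseSign² zero = refl
  reverseSign² (suc n) = trans (rearr (altSign n) (reverseSign n))
    (trans (cong₂ _*_ (altSign² n) (reverseSign² n)) refl)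
    where
    rearr : ∀ a b → a * b * (a * b) ≡ (a * a) * (b * b)
    rearr = solve-∀ ringℚ

open Determinant

-- Polynomials in t and their lowest terms at t = 0

module LeadingTerm where

  open import Data.Rational using (_+_; _*_; -_; _-_; toℚᵘ)
  open import Data.Rational.Unnormalised as ℚᵘ using (mkℚᵘ; *≡*)
  import Data.Rational.Unnormalised.Properties as ℚᵘP

  ι : ℕ → ℚ
  ι = nat→ℚ

  -- The operations of ℚ normalise their results, so the equation does not hold by computation; it
  -- is transferred to unnormalised fractions, where it becomes an identity of integers.
  ι-homo : ∀ (_∙_ : ℕ → ℕ → ℕ) (_∙ℚ_ : ℚ → ℚ → ℚ) (_∙ᵘ_ : ℚᵘ.ℚᵘ → ℚᵘ.ℚᵘ → ℚᵘ.ℚᵘ) →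
    (∀ p q → toℚᵘ (p ∙ℚ q) ℚᵘ.≃ (toℚᵘ p ∙ᵘ toℚᵘ q)) →
    (∀ {p q r s} → p ℚᵘ.≃ q → r ℚᵘ.≃ s → (p ∙ᵘ r) ℚᵘ.≃ (q ∙ᵘ s)) →
    (∀ m n → mkℚᵘ (ℤ.+ (m ∙ n)) 0 ℚᵘ.≃ (mkℚᵘ (ℤ.+ m) 0 ∙ᵘ mkℚᵘ (ℤ.+ n) 0)) →
    ∀ m n → ι (m ∙ n) ≡ ι m ∙ℚ ι n
  ι-homo _∙_ _∙ℚ_ _∙ᵘ_ homo ∙-cong e m n = ℚP.toℚᵘ-injective
    (ℚᵘP.≃-trans (ℚP.toℚᵘ-fromℚᵘ (mkℚᵘ (ℤ.+ (m ∙ n)) 0))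
      (ℚᵘP.≃-trans (e m n)
        (ℚᵘP.≃-sym (ℚᵘP.≃-trans (homo (ι m) (ι n))
          (∙-cong (ℚP.toℚᵘ-fromℚᵘ (mkℚᵘ (ℤ.+ m) 0)) (ℚP.toℚᵘ-fromℚᵘ (mkℚᵘ (ℤ.+ n) 0)))))))

  ι-+ : ∀ m n → ι (m ℕ.+ n) ≡ ι m + ι n
  ι-+ = ι-homo ℕ._+_ _+_ ℚᵘ._+_ ℚP.toℚᵘ-homo-+ ℚᵘP.+-cong λ m n → *≡*
    (cong (ℤ._* ℤ.+ 1) (cong₂ ℤ._+_ (sym (ℤP.*-identityʳ (ℤ.+ m))) (sym (ℤP.*-identityʳ (ℤ.+ n)))))

  ι-* : ∀ m n → ι (m ℕ.* n) ≡ ι m * ι n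
  ι-* = ι-homo ℕ._*_ _*_ ℚᵘ._*_ ℚP.toℚᵘ-homo-* ℚᵘP.*-cong λ m n → *≡* (cong (ℤ._* ℤ.+ 1) (ℤP.pos-* m n))

  ι-suc : ∀ n → ι (suc n) ≡ 1ℚ + ι n
  ι-suc n = ι-+ 1 n

  ι-recip : ∀ k → ι (suc k) * recip (ℤ.+ suc k) ≡ 1ℚ
  ι-recip k = ℚP.toℚᵘ-injective
    (ℚᵘP.≃-trans (ℚP.toℚᵘ-homo-* (ι (suc k)) (recip (ℤ.+ suc k)))
      (ℚᵘP.≃-trans (ℚᵘP.*-cong (ℚP.toℚᵘ-fromℚᵘ (mkℚᵘ (ℤ.+ suc k) 0)) (ℚP.toℚᵘ-fromℚᵘ (mkℚᵘ (ℤ.+ 1) k)))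
        (*≡* (trans (ℤP.*-identityʳ _) (trans (ℤP.*-identityʳ (ℤ.+ suc k)) (sym (trans (ℤP.*-identityˡ _) (ℤP.*-identityˡ (ℤ.+ suc k)))))))))

  cancel-ι : ∀ k {x y} → ι (suc k) * x ≡ ι (suc k) * y → x ≡ y
  cancel-ι k {x} {y} e = trans (sym (expand x)) (trans (cong (recip (ℤ.+ suc k) *_) e) (expand y))
    where
    expand : ∀ z → recip (ℤ.+ suc k) * (ι (suc k) * z) ≡ z
    expand z = trans (sym (ℚP.*-assoc (recip (ℤ.+ suc k)) (ι (suc k)) z))
      (trans (cong (_* z) (trans (ℚP.*-comm (recip (ℤ.+ suc k)) (ι (suc k))) (ι-recip k))) (ℚP.*-identityˡ z))

  ι-^-suc : ∀ t r → ι (t ℕ.^ suc r) ≡ ι t * ι (t ℕ.^ r)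
  ι-^-suc t r = ι-* t (t ℕ.^ r)

  cancel-ι^ : ∀ t r {x y} → ι (suc t ℕ.^ r) * x ≡ ι (suc t ℕ.^ r) * y → x ≡ y
  cancel-ι^ t zero e = trans (sym (ℚP.*-identityˡ _)) (trans e (ℚP.*-identityˡ _))
  cancel-ι^ t (suc r) {x} {y} e = cancel-ι^ t r (cancel-ι t (trans (sym (reassoc x)) (trans e (reassoc y))))
    where
    reassoc : ∀ z → ι (suc t ℕ.^ suc r) * z ≡ ι (suc t) * (ι (suc t ℕ.^ r) * z)
    reassoc z = trans (cong (_* z) (ι-^-suc (suc t) r)) (ℚP.*-assoc (ι (suc t)) (ι (suc t ℕ.^ r)) z)

  addP : List ℚ → List ℚ → List ℚ
  addP [] q = q
  addP (a ∷ p) [] = a ∷ p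
  addP (a ∷ p) (b ∷ q) = a + b ∷ addP p q

  scaleP : ℚ → List ℚ → List ℚ
  scaleP c = map (c *_)

  mulP : List ℚ → List ℚ → List ℚ
  mulP [] q = []
  mulP (a ∷ p) q = addP (scaleP a q) (0ℚ ∷ mulP p q)

  eval-addP : ∀ p q x → evalPoly (addP p q) x ≡ evalPoly p x + evalPoly q x
  eval-addP [] q x = sym (ℚP.+-identityˡ _)
  eval-addP (a ∷ p) [] x = sym (ℚP.+-identityʳ _)
  eval-addP (a ∷ p) (b ∷ q) x = trans (cong (λ y → a + b + x * y) (eval-addP p q x)) (rearr a b x _ _)
    where
    rearr : ∀ a b x y z → a + b + x * (y + z) ≡ (a + x * y) + (b + x * z)
    rearr = solve-∀ ringℚ

  eval-scaleP : ∀ c p x → evalPoly (scaleP c p) x ≡ c * evalPoly p x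
  eval-scaleP c [] x = sym (ℚP.*-zeroʳ c)
  eval-scaleP c (a ∷ p) x = trans (cong (λ y → c * a + x * y) (eval-scaleP c p x)) (rearr c a x _)
    where
    rearr : ∀ c a x y → c * a + x * (c * y) ≡ c * (a + x * y)
    rearr = solve-∀ ringℚ

  eval-mulP : ∀ p q x → evalPoly (mulP p q) x ≡ evalPoly p x * evalPoly q x
  eval-mulP [] q x = sym (ℚP.*-zeroˡ (evalPoly q x))
  eval-mulP (a ∷ p) q x = trans (eval-addP (scaleP a q) (0ℚ ∷ mulP p q) x)
    (trans (cong₂ (λ y z → y + (0ℚ + x * z)) (eval-scaleP a q x) (eval-mulP p q x)) (rearr a x _ _))
    where
    rearr : ∀ a x y z → a * z + (0ℚ + x * (y * z)) ≡ (a + x * y) * z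
    rearr = solve-∀ ringℚ

  eval-shift : ∀ k p t → evalPoly (replicate k 0ℚ ++ p) (ι t) ≡ ι (t ℕ.^ k) * evalPoly p (ι t)
  eval-shift zero p t = sym (ℚP.*-identityˡ _)
  eval-shift (suc k) p t = trans (cong (λ y → 0ℚ + ι t * y) (eval-shift k p t))
    (trans (rearr (ι t) _ _) (cong (_* evalPoly p (ι t)) (sym (ι-^-suc t k))))
    where
    rearr : ∀ a b c → 0ℚ + a * (b * c) ≡ a * b * c
    rearr = solve-∀ ringℚ

  -- f is a polynomial with f(t) = c t^r + O(t^{r+1}); c may be zero.
  record Lead (r : ℕ) (c : ℚ) (f : ℕ → ℚ) : Set where
    constructor lead
    field
      tail : List ℚ
      expansion : ∀ t → f t ≡ ι (t ℕ.^ r) * (c + ι t * evalPoly tail (ι t))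

  Lead-const : ∀ c → Lead 0 c (λ _ → c)
  Lead-const c = lead [] λ t → rearr c (ι t)
    where
    rearr : ∀ c x → c ≡ 1ℚ * (c + x * 0ℚ)
    rearr = solve-∀ ringℚ

  Lead-zero : ∀ r → Lead r 0ℚ (λ _ → 0ℚ)
  Lead-zero r = lead [] λ t → rearr (ι (t ℕ.^ r)) (ι t)
    where
    rearr : ∀ c x → 0ℚ ≡ c * (0ℚ + x * 0ℚ)
    rearr = solve-∀ ringℚ

  Lead-+ : ∀ {r c d f g} → Lead r c f → Lead r d g → Lead r (c + d) (λ t → f t + g t)
  Lead-+ {r} {c} {d} (lead p ep) (lead q eq) = lead (addP p q) λ t →
    trans (cong₂ _+_ (ep t) (eq t))
      (trans (rearr (ι (t ℕ.^ r)) c d (ι t) _ _)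
        (cong (λ y → ι (t ℕ.^ r) * (c + d + ι t * y)) (sym (eval-addP p q (ι t)))))
    where
    rearr : ∀ a c d x y z → a * (c + x * y) + a * (d + x * z) ≡ a * (c + d + x * (y + z))
    rearr = solve-∀ ringℚ

  Lead-* : ∀ {r s c d f g} → Lead r c f → Lead s d g → Lead (r ℕ.+ s) (c * d) (λ t → f t * g t)
  Lead-* {r} {s} {c} {d} (lead p ep) (lead q eq) = lead (addP (addP (scaleP c q) (scaleP d p)) (0ℚ ∷ mulP p q)) λ t →
    trans (cong₂ _*_ (ep t) (eq t))
      (trans (rearr (ι (t ℕ.^ r)) (ι (t ℕ.^ s)) c d (ι t) (evalPoly p (ι t)) (evalPoly q (ι t)))
        (cong₂ (λ a y → a * (c * d + ι t * y))
          (sym (trans (cong ι (ℕP.^-distribˡ-+-* t r s)) (ι-* (t ℕ.^ r) (t ℕ.^ s))))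
          (sym (trans (eval-addP (addP (scaleP c q) (scaleP d p)) (0ℚ ∷ mulP p q) (ι t))
            (cong₂ (λ y z → y + (0ℚ + ι t * z))
              (trans (eval-addP (scaleP c q) (scaleP d p) (ι t))
                (cong₂ _+_ (eval-scaleP c q (ι t)) (eval-scaleP d p (ι t))))
              (eval-mulP p q (ι t)))))))
    where
    rearr : ∀ a b c d x y z → a * (c + x * y) * (b * (d + x * z)) ≡
      a * b * (c * d + x * (c * z + d * y + (0ℚ + x * (y * z))))
    rearr = solve-∀ ringℚ

  Lead-cong : ∀ {r c d f g} → c ≡ d → (∀ t → g t ≡ f t) → Lead r c f → Lead r d g
  Lead-cong refl e (lead q p) = lead q λ t → trans (e t) (p t)

  Lead-sum : ∀ {r} n {c : ℕ → ℚ} {f : ℕ → ℕ → ℚ} → (∀ i → i < n → Lead r (c i) (λ t → f t i)) →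
    Lead r (sumTo n c) (λ t → sumTo n (f t))
  Lead-sum {r} zero l = Lead-zero r
  Lead-sum (suc n) {c} {f} l =
    Lead-+ (l 0 (s≤s z≤n)) (Lead-sum n {c ∘ suc} {λ t → f t ∘ suc} λ i i<n → l (suc i) (s≤s i<n))

  sumℕ : ℕ → (ℕ → ℕ) → ℕ
  sumℕ zero ρ = 0
  sumℕ (suc n) ρ = ρ 0 ℕ.+ sumℕ n (ρ ∘ suc)

  -- Every product in the expansion takes one entry from each row, so the orders of the rows add up
  -- and the leading coefficients multiply.
  dt-Lead : ∀ n (ρ : ℕ → ℕ) (L : Matrix) (M : ℕ → Matrix) →
    (∀ i j → i < n → j < n → Lead (ρ i) (L i j) (λ t → M t i j)) →
    Lead (sumℕ n ρ) (dt n L) (λ t → dt n (M t))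
  dt-Lead zero ρ L M l = Lead-const 1ℚ
  dt-Lead (suc n) ρ L M l = Lead-sum (suc n) {cofactorTerm n L} {λ t → cofactorTerm n (M t)} λ j j<n →
    Lead-* (Lead-* (Lead-const (altSign j)) (l 0 j (s≤s z≤n) j<n))
      (dt-Lead n (ρ ∘ suc) (minor 0 j L) (λ t → minor 0 j (M t))
        λ i k i<n k<n → l (suc i) (skip j k) (s≤s i<n) (skip-bound j k<n))

  -- The d-th difference of f vanishes: f is a polynomial of degree less than d.
  Deg : ℕ → (ℕ → ℚ) → Set
  Deg zero f = ∀ x → f x ≡ 0ℚ
  Deg (suc d) f = Deg d (λ x → f (suc x) - f x)

  Deg-cong : ∀ d {f g} → (∀ x → f x ≡ g x) → Deg d f → Deg d g
  Deg-cong zero e p x = trans (sym (e x)) (p x)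
  Deg-cong (suc d) e p = Deg-cong d (λ x → cong₂ _-_ (e (suc x)) (e x)) p

  Deg-+ : ∀ d {f g} → Deg d f → Deg d g → Deg d (λ x → f x + g x)
  Deg-+ zero p q x = trans (cong₂ _+_ (p x) (q x)) (ℚP.+-identityˡ 0ℚ)
  Deg-+ (suc d) {f} {g} p q = Deg-cong d (λ x → rearr (f (suc x)) (f x) (g (suc x)) (g x)) (Deg-+ d p q)
    where
    rearr : ∀ a b c d → (a - b) + (c - d) ≡ (a + c) - (b + d)
    rearr = solve-∀ ringℚ

  Deg-suc : ∀ d {f} → Deg d f → Deg (suc d) f
  Deg-suc zero p x = cong₂ _-_ (p (suc x)) (p x)
  Deg-suc (suc d) p = Deg-suc d p

  Deg-shift : ∀ d {f} → Deg d f → Deg d (f ∘ suc)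
  Deg-shift zero p x = p (suc x)
  Deg-shift (suc d) p = Deg-shift d p

  Deg-const : ∀ d c → Deg (suc d) (λ _ → c)
  Deg-const zero c x = ℚP.+-inverseʳ c
  Deg-const (suc d) c = Deg-suc (suc d) {λ _ → c} (Deg-const d c)

  Deg-* : ∀ d {f} → Deg d f → Deg (suc d) (λ x → ι x * f x)
  Deg-* zero {f} p x = trans (cong₂ (λ a b → ι (suc x) * a - ι x * b) (p (suc x)) (p x)) (rearr (ι (suc x)) (ι x))
    where
    rearr : ∀ a b → a * 0ℚ - b * 0ℚ ≡ 0ℚ
    rearr = solve-∀ ringℚ
  Deg-* (suc d) {f} p = Deg-cong (suc d)
    (λ x → trans (rearr (ι x) (f (suc x)) (f x)) (cong (λ y → y * f (suc x) - ι x * f x) (sym (ι-suc x))))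
    (Deg-+ (suc d) {λ x → ι x * (f (suc x) - f x)} {f ∘ suc} (Deg-* d p) (Deg-shift (suc d) {f} p))
    where
    rearr : ∀ i a b → i * (a - b) + a ≡ (1ℚ + i) * a - i * b
    rearr = solve-∀ ringℚ

  evalPoly-Deg : ∀ p → Deg (length p) (λ x → evalPoly p (ι x))
  evalPoly-Deg [] x = refl
  evalPoly-Deg (c ∷ p) = Deg-+ (suc (length p)) {λ _ → c} (Deg-const (length p) c) (Deg-* (length p) (evalPoly-Deg p))

  -- The difference of `f` also vanishes at positive arguments and has smaller degree, so by
  -- induction it vanishes at 0, where it equals `f 1 - f 0`. This replaces a count of roots.
  Deg-vanish : ∀ d {f} → Deg d f → (∀ t → f (suc t) ≡ 0ℚ) → f 0 ≡ 0ℚ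
  Deg-vanish zero p z = p 0
  Deg-vanish (suc d) {f} p z = trans (sym (rearr (f 1) (f 0)))
    (cong₂ _-_ (z 0) (Deg-vanish d p λ t → cong₂ _-_ (z (suc t)) (z t)))
    where
    rearr : ∀ a b → a - (a - b) ≡ b
    rearr = solve-∀ ringℚ

  -- A power of t can be cancelled only at positive t; this recovers the value at 0 after such a
  -- cancellation.
  evalPoly-unique₀ : ∀ p q → (∀ t → evalPoly p (ι (suc t)) ≡ evalPoly q (ι (suc t))) →
    evalPoly p (ι 0) ≡ evalPoly q (ι 0)
  evalPoly-unique₀ p q e = trans (rearr (evalPoly p (ι 0)) (evalPoly q (ι 0)))
    (trans (cong (_+ evalPoly q (ι 0)) (trans (sym (eval-diff (ι 0)))
      (Deg-vanish (length r) (evalPoly-Deg r) λ t →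
        trans (eval-diff (ι (suc t))) (trans (cong (λ x → x + - 1ℚ * evalPoly q (ι (suc t))) (e t)) (cancel (evalPoly q (ι (suc t))))))))
      (ℚP.+-identityˡ _))
    where
    r = addP p (scaleP (- 1ℚ) q)
    eval-diff : ∀ x → evalPoly r x ≡ evalPoly p x + - 1ℚ * evalPoly q x
    eval-diff x = trans (eval-addP p (scaleP (- 1ℚ) q) x) (cong (evalPoly p x +_) (eval-scaleP (- 1ℚ) q x))
    rearr : ∀ a b → a ≡ (a + - 1ℚ * b) + b
    rearr = solve-∀ ringℚ
    cancel : ∀ a → a + - 1ℚ * a ≡ 0ℚ
    cancel = solve-∀ ringℚ

  -- Cancelling `t^r` leaves `c + t p(t) = t^(k+1) q(t)` for positive t, hence also at 0, where only
  -- `c` remains.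
  Lead-divisible⇒0 : ∀ r k {c f} q → Lead r c f →
    (∀ t → ι (t ℕ.^ (suc k ℕ.+ r)) * evalPoly q (ι t) ≡ f t) → c ≡ 0ℚ
  Lead-divisible⇒0 r k {c} {f} q (lead p ep) e = trans (sym (at0 (evalPoly p (ι 0)) c))
    (trans (evalPoly-unique₀ (c ∷ p) (replicate (suc k) 0ℚ ++ q) λ t → cancel-ι^ t r
      (trans (sym (ep (suc t))) (trans (sym (e (suc t)))
        (trans (cong (_* evalPoly q (ι (suc t)))
          (trans (cong ι (ℕP.^-distribˡ-+-* (suc t) (suc k) r))
            (trans (ι-* (suc t ℕ.^ suc k) (suc t ℕ.^ r)) (ℚP.*-comm (ι (suc t ℕ.^ suc k)) (ι (suc t ℕ.^ r))))))
          (trans (ℚP.*-assoc (ι (suc t ℕ.^ r)) (ι (suc t ℕ.^ suc k)) (evalPoly q (ι (suc t))))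
            (cong (ι (suc t ℕ.^ r) *_) (sym (eval-shift (suc k) q (suc t)))))))))
      (at0 (evalPoly (replicate k 0ℚ ++ q) (ι 0)) 0ℚ))
    where
    at0 : ∀ y c → c + 0ℚ * y ≡ c
    at0 y c = trans (cong (c +_) (ℚP.*-zeroˡ y)) (ℚP.+-identityʳ c)

  -- Division by t, one coefficient at a time: the value at 0 kills the constant coefficient, and
  -- the quotient is divisible by one power less. Applied to a nonzero count, it bounds the
  -- exponents that can divide it.
  highDivisible⇒0 : ∀ Q e {f : ℕ → ℚ} q → length Q ≤ e → (∀ t → f t ≡ evalPoly Q (ι t)) →
    (∀ t → ι (t ℕ.^ e) * evalPoly q (ι t) ≡ f t) → ∀ t → f t ≡ 0ℚ
  highDivisible⇒0 [] e q _ fQ _ t = fQ t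
  highDivisible⇒0 (c ∷ Q) (suc e) {f} q (s≤s l) fQ fe t = trans (fQ t)
    (trans (cong₂ (λ x y → x + ι t * y) c≡0
      (highDivisible⇒0 Q e {λ t → evalPoly Q (ι t)} q l (λ _ → refl) (λ { zero → at0 ; (suc t) → atSuc t }) t))
      (trans (ℚP.+-identityˡ _) (ℚP.*-zeroʳ (ι t))))
    where
    c≡0 : c ≡ 0ℚ
    c≡0 = trans (sym (trans (cong (c +_) (ℚP.*-zeroˡ (evalPoly Q (ι 0)))) (ℚP.+-identityʳ c)))
      (trans (sym (fQ 0)) (trans (sym (fe 0)) (ℚP.*-zeroˡ (evalPoly q (ι 0)))))
    atSuc : ∀ t → ι (suc t ℕ.^ e) * evalPoly q (ι (suc t)) ≡ evalPoly Q (ι (suc t))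
    atSuc t = cancel-ι t (trans (sym (ℚP.*-assoc (ι (suc t)) (ι (suc t ℕ.^ e)) (evalPoly q (ι (suc t)))))
      (trans (cong (_* evalPoly q (ι (suc t))) (sym (ι-^-suc (suc t) e)))
        (trans (fe (suc t)) (trans (fQ (suc t))
          (trans (cong (_+ ι (suc t) * evalPoly Q (ι (suc t))) c≡0) (ℚP.+-identityˡ (ι (suc t) * evalPoly Q (ι (suc t)))))))))
    at0 : ι (0 ℕ.^ e) * evalPoly q (ι 0) ≡ evalPoly Q (ι 0)
    at0 = trans (sym (eval-shift e q 0))
      (evalPoly-unique₀ (replicate e 0ℚ ++ q) Q λ t → trans (eval-shift e q (suc t)) (atSuc t))

  -- h t k = h_k(1^t)
  h : ℕ → ℕ → ℚ
  h t zero = 1ℚ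
  h zero (suc k) = 0ℚ
  h (suc t) (suc k) = h (suc t) k + h t (suc k)

  -- Since h_k(1^t) is the binomial coefficient of t + k - 1 over k, these are the ratios of
  -- neighbouring binomials in k and in t. Each is needed in the Pascal recursion for the other.
  h-sucʳ : ∀ t k → ι (suc k) * h t (suc k) ≡ (ι t + ι k) * h t k
  h-sucˡ : ∀ t k → ι t * h (suc t) k ≡ (ι t + ι k) * h t k
  h-sucʳ zero zero = refl
  h-sucʳ zero (suc k) = trans (ℚP.*-zeroʳ (ι (suc (suc k)))) (sym (ℚP.*-zeroʳ (0ℚ + ι (suc k))))
  h-sucʳ (suc t) k = begin
    ι (suc k) * (h (suc t) k + h t (suc k)) ≡⟨ ℚP.*-distribˡ-+ (ι (suc k)) _ _ ⟩
    ι (suc k) * h (suc t) k + ι (suc k) * h t (suc k)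
      ≡⟨ cong₂ _+_ (cong (_* h (suc t) k) (ι-suc k)) (trans (h-sucʳ t k) (sym (h-sucˡ t k))) ⟩
    (1ℚ + ι k) * h (suc t) k + ι t * h (suc t) k ≡⟨ rearr (ι k) (ι t) (h (suc t) k) ⟩
    (1ℚ + ι t + ι k) * h (suc t) k ≡⟨ cong (λ x → (x + ι k) * h (suc t) k) (sym (ι-suc t)) ⟩
    (ι (suc t) + ι k) * h (suc t) k ∎
    where
    open ≡-Reasoning
    rearr : ∀ k t x → (1ℚ + k) * x + t * x ≡ (1ℚ + t + k) * x
    rearr = solve-∀ ringℚ
  h-sucˡ t zero = cong (_* 1ℚ) (sym (ℚP.+-identityʳ (ι t)))
  h-sucˡ t (suc k) = begin
    ι t * (h (suc t) k + h t (suc k)) ≡⟨ ℚP.*-distribˡ-+ (ι t) _ _ ⟩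
    ι t * h (suc t) k + ι t * h t (suc k) ≡⟨ cong (_+ ι t * h t (suc k)) (trans (h-sucˡ t k) (sym (h-sucʳ t k))) ⟩
    ι (suc k) * h t (suc k) + ι t * h t (suc k) ≡⟨ rearr (ι (suc k)) (ι t) (h t (suc k)) ⟩
    (ι t + ι (suc k)) * h t (suc k) ∎
    where
    open ≡-Reasoning
    rearr : ∀ k t x → k * x + t * x ≡ (t + k) * x
    rearr = solve-∀ ringℚ

  -- By `h-sucʳ`, h_(k+2) is h_(k+1) times (t + k + 1) / (k + 2), and the constant term k + 1 of the
  -- numerator cancels the 1 / (k + 1) known by induction.
  h-Lead : ∀ k → Lead 1 (recip (ℤ.+ suc k)) (λ t → h t (suc k))
  h-Lead zero = lead [] λ t → trans (sym (ℚP.*-identityˡ (h t 1)))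
    (trans (h-sucʳ t 0) (trans (rearr (ι t)) (cong (λ x → ι x * (1ℚ + ι t * 0ℚ)) (sym (ℕP.*-identityʳ t)))))
    where
    rearr : ∀ x → (x + 0ℚ) * 1ℚ ≡ x * (1ℚ + x * 0ℚ)
    rearr = solve-∀ ringℚ
  h-Lead (suc k) = Lead-cong
    (trans (ℚP.*-assoc R (ι (suc k)) _) (trans (cong (R *_) (ι-recip k)) (ℚP.*-identityʳ R)))
    (λ t → cancel-ι (suc k) (trans (h-sucʳ t (suc k)) (sym (trans (sym (ℚP.*-assoc (ι (suc (suc k))) (R * (ι t + ι (suc k))) (h t (suc k))))
      (cong (_* h t (suc k)) (trans (sym (ℚP.*-assoc (ι (suc (suc k))) R (ι t + ι (suc k))))
        (trans (cong (_* (ι t + ι (suc k))) (ι-recip (suc k))) (ℚP.*-identityˡ (ι t + ι (suc k))))))))))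
    (Lead-* (Lead-* (Lead-const R) linear) (h-Lead k))
    where
    R = recip (ℤ.+ suc (suc k))
    rearr : ∀ x y → x + y ≡ 1ℚ * (y + x * (1ℚ + x * 0ℚ))
    rearr = solve-∀ ringℚ
    linear : Lead 0 (ι (suc k)) (λ t → ι t + ι (suc k))
    linear = lead (1ℚ ∷ []) λ t → rearr (ι t) (ι (suc k))

open LeadingTerm

-- Branching of the Jacobi-Trudi determinant in the number of variables

module ColumnExpansion where

  open import Data.Rational using (_+_; _*_; -_; _-_)

  -- H t a b = h_{a-b}(1^t), zero when a < b
  H : ℕ → ℕ → ℕ → ℚ
  H t a zero = h t a
  H t zero (suc b) = 0ℚ
  H t (suc a) (suc b) = H t a b

  -- The rule h_k(1^(t+1)) = h_k(1^t) + h_(k-1)(1^(t+1)), read as a step of the column parameter;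
  -- this is the recurrence fed to `telescope`.
  H-suc : ∀ t a b → H (suc t) a b ≡ H t a b + H (suc t) a (suc b)
  H-suc t zero zero = refl
  H-suc t (suc a) zero = ℚP.+-comm (h (suc t) a) (h t (suc a))
  H-suc t zero (suc b) = refl
  H-suc t (suc a) (suc b) = H-suc t a b

  H-< : ∀ t {a b} → a < b → H t a b ≡ 0ℚ
  H-< t {zero} {suc b} _ = refl
  H-< t {suc a} {suc b} (s≤s p) = H-< t p

  H-≥ : ∀ t {a b} → b ≤ a → H t a b ≡ h t (a ∸ b)
  H-≥ t {a} {zero} _ = refl
  H-≥ t {suc a} {suc b} (s≤s p) = H-≥ t p

  infixr 5 _∷ₛ_ _++ₛ_
  _∷ₛ_ : {A : Set} → A → (ℕ → A) → ℕ → A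
  (x ∷ₛ s) zero = x
  (x ∷ₛ s) (suc j) = s j

  -- the sum of f over all ν with lo j ≤ ν j < lo j + w j for j < n
  MSum : ℕ → (lo w : ℕ → ℕ) → ((ℕ → ℕ) → ℚ) → ℚ
  MSum zero lo w f = f (λ _ → 0)
  MSum (suc n) lo w f = sumTo (w 0) λ m → MSum n (lo ∘ suc) (w ∘ suc) (λ ν → f ((lo 0 ℕ.+ m) ∷ₛ ν))

  MSum-cong : ∀ n {lo w w' f g} → (∀ j → j < n → w j ≡ w' j) →
    (∀ ν → (∀ j → j < n → lo j ≤ ν j × ν j < lo j ℕ.+ w j) → f ν ≡ g ν) → MSum n lo w f ≡ MSum n lo w' g
  MSum-cong zero ew e = e _ λ _ ()
  MSum-cong (suc n) {lo} {w} {w'} {f} {g} ew e = trans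
    (cong (λ k → sumTo k λ m → MSum n (lo ∘ suc) (w ∘ suc) (λ ν → f ((lo 0 ℕ.+ m) ∷ₛ ν))) (ew 0 (s≤s z≤n)))
    (sumTo-cong (w' 0) λ m m<w → MSum-cong n (λ j j<n → ew (suc j) (s≤s j<n)) λ ν b →
      e _ λ { zero _ → ℕP.m≤m+n (lo 0) m , ℕP.+-monoʳ-< (lo 0) (subst (m <_) (sym (ew 0 (s≤s z≤n))) m<w)
            ; (suc j) (s≤s j<n) → b j j<n })

  MSum-sumTo : ∀ n lo w k (f : ℕ → (ℕ → ℕ) → ℚ) →
    MSum n lo w (λ ν → sumTo k (λ m → f m ν)) ≡ sumTo k (λ m → MSum n lo w (f m))
  MSum-sumTo zero lo w k f = refl
  MSum-sumTo (suc n) lo w k f = trans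
    (sumTo-cong (w 0) λ m _ → MSum-sumTo n (lo ∘ suc) (w ∘ suc) k λ i ν → f i ((lo 0 ℕ.+ m) ∷ₛ ν))
    (sumTo-swap (w 0) k _)

  MSum-* : ∀ n lo w c f → MSum n lo w (λ ν → c * f ν) ≡ c * MSum n lo w f
  MSum-* zero lo w c f = refl
  MSum-* (suc n) lo w c f = trans
    (sumTo-cong (w 0) λ m _ → MSum-* n (lo ∘ suc) (w ∘ suc) c λ ν → f ((lo 0 ℕ.+ m) ∷ₛ ν))
    (sumTo-*ˡ (w 0) c _)

  Column : Set
  Column = ℕ → ℚ

  _++ₛ_ : {A : Set} → List A → (ℕ → A) → ℕ → A
  ([] ++ₛ r) j = r j
  ((c ∷ cs) ++ₛ r) zero = c
  ((c ∷ cs) ++ₛ r) (suc j) = (cs ++ₛ r) j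

  -- Φ is additive in each of its first n columns, depends on no others, and vanishes when one
  -- of these columns repeats the one before it (p for the first).
  Alternating : ℕ → Column → ((ℕ → Column) → ℚ) → Set
  Alternating zero p Φ = ∀ r r' → Φ r ≡ Φ r'
  Alternating (suc n) p Φ =
    (∀ r → Φ (p ∷ₛ r) ≡ 0ℚ) ×
    (∀ u v w r → (∀ i → w i ≡ u i + v i) → Φ (w ∷ₛ r) ≡ Φ (u ∷ₛ r) + Φ (v ∷ₛ r)) ×
    (∀ c → Alternating n c (λ r → Φ (c ∷ₛ r)))

  Alternating-cong : ∀ n {p Φ Ψ} → (∀ r → Φ r ≡ Ψ r) → Alternating n p Φ → Alternating n p Ψ
  Alternating-cong zero e a r r' = trans (sym (e r)) (trans (a r r') (e r'))
  Alternating-cong (suc n) e (z , l , s) =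
    (λ r → trans (sym (e _)) (z r)) ,
    (λ u v w r q → trans (sym (e _)) (trans (l u v w r q) (cong₂ _+_ (e _) (e _)))) ,
    λ c → Alternating-cong n (λ r → e (c ∷ₛ r)) (s c)

  Extensional : ((ℕ → Column) → ℚ) → Set
  Extensional Φ = ∀ r r' → (∀ j i → r j i ≡ r' j i) → Φ r ≡ Φ r'

  ∷ₛ-cong : ∀ {r r' : ℕ → Column} {c c'} → (∀ i → c i ≡ c' i) → (∀ j i → r j i ≡ r' j i) →
    ∀ j i → (c ∷ₛ r) j i ≡ (c' ∷ₛ r') j i
  ∷ₛ-cong e e' zero i = e i
  ∷ₛ-cong e e' (suc j) i = e' j i

  -- The columns are replaced from right to left: subtracting from each the one before it
  -- leaves a telescoping sum.
  telescope : ∀ n Φ p (lo w : ℕ → ℕ) (F K : ℕ → ℕ → Column) → Extensional Φ → Alternating n p Φ →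
    (∀ j x i → F j x i ≡ K j x i + F j (suc x) i) →
    (∀ j → j < n → ∀ i → F j (lo j ℕ.+ w j) i ≡ (p ∷ₛ (λ j → F j (lo j))) j i) →
    Φ (λ j → F j (lo j)) ≡ MSum n lo w (λ ν → Φ (λ j → K j (ν j)))
  telescope zero Φ p lo w F K ext alt recurrence end = alt _ _
  telescope (suc n) Φ p lo w F K ext (z , l , alt) recurrence end = begin
    Φ (λ j → F j (lo j))
      ≡⟨ ext _ _ (λ { zero i → refl ; (suc j) i → refl }) ⟩
    Φ (F 0 (lo 0) ∷ₛ λ j → F (suc j) (lo (suc j)))
      -- The later columns are expanded while the first is still `F 0 (lo 0)`: this is the column
      -- that the leftover of the second one repeats.
      ≡⟨ telescope n (λ r → Φ (F 0 (lo 0) ∷ₛ r)) (F 0 (lo 0)) (lo ∘ suc) (w ∘ suc) (F ∘ suc) (K ∘ suc)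
          (λ r r' e → ext _ _ (∷ₛ-cong (λ _ → refl) e)) (alt (F 0 (lo 0))) (recurrence ∘ suc)
          (λ { zero j<n i → end 1 (s≤s j<n) i ; (suc j) j<n i → end (suc (suc j)) (s≤s j<n) i }) ⟩
    MSum n (lo ∘ suc) (w ∘ suc) (λ ν → Φ (F 0 (lo 0) ∷ₛ λ j → K (suc j) (ν j)))
      ≡⟨ MSum-cong n (λ _ _ → refl) (λ ν _ → first (w 0) (lo 0) (λ j → K (suc j) (ν j)) (end 0 (s≤s z≤n))) ⟩
    MSum n (lo ∘ suc) (w ∘ suc) (λ ν → sumTo (w 0) (λ m → Φ (K 0 (lo 0 ℕ.+ m) ∷ₛ λ j → K (suc j) (ν j))))
      ≡⟨ MSum-sumTo n (lo ∘ suc) (w ∘ suc) (w 0) _ ⟩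
    sumTo (w 0) (λ m → MSum n (lo ∘ suc) (w ∘ suc) (λ ν → Φ (K 0 (lo 0 ℕ.+ m) ∷ₛ λ j → K (suc j) (ν j))))
      ≡⟨ sumTo-cong (w 0) (λ m _ → MSum-cong n (λ _ _ → refl) λ ν _ →
          ext _ _ (λ { zero i → refl ; (suc j) i → refl })) ⟩
    MSum (suc n) lo w (λ ν → Φ (λ j → K j (ν j))) ∎
    where
    open ≡-Reasoning
    -- After `d` uses of the recurrence the leftover column is `p`, on which Φ vanishes.
    first : ∀ d x r → (∀ i → F 0 (x ℕ.+ d) i ≡ p i) →
      Φ (F 0 x ∷ₛ r) ≡ sumTo d (λ m → Φ (K 0 (x ℕ.+ m) ∷ₛ r))
    first zero x r e = trans (ext _ _ (∷ₛ-cong (λ i → trans (cong (λ y → F 0 y i) (sym (ℕP.+-identityʳ x))) (e i)) (λ _ _ → refl))) (z r)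
    first (suc d) x r e = trans (l (K 0 x) (F 0 (suc x)) (F 0 x) r (recurrence 0 x)) (cong₂ _+_
      (cong (λ y → Φ (K 0 y ∷ₛ r)) (sym (ℕP.+-identityʳ x)))
      (trans (first d (suc x) r λ i → trans (cong (λ y → F 0 y i) (sym (ℕP.+-suc x d))) (e i))
        (sumTo-cong d λ m _ → cong (λ y → Φ (K 0 y ∷ₛ r)) (sym (ℕP.+-suc x m)))))

  ++ₛ-at : ∀ {A : Set} (pre : List A) r j → (pre ++ₛ r) (length pre ℕ.+ j) ≡ r j
  ++ₛ-at [] r j = refl
  ++ₛ-at (c ∷ pre) r j = ++ₛ-at pre r j

  ++ₛ-here : ∀ {A : Set} (pre : List A) r → (pre ++ₛ r) (length pre) ≡ r 0
  ++ₛ-here pre r = trans (cong (pre ++ₛ r) (sym (ℕP.+-identityʳ (length pre)))) (++ₛ-at pre r 0)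

  ++ₛ-off : ∀ {A : Set} (pre : List A) {c c'} r j → j ≢ length pre → (pre ++ₛ c ∷ₛ r) j ≡ (pre ++ₛ c' ∷ₛ r) j
  ++ₛ-off [] r zero ne = ⊥-elim (ne refl)
  ++ₛ-off [] r (suc j) ne = refl
  ++ₛ-off (x ∷ pre) r zero ne = refl
  ++ₛ-off (x ∷ pre) r (suc j) ne = ++ₛ-off pre r j (ne ∘ cong suc)

  ++ₛ-before : ∀ {A : Set} (pre : List A) r r' j → j < length pre → (pre ++ₛ r) j ≡ (pre ++ₛ r') j
  ++ₛ-before (x ∷ pre) r r' zero _ = refl
  ++ₛ-before (x ∷ pre) r r' (suc j) (s≤s p) = ++ₛ-before pre r r' j p

  ++ₛ-snoc : ∀ {A : Set} (pre : List A) c r j → ((pre ∷ʳ c) ++ₛ r) j ≡ (pre ++ₛ c ∷ₛ r) j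
  ++ₛ-snoc [] c r zero = refl
  ++ₛ-snoc [] c r (suc j) = refl
  ++ₛ-snoc (x ∷ pre) c r zero = refl
  ++ₛ-snoc (x ∷ pre) c r (suc j) = ++ₛ-snoc pre c r j

  length-snoc : ∀ {A : Set} (pre : List A) c → length (pre ∷ʳ c) ≡ suc (length pre)
  length-snoc pre c = trans (ListP.length-++ pre) (ℕP.+-comm (length pre) 1)

  module _ (N : ℕ) where

    detAfter : List Column → (ℕ → Column) → ℚ
    detAfter pre r = dt N (λ i j → (pre ++ₛ r) j i)

    detAfter-+ : ∀ pre → length pre < N → ∀ u v w r → (∀ i → w i ≡ u i + v i) →
      detAfter pre (w ∷ₛ r) ≡ detAfter pre (u ∷ₛ r) + detAfter pre (v ∷ₛ r)
    detAfter-+ pre p<N u v w r e = dt-+ N _ _ _ (length pre) p<N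
      (λ i → trans (cong-app (++ₛ-here pre (w ∷ₛ r)) i) (trans (e i)
        (sym (cong₂ _+_ (cong-app (++ₛ-here pre (u ∷ₛ r)) i) (cong-app (++ₛ-here pre (v ∷ₛ r)) i)))))
      (λ i k ne → cong-app (++ₛ-off pre r k ne) i) (λ i k ne → cong-app (++ₛ-off pre r k ne) i)

    detAfter-snoc : ∀ pre c r → detAfter (pre ∷ʳ c) r ≡ detAfter pre (c ∷ₛ r)
    detAfter-snoc pre c r = dt-cong N λ i j _ _ → cong-app (++ₛ-snoc pre c r j) i

    detAfter-alternating : ∀ n pre p → suc (length pre) ℕ.+ n ≡ N → Alternating n p (detAfter (pre ∷ʳ p))
    detAfter-alternating zero pre p e r r' = dt-cong N λ i j _ j<N → cong-app (++ₛ-before (pre ∷ʳ p) r r' j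
      (subst (j <_) (trans (sym e) (trans (ℕP.+-identityʳ _) (sym (length-snoc pre p)))) j<N)) i
    detAfter-alternating (suc n) pre p e =
      (λ r → dt-alternating N _ (length pre) lt λ i →
        trans (cong-app (trans (++ₛ-snoc pre p (p ∷ₛ r) (length pre)) (++ₛ-here pre (p ∷ₛ p ∷ₛ r))) i)
          (sym (cong-app (trans (cong ((pre ∷ʳ p) ++ₛ p ∷ₛ r) (sym (length-snoc pre p))) (++ₛ-here (pre ∷ʳ p) (p ∷ₛ r))) i))) ,
      detAfter-+ (pre ∷ʳ p) (subst (_< N) (sym (length-snoc pre p)) lt) ,
      λ c → Alternating-cong n (detAfter-snoc (pre ∷ʳ p) c) (detAfter-alternating n (pre ∷ʳ p) c
        (trans (cong (λ x → suc x ℕ.+ n) (length-snoc pre p)) (trans (sym (ℕP.+-suc (suc (length pre)) n)) e)))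
      where
      lt : suc (length pre) < N
      lt = subst (suc (length pre) <_) e (ℕP.m<m+n (suc (length pre)) (s≤s z≤n))

  -- The first column has no predecessor; the zero column takes that role, since it too makes the
  -- determinant vanish.
  dt-columns-alternating : ∀ n → Alternating (suc n) (λ _ → 0ℚ) (detAfter (suc n) [])
  dt-columns-alternating n =
    (λ r → dt-zeroBlock (suc n) (λ i j → ((λ _ → 0ℚ) ∷ₛ r) j i) 0 (s≤s z≤n) λ { _ .0 _ z≤n → refl }) ,
    detAfter-+ (suc n) [] (s≤s z≤n) ,
    λ c → Alternating-cong n (detAfter-snoc (suc n) [] c) (detAfter-alternating (suc n) n [] c refl)

  Antitone : (ℕ → ℕ) → Set
  Antitone L = ∀ i → L (suc i) ≤ L i

  antitone-≤ : ∀ {L} → Antitone L → ∀ {i j} → i ≤ j → L j ≤ L i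
  antitone-≤ {L} a {i} {j} i≤j = subst (λ x → L x ≤ L i) (ℕP.m∸n+n≡m i≤j) (go (j ∸ i))
    where
    go : ∀ d → L (d ℕ.+ i) ≤ L i
    go zero = ℕP.≤-refl
    go (suc d) = ℕP.≤-trans (a (d ℕ.+ i)) (go d)

  -- The Jacobi–Trudi matrix of L/M at 1^t; adding N makes the shifted parts L i - i and M j - j natural.
  JT : ℕ → ℕ → (L M : ℕ → ℕ) → Matrix
  JT t N L M i j = H t (L i ℕ.+ (N ∸ i)) (M j ℕ.+ (N ∸ j))

  -- Row `j` of ν may reach up to the end of row `j - 1` of `M` (up to `u` for `j = 0`), so that ν/M
  -- is a horizontal strip; `suc` counts the endpoint.
  width : ℕ → (ℕ → ℕ) → ℕ → ℕ
  width u M j = suc ((u ∷ₛ M) j ∸ M j)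

  -- One step past `M j`, column `j + 1` coincides with column `j`, because the staircase shifts
  -- neighbouring columns by one; column 0 is zero one step past `L 0`, where all degrees are
  -- negative. These are the stopping points of the telescoping. The resulting ν need not lie below
  -- `L`.
  JT-suc : ∀ t N L M → Antitone L → M 0 ≤ L 0 → (∀ j → suc j < N → M (suc j) ≤ M j) →
    dt N (JT (suc t) N L M) ≡ MSum N M (width (L 0) M) (λ ν → dt N (JT t N L ν))
  JT-suc t zero L M _ _ _ = refl
  JT-suc t N@(suc n) L M La M≤L Ma = telescope N (detAfter N []) (λ _ → 0ℚ) M (width (L 0) M) (F (suc t)) (F t)
      (λ r r' e → dt-cong N λ i j _ _ → e j i) (dt-columns-alternating n)
      (λ j x i → H-suc t (L i ℕ.+ (N ∸ i)) (x ℕ.+ (N ∸ j))) end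
    where
    F : ℕ → ℕ → ℕ → Column
    F t j x i = H t (L i ℕ.+ (N ∸ i)) (x ℕ.+ (N ∸ j))
    end : ∀ j → j < N → ∀ i → F (suc t) j (M j ℕ.+ width (L 0) M j) i ≡ ((λ _ → 0ℚ) ∷ₛ λ j → F (suc t) j (M j)) j i
    end zero _ i = H-< (suc t) (subst (λ x → L i ℕ.+ (N ∸ i) < x ℕ.+ N)
      (sym (trans (ℕP.+-suc (M 0) _) (cong suc (ℕP.m+[n∸m]≡n M≤L))))
      (s≤s (ℕP.+-mono-≤ (antitone-≤ La z≤n) (ℕP.m∸n≤m N i))))
    end (suc j) sj<N i = cong (H (suc t) (L i ℕ.+ (N ∸ i))) (begin
      M (suc j) ℕ.+ suc (M j ∸ M (suc j)) ℕ.+ (n ∸ j)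
        ≡⟨ cong (ℕ._+ (n ∸ j)) (trans (ℕP.+-suc (M (suc j)) _) (cong suc (ℕP.m+[n∸m]≡n (Ma j sj<N)))) ⟩
      suc (M j) ℕ.+ (n ∸ j) ≡⟨ sym (ℕP.+-suc (M j) (n ∸ j)) ⟩
      M j ℕ.+ suc (n ∸ j) ≡⟨ cong (M j ℕ.+_) (sym (ℕP.+-∸-assoc 1 (ℕP.<⇒≤ (ℕ.s≤s⁻¹ sj<N)))) ⟩
      M j ℕ.+ (N ∸ j) ∎)
      where open ≡-Reasoning

open ColumnExpansion

-- Semistandard fillings counted row by row

module Filling where

  open import Data.Rational using (_+_; _*_; -_; _-_)

  ind : Bool → ℚ
  ind true = 1ℚ
  ind false = 0ℚ

  ind-∧ : ∀ a b → ind (a ∧ b) ≡ ind a * ind b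
  ind-∧ true b = sym (ℚP.*-identityˡ (ind b))
  ind-∧ false b = sym (ℚP.*-zeroˡ (ind b))

  ind-∧-* : ∀ a b x → ind (a ∧ b) * x ≡ ind a * (ind b * x)
  ind-∧-* a b x = trans (cong (_* x) (ind-∧ a b)) (ℚP.*-assoc (ind a) (ind b) x)

  T⇒≡true : ∀ {b} → T b → b ≡ true
  T⇒≡true {true} _ = refl

  T-extensional : ∀ {a b} → (T a → T b) → (T b → T a) → a ≡ b
  T-extensional {true} f g = sym (T⇒≡true (f tt))
  T-extensional {false} {true} f g = ⊥-elim (g tt)
  T-extensional {false} {false} f g = refl

  ifTrue-elim : ∀ g {e} → T g → T (if g then e else true) → T e
  ifTrue-elim true _ p = p

  ifTrue-intro : ∀ g {e} → (T g → T e) → T (if g then e else true)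
  ifTrue-intro true f = f tt
  ifTrue-intro false f = tt

  ∧-intro : ∀ {a b} → T a → T b → T (a ∧ b)
  ∧-intro p q = Equivalence.from BoolP.T-∧ (p , q)

  ∧-elim : ∀ {a b} → T (a ∧ b) → T a × T b
  ∧-elim = Equivalence.to BoolP.T-∧

  allᵇ-applyUpTo-elim : ∀ {A : Set} (p : A → Bool) f n → T (allᵇ p (applyUpTo f n)) → ∀ j → j < n → T (p (f j))
  allᵇ-applyUpTo-elim p f (suc n) t zero _ = proj₁ (∧-elim t)
  allᵇ-applyUpTo-elim p f (suc n) t (suc j) (s≤s q) = allᵇ-applyUpTo-elim p (f ∘ suc) n (proj₂ (∧-elim {p (f 0)} t)) j q

  allᵇ-applyUpTo-intro : ∀ {A : Set} (p : A → Bool) f n → (∀ j → j < n → T (p (f j))) → T (allᵇ p (applyUpTo f n))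
  allᵇ-applyUpTo-intro p f zero _ = tt
  allᵇ-applyUpTo-intro p f (suc n) e =
    ∧-intro (e 0 (s≤s z≤n)) (allᵇ-applyUpTo-intro p (f ∘ suc) n λ j q → e (suc j) (s≤s q))

  sumL : {A : Set} → List A → (A → ℚ) → ℚ
  sumL [] f = 0ℚ
  sumL (x ∷ xs) f = f x + sumL xs f

  sumL-++ : ∀ {A : Set} (xs ys : List A) f → sumL (xs ++ ys) f ≡ sumL xs f + sumL ys f
  sumL-++ [] ys f = sym (ℚP.+-identityˡ _)
  sumL-++ (x ∷ xs) ys f = trans (cong (f x +_) (sumL-++ xs ys f)) (sym (ℚP.+-assoc (f x) _ _))

  sumL-map : ∀ {A B : Set} (g : A → B) xs f → sumL (map g xs) f ≡ sumL xs (f ∘ g)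
  sumL-map g [] f = refl
  sumL-map g (x ∷ xs) f = cong (f (g x) +_) (sumL-map g xs f)

  sumL-concatMap : ∀ {A B : Set} (g : A → List B) xs f → sumL (concatMap g xs) f ≡ sumL xs (λ x → sumL (g x) f)
  sumL-concatMap g [] f = refl
  sumL-concatMap g (x ∷ xs) f = trans (sumL-++ (g x) _ f) (cong (sumL (g x) f +_) (sumL-concatMap g xs f))

  sumL-applyUpTo : ∀ {A : Set} (g : ℕ → A) n f → sumL (applyUpTo g n) f ≡ sumTo n (f ∘ g)
  sumL-applyUpTo g zero f = refl
  sumL-applyUpTo g (suc n) f = cong (f (g 0) +_) (sumL-applyUpTo (g ∘ suc) n f)

  sumL-cong : ∀ {A : Set} (xs : List A) {f g} → (∀ x → f x ≡ g x) → sumL xs f ≡ sumL xs g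
  sumL-cong [] e = refl
  sumL-cong (x ∷ xs) e = cong₂ _+_ (e x) (sumL-cong xs e)

  sumL-* : ∀ {A : Set} (xs : List A) c f → sumL xs (λ x → c * f x) ≡ c * sumL xs f
  sumL-* [] c f = sym (ℚP.*-zeroʳ c)
  sumL-* (x ∷ xs) c f = trans (cong (c * f x +_) (sumL-* xs c f)) (sym (ℚP.*-distribˡ-+ c (f x) _))

  length-filterᵇ : ∀ {A : Set} (p : A → Bool) xs → ι (length (filterᵇ p xs)) ≡ sumL xs (ind ∘ p)
  length-filterᵇ p [] = refl
  length-filterᵇ p (x ∷ xs) with p x
  ... | true = trans (ι-suc (length (filterᵇ p xs))) (cong (1ℚ +_) (length-filterᵇ p xs))
  ... | false = trans (length-filterᵇ p xs) (sym (ℚP.+-identityˡ _))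

  wordSum : ℕ → ℕ → (List ℕ → ℚ) → ℚ
  wordSum t zero f = f []
  wordSum t (suc k) f = sumTo t λ x → wordSum t k λ w → f (suc x ∷ w)

  sumL-words : ∀ t k f → sumL (words t k) f ≡ wordSum t k f
  sumL-words t zero f = ℚP.+-identityʳ (f [])
  sumL-words t (suc k) f = trans (sumL-concatMap (λ x → map (x ∷_) (words t k)) (map suc (upTo t)) f)
    (trans (sumL-map suc (upTo t) _) (trans (sumL-applyUpTo (λ x → x) t _)
      (sumTo-cong t λ x _ → trans (sumL-map (suc x ∷_) (words t k) f) (sumL-words t k λ w → f (suc x ∷ w)))))

  Word : ℕ → List ℕ → Set
  Word k w = length w ≡ k × (∀ i → i < k → 1 ≤ w ! i)

  wordSum-cong : ∀ t k {f g} → (∀ w → Word k w → f w ≡ g w) → wordSum t k f ≡ wordSum t k g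
  wordSum-cong t zero e = e [] (refl , λ _ ())
  wordSum-cong t (suc k) e = sumTo-cong t λ x _ → wordSum-cong t k λ w (l , p) →
    e (suc x ∷ w) (cong suc l , λ { zero _ → s≤s z≤n ; (suc i) (s≤s q) → p i q })

  wordSum-* : ∀ t k c f → wordSum t k (λ w → c * f w) ≡ c * wordSum t k f
  wordSum-* t zero c f = refl
  wordSum-* t (suc k) c f = trans (sumTo-cong t λ x _ → wordSum-* t k c λ w → f (suc x ∷ w)) (sumTo-*ˡ t c _)

  wordSum-zero : ∀ t k {f} → (∀ w → f w ≡ 0ℚ) → wordSum t k f ≡ 0ℚ
  wordSum-zero t zero e = e []
  wordSum-zero t (suc k) e = sumTo-zero t λ x _ → wordSum-zero t k λ w → e (suc x ∷ w)

  wordSum-MSum : ∀ t k n lo wd (f : List ℕ → (ℕ → ℕ) → ℚ) →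
    wordSum t k (λ w → MSum n lo wd (f w)) ≡ MSum n lo wd (λ ν → wordSum t k (λ w → f w ν))
  wordSum-MSum t zero n lo wd f = refl
  wordSum-MSum t (suc k) n lo wd f = trans
    (sumTo-cong t λ x _ → wordSum-MSum t k n lo wd λ w → f (suc x ∷ w))
    (sym (MSum-sumTo n lo wd t _))

  incSum : ℕ → ℕ → (List ℕ → ℚ) → ℚ
  incSum t k f = wordSum t k λ w → ind (weaklyIncᵇ w) * f w

  incSum-cong : ∀ t k {f g} → (∀ w → Word k w → f w ≡ g w) → incSum t k f ≡ incSum t k g
  incSum-cong t k e = wordSum-cong t k λ w p → cong (ind (weaklyIncᵇ w) *_) (e w p)

  incSum-* : ∀ t k c f → incSum t k (λ w → c * f w) ≡ c * incSum t k f
  incSum-* t k c f = trans (wordSum-cong t k λ w _ → rearr (ind (weaklyIncᵇ w)) c (f w)) (wordSum-* t k c _)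
    where
    rearr : ∀ a c x → a * (c * x) ≡ c * (a * x)
    rearr = solve-∀ ringℚ

  incSum-MSum : ∀ t k n lo wd (f : List ℕ → (ℕ → ℕ) → ℚ) →
    incSum t k (λ w → MSum n lo wd (f w)) ≡ MSum n lo wd (λ ν → incSum t k (λ w → f w ν))
  incSum-MSum t k n lo wd f = trans
    (wordSum-cong t k λ w _ → sym (MSum-* n lo wd (ind (weaklyIncᵇ w)) (f w)))
    (wordSum-MSum t k n lo wd _)

  weaklyInc-1∷ : ∀ {k} w → Word k w → weaklyIncᵇ (1 ∷ w) ≡ weaklyIncᵇ w
  weaklyInc-1∷ [] _ = refl
  weaklyInc-1∷ (suc y ∷ w) _ = refl
  weaklyInc-1∷ (zero ∷ w) (refl , p) with p 0 (s≤s z≤n)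
  ... | ()

  -- No 1 can follow a letter that is at least 2, so all letters can be lowered by one and the
  -- alphabet shrinks.
  wordSum-inc≥2 : ∀ t k x g →
    wordSum (suc t) k (λ w → ind (weaklyIncᵇ (suc (suc x) ∷ w)) * g w) ≡
    wordSum t k (λ w → ind (weaklyIncᵇ (suc x ∷ w)) * g (map suc w))
  wordSum-inc≥2 t zero x g = refl
  wordSum-inc≥2 t (suc k) x g = trans
    (cong₂ _+_ (wordSum-zero (suc t) k λ w → ℚP.*-zeroˡ (g (1 ∷ w)))
      (sumTo-cong t λ y _ → begin
        wordSum (suc t) k (λ w → ind ((x <ᵇ suc y) ∧ weaklyIncᵇ (suc (suc y) ∷ w)) * g (suc (suc y) ∷ w))
          ≡⟨ wordSum-cong (suc t) k (λ w _ → ind-∧-* (x <ᵇ suc y) (weaklyIncᵇ (suc (suc y) ∷ w)) (g (suc (suc y) ∷ w))) ⟩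
        wordSum (suc t) k (λ w → ind (x <ᵇ suc y) * (ind (weaklyIncᵇ (suc (suc y) ∷ w)) * g (suc (suc y) ∷ w)))
          ≡⟨ wordSum-* (suc t) k (ind (x <ᵇ suc y)) _ ⟩
        ind (x <ᵇ suc y) * wordSum (suc t) k (λ w → ind (weaklyIncᵇ (suc (suc y) ∷ w)) * g (suc (suc y) ∷ w))
          ≡⟨ cong (ind (x <ᵇ suc y) *_) (wordSum-inc≥2 t k y λ w → g (suc (suc y) ∷ w)) ⟩
        ind (x <ᵇ suc y) * wordSum t k (λ w → ind (weaklyIncᵇ (suc y ∷ w)) * g (suc (suc y) ∷ map suc w))
          ≡⟨ sym (wordSum-* t k (ind (x <ᵇ suc y)) _) ⟩
        wordSum t k (λ w → ind (x <ᵇ suc y) * (ind (weaklyIncᵇ (suc y ∷ w)) * g (suc (suc y) ∷ map suc w)))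
          ≡⟨ wordSum-cong t k (λ w _ → sym (ind-∧-* (x <ᵇ suc y) (weaklyIncᵇ (suc y ∷ w)) (g (suc (suc y) ∷ map suc w)))) ⟩
        wordSum t k (λ w → ind ((x <ᵇ suc y) ∧ weaklyIncᵇ (suc y ∷ w)) * g (suc (suc y) ∷ map suc w)) ∎))
    (ℚP.+-identityˡ _)
    where open ≡-Reasoning

  -- A weakly increasing word over 1..t+1 is 1^m followed by one over 2..t+1.
  incSum-suc : ∀ t k f →
    incSum (suc t) k f ≡ sumTo (suc k) (λ m → incSum t (k ∸ m) (λ w → f (replicate m 1 ++ map suc w)))
  incSum-suc t zero f = sym (ℚP.+-identityʳ _)
  incSum-suc t (suc k) f = trans
    (cong₂ _+_
      (trans (wordSum-cong (suc t) k λ w p → cong (λ b → ind b * f (1 ∷ w)) (weaklyInc-1∷ w p))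
        (incSum-suc t k λ w → f (1 ∷ w)))
      (sumTo-cong t λ x _ → wordSum-inc≥2 t k x λ w → f (suc (suc x) ∷ w)))
    (ℚP.+-comm _ (incSum t (suc k) λ w → f (map suc w)))

  -- This has literally the shape of the inner test of `isSSYTᵇ`, with the two rows as parameters,
  -- so the two agree by computation.
  colStrictᵇ : ℕ → ℕ → List ℕ → ℕ → ℕ → List ℕ → Bool
  colStrictᵇ mp lp wp m l w = allᵇ (λ j →
    if ((mp ≤ᵇ j) ∧ (j <ᵇ lp)) ∧ ((m ≤ᵇ j) ∧ (j <ᵇ l)) then wp ! (j ∸ mp) <ᵇ w ! (j ∸ m) else true) (upTo lp)

  ColStrict : ℕ → ℕ → List ℕ → ℕ → ℕ → List ℕ → Set
  ColStrict mp lp wp m l w = ∀ j → mp ≤ j → j < lp → m ≤ j → j < l → wp ! (j ∸ mp) < w ! (j ∸ m)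

  colStrict-elim : ∀ mp lp wp m l w → T (colStrictᵇ mp lp wp m l w) → ColStrict mp lp wp m l w
  colStrict-elim mp lp wp m l w t j mp≤j j<lp m≤j j<l = ℕP.<ᵇ⇒< (wp ! (j ∸ mp)) (w ! (j ∸ m))
    (ifTrue-elim (((mp ≤ᵇ j) ∧ (j <ᵇ lp)) ∧ ((m ≤ᵇ j) ∧ (j <ᵇ l)))
      (∧-intro (∧-intro (ℕP.≤⇒≤ᵇ mp≤j) (ℕP.<⇒<ᵇ j<lp)) (∧-intro (ℕP.≤⇒≤ᵇ m≤j) (ℕP.<⇒<ᵇ j<l)))
      (allᵇ-applyUpTo-elim _ (λ x → x) lp t j j<lp))

  colStrict-intro : ∀ mp lp wp m l w → ColStrict mp lp wp m l w → T (colStrictᵇ mp lp wp m l w)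
  colStrict-intro mp lp wp m l w c = allᵇ-applyUpTo-intro _ (λ x → x) lp λ j _ →
    ifTrue-intro (((mp ≤ᵇ j) ∧ (j <ᵇ lp)) ∧ ((m ≤ᵇ j) ∧ (j <ᵇ l))) λ g →
      let (a , b) = ∧-elim {(mp ≤ᵇ j) ∧ (j <ᵇ lp)} g
          (a₁ , a₂) = ∧-elim {mp ≤ᵇ j} a
          (b₁ , b₂) = ∧-elim {m ≤ᵇ j} b
      in ℕP.<⇒<ᵇ (c j (ℕP.≤ᵇ⇒≤ mp j a₁) (ℕP.<ᵇ⇒< j lp a₂) (ℕP.≤ᵇ⇒≤ m j b₁) (ℕP.<ᵇ⇒< j l b₂))

  -- The number of semistandard fillings with entries in 1..t of n rows of shape L/M, placed below
  -- a row wp that occupies the columns mp ≤ j < lp.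
  rowSum : ℕ → ℕ → (M L : ℕ → ℕ) → ℕ → ℕ → List ℕ → ℚ
  rowSum t zero M L mp lp wp = 1ℚ
  rowSum t (suc n) M L mp lp wp = incSum t (L 0 ∸ M 0) λ w →
    ind (colStrictᵇ mp lp wp (M 0) (L 0) w) * rowSum t n (M ∘ suc) (L ∘ suc) (M 0) (L 0) w

  colsStrictᵇ : ℕ → (M L : ℕ → ℕ) → List (List ℕ) → Bool
  colsStrictᵇ n M L F =
    allᵇ (λ i → colStrictᵇ (M i) (L i) (lookupL F i) (M (suc i)) (L (suc i)) (lookupL F (suc i))) (upTo n)

  allᵇ-applyUpTo : ∀ {A B : Set} (p : B → Bool) (f : A → B) (g : ℕ → A) n →
    allᵇ p (applyUpTo (f ∘ g) n) ≡ allᵇ (p ∘ f) (applyUpTo g n)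
  allᵇ-applyUpTo p f g zero = refl
  allᵇ-applyUpTo p f g (suc n) = cong (p (f (g 0)) ∧_) (allᵇ-applyUpTo p f (g ∘ suc) n)

  -- The factor for the row above makes the statement inductive. `isSSYTᵇ` also compares the last
  -- row with the absent row `n`; `L n ≡ 0` makes that test vacuous.
  fillingSum : ∀ t n M L mp lp wp → L n ≡ 0 →
    sumL (fillings t (applyUpTo (λ i → L i ∸ M i) n))
      (λ F → ind (colStrictᵇ mp lp wp (M 0) (L 0) (lookupL F 0)) * ind (allᵇ weaklyIncᵇ F ∧ colsStrictᵇ n M L F))
    ≡ rowSum t n M L mp lp wp
  fillingSum t zero M L mp lp wp L0 = trans (ℚP.+-identityʳ _) (trans (ℚP.*-identityʳ _)
    (cong ind (T⇒≡true (colStrict-intro mp lp wp (M 0) (L 0) [] λ j _ _ _ j<L0 →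
      ⊥-elim (ℕP.n≮0 (subst (j <_) L0 j<L0))))))
  fillingSum t (suc n) M L mp lp wp Ln = begin
    sumL (fillings t ((L 0 ∸ M 0) ∷ ks)) f
      ≡⟨ sumL-concatMap (λ r → map (r ∷_) (fillings t ks)) (words t (L 0 ∸ M 0)) f ⟩
    sumL (words t (L 0 ∸ M 0)) (λ r → sumL (map (r ∷_) (fillings t ks)) f)
      ≡⟨ sumL-words t (L 0 ∸ M 0) _ ⟩
    wordSum t (L 0 ∸ M 0) (λ r → sumL (map (r ∷_) (fillings t ks)) f)
      ≡⟨ wordSum-cong t (L 0 ∸ M 0) (λ r _ → begin
          sumL (map (r ∷_) (fillings t ks)) f ≡⟨ sumL-map (r ∷_) (fillings t ks) f ⟩
          sumL (fillings t ks) (λ F → f (r ∷ F)) ≡⟨ sumL-cong (fillings t ks) (split r) ⟩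
          sumL (fillings t ks) (λ F → ind (weaklyIncᵇ r) * ind (c r) * g r F)
            ≡⟨ sumL-* (fillings t ks) (ind (weaklyIncᵇ r) * ind (c r)) (g r) ⟩
          ind (weaklyIncᵇ r) * ind (c r) * sumL (fillings t ks) (g r)
            ≡⟨ cong (ind (weaklyIncᵇ r) * ind (c r) *_) (fillingSum t n (M ∘ suc) (L ∘ suc) (M 0) (L 0) r Ln) ⟩
          ind (weaklyIncᵇ r) * ind (c r) * rowSum t n (M ∘ suc) (L ∘ suc) (M 0) (L 0) r
            ≡⟨ ℚP.*-assoc (ind (weaklyIncᵇ r)) _ _ ⟩
          ind (weaklyIncᵇ r) * (ind (c r) * rowSum t n (M ∘ suc) (L ∘ suc) (M 0) (L 0) r) ∎) ⟩
    rowSum t (suc n) M L mp lp wp ∎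
    where
    open ≡-Reasoning
    ks = applyUpTo (λ i → L (suc i) ∸ M (suc i)) n
    f : List (List ℕ) → ℚ
    f F = ind (colStrictᵇ mp lp wp (M 0) (L 0) (lookupL F 0)) * ind (allᵇ weaklyIncᵇ F ∧ colsStrictᵇ (suc n) M L F)
    c : List ℕ → Bool
    c r = colStrictᵇ mp lp wp (M 0) (L 0) r
    g : List ℕ → List (List ℕ) → ℚ
    g r F = ind (colStrictᵇ (M 0) (L 0) r (M 1) (L 1) (lookupL F 0)) *
      ind (allᵇ weaklyIncᵇ F ∧ colsStrictᵇ n (M ∘ suc) (L ∘ suc) F)
    rearr : ∀ a b c d e → a * ((b * c) * (d * e)) ≡ b * a * (d * (c * e))
    rearr = solve-∀ ringℚ
    split : ∀ r F → f (r ∷ F) ≡ ind (weaklyIncᵇ r) * ind (c r) * g r F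
    split r F = trans
      (cong (ind (c r) *_) (trans (ind-∧ (weaklyIncᵇ r ∧ allᵇ weaklyIncᵇ F) (colsStrictᵇ (suc n) M L (r ∷ F)))
        (cong₂ _*_ (ind-∧ (weaklyIncᵇ r) _) (ind-∧ (colStrictᵇ (M 0) (L 0) r (M 1) (L 1) (lookupL F 0)) _))))
      (trans (rearr (ind (c r)) (ind (weaklyIncᵇ r)) _ (ind (colStrictᵇ (M 0) (L 0) r (M 1) (L 1) (lookupL F 0))) _)
        (cong (λ y → ind (weaklyIncᵇ r) * ind (c r) * (ind (colStrictᵇ (M 0) (L 0) r (M 1) (L 1) (lookupL F 0)) * y))
          (trans (cong (λ b → ind (allᵇ weaklyIncᵇ F) * ind b) (allᵇ-applyUpTo _ suc (λ x → x) n))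
            (sym (ind-∧ (allᵇ weaklyIncᵇ F) _)))))

  !-overflow : ∀ xs {i} → length xs ≤ i → xs ! i ≡ 0
  !-overflow [] _ = refl
  !-overflow (x ∷ xs) {suc i} (s≤s p) = !-overflow xs p

  -- The row above the first one is taken to be empty, from column `la ! 0` to `la ! 0`, and imposes
  -- no condition.
  ssytCount≡rowSum : ∀ la mu t → ι (ssytCount la mu t) ≡ rowSum t (length la) (mu !_) (la !_) (la ! 0) (la ! 0) []
  ssytCount≡rowSum la mu t = begin
    ι (ssytCount la mu t) ≡⟨ length-filterᵇ (isSSYTᵇ la mu) (fillings t (rowLengths la mu)) ⟩
    sumL (fillings t (rowLengths la mu)) (ind ∘ isSSYTᵇ la mu)
      ≡⟨ cong (λ ks → sumL (fillings t ks) (ind ∘ isSSYTᵇ la mu)) (ListP.map-upTo (λ i → la ! i ∸ mu ! i) (length la)) ⟩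
    sumL (fillings t (applyUpTo (λ i → la ! i ∸ mu ! i) (length la))) (ind ∘ isSSYTᵇ la mu)
      ≡⟨ sumL-cong (fillings t (applyUpTo (λ i → la ! i ∸ mu ! i) (length la))) (λ F → trans (sym (ℚP.*-identityˡ _))
          (cong (λ b → ind b * ind (isSSYTᵇ la mu F)) (sym (T⇒≡true
            (colStrict-intro (la ! 0) (la ! 0) [] (mu ! 0) (la ! 0) (lookupL F 0) λ j a b _ _ → ⊥-elim (ℕP.<⇒≱ b a)))))) ⟩
    _ ≡⟨ fillingSum t (length la) (mu !_) (la !_) (la ! 0) (la ! 0) [] (!-overflow la ℕP.≤-refl) ⟩
    rowSum t (length la) (mu !_) (la !_) (la ! 0) (la ! 0) [] ∎
    where open ≡-Reasoning

open Filling

-- The Jacobi-Trudi identity at 1^t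

module JacobiTrudi where

  open import Data.Rational using (_+_; _*_; -_; _-_)

  ind-yes : ∀ {b} → T b → ind b ≡ 1ℚ
  ind-yes {true} _ = refl

  sumTo-extend : ∀ a (c : ℕ → Bool) g → (∀ m → m < a → c m ≡ true) → (∀ m → a ≤ m → c m ≡ false) → ∀ d →
    sumTo (a ℕ.+ d) (λ m → ind (c m) * g m) ≡ sumTo a g
  sumTo-extend zero c g yes' no' d = sumTo-zero d λ m _ → trans (cong (λ b → ind b * g m) (no' m z≤n)) (ℚP.*-zeroˡ (g m))
  sumTo-extend (suc a) c g yes' no' d = cong₂ _+_
    (trans (cong (λ b → ind b * g 0) (yes' 0 (s≤s z≤n))) (ℚP.*-identityˡ (g 0)))
    (sumTo-extend a (c ∘ suc) (g ∘ suc) (λ m p → yes' (suc m) (s≤s p)) (λ m p → no' (suc m) (s≤s p)) d)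

  ≤ᵇ-true : ∀ {m n} → m ≤ n → (m ≤ᵇ n) ≡ true
  ≤ᵇ-true p = T⇒≡true (ℕP.≤⇒≤ᵇ p)

  ≤ᵇ-false : ∀ {m n} → n < m → (m ≤ᵇ n) ≡ false
  ≤ᵇ-false {m} {n} p with m ≤ᵇ n in eq
  ... | false = refl
  ... | true = ⊥-elim (ℕP.<⇒≱ p (ℕP.≤ᵇ⇒≤ m n (subst T (sym eq) _)))

  -- Both sides run over `m` up to the minimum of `a` and `b`; each is a part of one sum of length
  -- `suc (a + b)`.
  sumTo-exchange : ∀ a b (g : ℕ → ℚ) →
    sumTo (suc a) (λ m → ind (m ≤ᵇ b) * g m) ≡ sumTo (suc b) (λ m → ind (m ≤ᵇ a) * g m)
  sumTo-exchange a b g = trans (sym (extend a b)) (trans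
    (trans (cong (λ n → sumTo n (λ m → ind (m ≤ᵇ a) * (ind (m ≤ᵇ b) * g m))) (cong suc (ℕP.+-comm a b)))
      (sumTo-cong (suc (b ℕ.+ a)) λ m _ → rearr (ind (m ≤ᵇ a)) (ind (m ≤ᵇ b)) (g m)))
    (extend b a))
    where
    extend : (a b : ℕ) → sumTo (suc a ℕ.+ b) (λ m → ind (m ≤ᵇ a) * (ind (m ≤ᵇ b) * g m)) ≡ sumTo (suc a) (λ m → ind (m ≤ᵇ b) * g m)
    extend a b = sumTo-extend (suc a) (_≤ᵇ a) (λ m → ind (m ≤ᵇ b) * g m) (λ { m (s≤s p) → ≤ᵇ-true p }) (λ m p → ≤ᵇ-false p) b
    rearr : ∀ x y z → x * (y * z) ≡ y * (x * z)
    rearr = solve-∀ ringℚ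

  !-replicate-< : ∀ a u {i} → i < a → (replicate a 1 ++ map suc u) ! i ≡ 1
  !-replicate-< (suc a) u {zero} _ = refl
  !-replicate-< (suc a) u {suc i} (s≤s p) = !-replicate-< a u p

  !-replicate-≥ : ∀ a u i → i < length u → (replicate a 1 ++ map suc u) ! (a ℕ.+ i) ≡ suc (u ! i)
  !-replicate-≥ (suc a) u i p = !-replicate-≥ a u i p
  !-replicate-≥ zero (x ∷ u) zero _ = refl
  !-replicate-≥ zero (x ∷ u) (suc i) (s≤s p) = !-replicate-≥ zero u i p

  ∸-split : ∀ {m ν j} → m ≤ ν → ν ≤ j → j ∸ m ≡ (ν ∸ m) ℕ.+ (j ∸ ν)
  ∸-split {m} {ν} {j} m≤ν ν≤j = trans (cong (_∸ m) (sym (ℕP.m+[n∸m]≡n ν≤j))) (ℕP.+-∸-comm (j ∸ ν) m≤ν)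

  module _ {mp νp lp : ℕ} {wp : List ℕ} (mp≤νp : mp ≤ νp) (νp≤lp : νp ≤ lp) (lenp : length wp ≡ lp ∸ νp) where

    entry-< : ∀ {j} → mp ≤ j → j < νp → (replicate (νp ∸ mp) 1 ++ map suc wp) ! (j ∸ mp) ≡ 1
    entry-< a b = !-replicate-< (νp ∸ mp) wp (ℕP.∸-monoˡ-< b a)

    entry-≥ : ∀ {j} → νp ≤ j → j < lp → (replicate (νp ∸ mp) 1 ++ map suc wp) ! (j ∸ mp) ≡ suc (wp ! (j ∸ νp))
    entry-≥ {j} a b = trans (cong ((replicate (νp ∸ mp) 1 ++ map suc wp) !_) (∸-split mp≤νp a))
      (!-replicate-≥ (νp ∸ mp) wp (j ∸ νp) (subst (j ∸ νp <_) (sym lenp) (ℕP.∸-monoˡ-< b a)))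

    entry-pos : ∀ {j} → mp ≤ j → j < lp → 1 ≤ (replicate (νp ∸ mp) 1 ++ map suc wp) ! (j ∸ mp)
    entry-pos {j} a b with ℕP.<-≤-connex j νp
    ... | inj₁ c = ℕP.≤-reflexive (sym (entry-< a c))
    ... | inj₂ c = subst (1 ≤_) (sym (entry-≥ c b)) (s≤s z≤n)

  -- A 1 in the lower row cannot stand below any entry, so its ones must end before column `mp`.
  -- Then a 1 of the upper row is above an entry of at least 2, and elsewhere both entries drop by
  -- one.
  colStrict-ones : ∀ {mp νp lp wp m ν l w} → mp ≤ νp → νp ≤ lp → length wp ≡ lp ∸ νp →
    m ≤ ν → ν ≤ l → Word (l ∸ ν) w → m ≤ mp → l ≤ lp →
    colStrictᵇ mp lp (replicate (νp ∸ mp) 1 ++ map suc wp) m l (replicate (ν ∸ m) 1 ++ map suc w) ≡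
    (ν ≤ᵇ mp) ∧ colStrictᵇ νp lp wp ν l w
  colStrict-ones {mp} {νp} {lp} {wp} {m} {ν} {l} {w} mp≤νp νp≤lp lenp m≤ν ν≤l (lenw , pos) m≤mp l≤lp = T-extensional
    (λ t → let c = colStrict-elim mp lp up m l down t in
      ∧-intro (ℕP.≤⇒≤ᵇ (ν≤mp c)) (colStrict-intro νp lp wp ν l w λ j νp≤j j<lp ν≤j j<l →
        ℕ.s≤s⁻¹ (subst₂ _<_ (entry-≥ mp≤νp νp≤lp lenp νp≤j j<lp) (entry-≥ m≤ν ν≤l lenw ν≤j j<l)
          (c j (ℕP.≤-trans mp≤νp νp≤j) j<lp (ℕP.≤-trans m≤ν ν≤j) j<l))))
    (λ t → let (a , b) = ∧-elim {ν ≤ᵇ mp} t in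
      colStrict-intro mp lp up m l down (back (ℕP.≤ᵇ⇒≤ ν mp a) (colStrict-elim νp lp wp ν l w b)))
    where
    up = replicate (νp ∸ mp) 1 ++ map suc wp
    down = replicate (ν ∸ m) 1 ++ map suc w
    ν≤mp : ColStrict mp lp up m l down → ν ≤ mp
    ν≤mp c = ℕP.≮⇒≥ λ mp<ν →
      let mp<l = ℕP.<-≤-trans mp<ν ν≤l
          mp<lp = ℕP.<-≤-trans mp<l l≤lp
      in ℕP.<⇒≱ (c mp ℕP.≤-refl mp<lp m≤mp mp<l)
           (ℕP.≤-trans (ℕP.≤-reflexive (entry-< m≤ν ν≤l lenw m≤mp mp<ν)) (entry-pos mp≤νp νp≤lp lenp ℕP.≤-refl mp<lp))
    back : ν ≤ mp → ColStrict νp lp wp ν l w → ColStrict mp lp up m l down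
    back ν≤mp c j mp≤j j<lp m≤j j<l with ℕP.<-≤-connex j νp
    ... | inj₁ j<νp = subst₂ _<_ (sym (entry-< mp≤νp νp≤lp lenp mp≤j j<νp)) (sym (entry-≥ m≤ν ν≤l lenw ν≤j j<l))
      (s≤s (pos (j ∸ ν) (ℕP.∸-monoˡ-< j<l ν≤j)))
      where ν≤j = ℕP.≤-trans ν≤mp mp≤j
    ... | inj₂ νp≤j = subst₂ _<_ (sym (entry-≥ mp≤νp νp≤lp lenp νp≤j j<lp)) (sym (entry-≥ m≤ν ν≤l lenw ν≤j j<l))
      (s≤s (c j νp≤j j<lp ν≤j j<l))
      where ν≤j = ℕP.≤-trans ν≤mp mp≤j

  belowᵇ : ℕ → (ν L : ℕ → ℕ) → Bool
  belowᵇ zero ν L = true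
  belowᵇ (suc n) ν L = (ν 0 ≤ᵇ L 0) ∧ belowᵇ n (ν ∘ suc) (L ∘ suc)

  Below : ℕ → (M L : ℕ → ℕ) → Set
  Below n M L = ∀ j → j < n → M j ≤ L j

  AntitoneTo : ℕ → (ℕ → ℕ) → Set
  AntitoneTo n M = ∀ j → suc j < n → M (suc j) ≤ M j

  -- The cells with entry 1 form a horizontal strip ν/M; the row above already begins with its own ones.
  rowSum-suc : ∀ t n M L {mp νp lp wp} → Below n M L → AntitoneTo n M → Antitone L →
    mp ≤ νp → νp ≤ lp → length wp ≡ lp ∸ νp → (0 < n → M 0 ≤ mp) → L 0 ≤ lp →
    rowSum (suc t) n M L mp lp (replicate (νp ∸ mp) 1 ++ map suc wp) ≡
    MSum n M (width mp M) (λ ν → ind (belowᵇ n ν L) * rowSum t n ν L νp lp wp)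
  rowSum-suc t zero M L _ _ _ _ _ _ _ _ = refl
  rowSum-suc t (suc n) M L {mp} {νp} {lp} {wp} M≤L Ma La mp≤νp νp≤lp lenp M0≤mp L0≤lp = begin
    rowSum (suc t) (suc n) M L mp lp up
      ≡⟨ incSum-suc t (L 0 ∸ M 0) _ ⟩
    sumTo (suc (L 0 ∸ M 0)) (λ m → incSum t (L 0 ∸ M 0 ∸ m) (λ w → ind (colStrictᵇ mp lp up (M 0) (L 0) (down m w)) *
        rowSum (suc t) n (M ∘ suc) (L ∘ suc) (M 0) (L 0) (down m w)))
      ≡⟨ sumTo-cong (suc (L 0 ∸ M 0)) term ⟩
    sumTo (suc (L 0 ∸ M 0)) (λ m → ind (m ≤ᵇ mp ∸ M 0) * G m)
      -- So far the number `m` of ones ranges up to the length of the row, with the strip condition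
      -- as an indicator. The determinant lets `m` range over the strip and tests containment in `L`
      -- instead.
      ≡⟨ sumTo-exchange (L 0 ∸ M 0) (mp ∸ M 0) G ⟩
    sumTo (suc (mp ∸ M 0)) (λ m → ind (m ≤ᵇ L 0 ∸ M 0) * G m)
      ≡⟨ sumTo-cong (suc (mp ∸ M 0)) (λ m _ → trans (sym (MSum-* n (M ∘ suc) _ (ind (m ≤ᵇ L 0 ∸ M 0)) _))
          (MSum-cong n {w = width (M 0) (M ∘ suc)} {w' = width mp M ∘ suc} (λ { zero _ → refl ; (suc j) _ → refl }) λ ν _ →
            trans (sym (ind-∧-* (m ≤ᵇ L 0 ∸ M 0) (belowᵇ n ν (L ∘ suc)) _))
              (cong (λ b → ind (b ∧ belowᵇ n ν (L ∘ suc)) * rowSum t (suc n) ((M 0 ℕ.+ m) ∷ₛ ν) L νp lp wp)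
                (∸-≤ᵇ m (M≤L 0 (s≤s z≤n)))))) ⟩
    MSum (suc n) M (width mp M) (λ ν → ind (belowᵇ (suc n) ν L) * rowSum t (suc n) ν L νp lp wp) ∎
    where
    open ≡-Reasoning
    up = replicate (νp ∸ mp) 1 ++ map suc wp
    down : ℕ → List ℕ → List ℕ
    down m w = replicate m 1 ++ map suc w
    G : ℕ → ℚ
    G m = MSum n (M ∘ suc) (width (M 0) (M ∘ suc)) λ ν →
      ind (belowᵇ n ν (L ∘ suc)) * rowSum t (suc n) ((M 0 ℕ.+ m) ∷ₛ ν) L νp lp wp
    ∸-≤ᵇ : ∀ m {x} → M 0 ≤ x → (m ≤ᵇ x ∸ M 0) ≡ (M 0 ℕ.+ m ≤ᵇ x)
    ∸-≤ᵇ m {x} le = T-extensional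
      (λ p → ℕP.≤⇒≤ᵇ (subst (M 0 ℕ.+ m ≤_) (ℕP.m+[n∸m]≡n le) (ℕP.+-monoʳ-≤ (M 0) (ℕP.≤ᵇ⇒≤ m _ p))))
      (λ p → ℕP.≤⇒≤ᵇ (subst (_≤ x ∸ M 0) (ℕP.m+n∸m≡n (M 0) m) (ℕP.∸-monoˡ-≤ (M 0) (ℕP.≤ᵇ⇒≤ (M 0 ℕ.+ m) x p))))
    rearr : ∀ a b c d → (a * b) * (c * d) ≡ a * (c * (b * d))
    rearr = solve-∀ ringℚ
    term : ∀ m → m < suc (L 0 ∸ M 0) →
      incSum t (L 0 ∸ M 0 ∸ m) (λ w → ind (colStrictᵇ mp lp up (M 0) (L 0) (down m w)) *
        rowSum (suc t) n (M ∘ suc) (L ∘ suc) (M 0) (L 0) (down m w)) ≡ ind (m ≤ᵇ mp ∸ M 0) * G m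
    term m (s≤s m≤) = begin
      incSum t (L 0 ∸ M 0 ∸ m) (λ w → ind (colStrictᵇ mp lp up (M 0) (L 0) (down m w)) *
        rowSum (suc t) n (M ∘ suc) (L ∘ suc) (M 0) (L 0) (down m w))
        ≡⟨ cong (λ k → incSum t k (λ w → ind (colStrictᵇ mp lp up (M 0) (L 0) (down m w)) *
            rowSum (suc t) n (M ∘ suc) (L ∘ suc) (M 0) (L 0) (down m w))) (ℕP.∸-+-assoc (L 0) (M 0) m) ⟩
      incSum t (L 0 ∸ ν₀) (λ w → ind (colStrictᵇ mp lp up (M 0) (L 0) (down m w)) *
        rowSum (suc t) n (M ∘ suc) (L ∘ suc) (M 0) (L 0) (down m w))
        ≡⟨ incSum-cong t (L 0 ∸ ν₀) (λ w p → cong₂ _*_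
            (trans (cong ind (trans (cong (λ a → colStrictᵇ mp lp up (M 0) (L 0) (down a w)) (sym (ℕP.m+n∸m≡n (M 0) m)))
                (colStrict-ones mp≤νp νp≤lp lenp (ℕP.m≤m+n (M 0) m) ν₀≤L0 p (M0≤mp (s≤s z≤n)) L0≤lp)))
              (ind-∧ (ν₀ ≤ᵇ mp) (colStrictᵇ νp lp wp ν₀ (L 0) w)))
            (trans (cong (λ a → rowSum (suc t) n (M ∘ suc) (L ∘ suc) (M 0) (L 0) (down a w)) (sym (ℕP.m+n∸m≡n (M 0) m)))
              (rowSum-suc t n (M ∘ suc) (L ∘ suc) (λ j q → M≤L (suc j) (s≤s q)) (λ j q → Ma (suc j) (s≤s q)) (La ∘ suc)
                (ℕP.m≤m+n (M 0) m) ν₀≤L0 (proj₁ p) (λ q → Ma 0 (s≤s q)) (La 0)))) ⟩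
      incSum t (L 0 ∸ ν₀) (λ w → ind (ν₀ ≤ᵇ mp) * ind (colStrictᵇ νp lp wp ν₀ (L 0) w) *
        MSum n (M ∘ suc) (width (M 0) (M ∘ suc)) (λ ν → ind (belowᵇ n ν (L ∘ suc)) * rowSum t n ν (L ∘ suc) ν₀ (L 0) w))
        ≡⟨ incSum-cong t (L 0 ∸ ν₀) (λ w _ → trans (sym (MSum-* n (M ∘ suc) (width (M 0) (M ∘ suc)) (ind (ν₀ ≤ᵇ mp) * ind (colStrictᵇ νp lp wp ν₀ (L 0) w)) _)) (MSum-cong n (λ _ _ → refl) λ ν _ →
            rearr (ind (ν₀ ≤ᵇ mp)) (ind (colStrictᵇ νp lp wp ν₀ (L 0) w)) (ind (belowᵇ n ν (L ∘ suc))) _)) ⟩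
      incSum t (L 0 ∸ ν₀) (λ w → MSum n (M ∘ suc) (width (M 0) (M ∘ suc)) (λ ν → ind (ν₀ ≤ᵇ mp) * (ind (belowᵇ n ν (L ∘ suc)) *
        (ind (colStrictᵇ νp lp wp ν₀ (L 0) w) * rowSum t n ν (L ∘ suc) ν₀ (L 0) w))))
        ≡⟨ incSum-MSum t (L 0 ∸ ν₀) n (M ∘ suc) _ _ ⟩
      MSum n (M ∘ suc) (width (M 0) (M ∘ suc)) (λ ν → incSum t (L 0 ∸ ν₀) (λ w → ind (ν₀ ≤ᵇ mp) * (ind (belowᵇ n ν (L ∘ suc)) *
        (ind (colStrictᵇ νp lp wp ν₀ (L 0) w) * rowSum t n ν (L ∘ suc) ν₀ (L 0) w))))
        ≡⟨ MSum-cong n (λ _ _ → refl) (λ ν _ → trans (incSum-* t (L 0 ∸ ν₀) (ind (ν₀ ≤ᵇ mp)) _)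
            (cong (ind (ν₀ ≤ᵇ mp) *_) (incSum-* t (L 0 ∸ ν₀) (ind (belowᵇ n ν (L ∘ suc))) _))) ⟩
      MSum n (M ∘ suc) (width (M 0) (M ∘ suc)) (λ ν → ind (ν₀ ≤ᵇ mp) * (ind (belowᵇ n ν (L ∘ suc)) *
        rowSum t (suc n) (ν₀ ∷ₛ ν) L νp lp wp))
        ≡⟨ MSum-* n (M ∘ suc) _ (ind (ν₀ ≤ᵇ mp)) _ ⟩
      ind (ν₀ ≤ᵇ mp) * G m
        ≡⟨ cong (λ b → ind b * G m) (sym (∸-≤ᵇ m (M0≤mp (s≤s z≤n)))) ⟩
      ind (m ≤ᵇ mp ∸ M 0) * G m ∎
      where
      ν₀ = M 0 ℕ.+ m
      ν₀≤L0 : ν₀ ≤ L 0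
      ν₀≤L0 = subst (ν₀ ≤_) (ℕP.m+[n∸m]≡n (M≤L 0 (s≤s z≤n))) (ℕP.+-monoʳ-≤ (M 0) m≤)

  antitoneTo-≤ : ∀ {n M} → AntitoneTo n M → ∀ {i j} → i ≤ j → j < n → M j ≤ M i
  antitoneTo-≤ {n} {M} a {i} {j} i≤j j<n with ℕP.m≤n⇒m<n∨m≡n i≤j
  ... | inj₂ refl = ℕP.≤-refl
  antitoneTo-≤ {n} {M} a {i} {suc j} i≤j j<n | inj₁ (s≤s i≤j') =
    ℕP.≤-trans (a j j<n) (antitoneTo-≤ a i≤j' (ℕP.<-trans (ℕP.n<1+n j) j<n))

  -- Without variables only the empty shape has a filling, and h_k = 0 for positive k: row 0 of the
  -- matrix is zero if row 0 of the shape has a cell, and otherwise it is the unit vector at column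
  -- 0.
  JT-zero : ∀ n L M p → Antitone L → Below n M L → AntitoneTo n M →
    rowSum 0 n M L p p [] ≡ dt n (JT 0 n L M)
  JT-zero zero L M p La M≤L Ma = refl
  JT-zero (suc n) L M p La M≤L Ma with ℕP.m≤n⇒m<n∨m≡n (M≤L 0 (s≤s z≤n))
  ... | inj₁ M0<L0 = trans (cong (λ k → incSum 0 k λ w → ind (colStrictᵇ p p [] (M 0) (L 0) w) * rowSum 0 n (M ∘ suc) (L ∘ suc) (M 0) (L 0) w)
      (ℕP.+-∸-assoc 1 M0<L0))
    (sym (dt-zeroRow (suc n) (JT 0 (suc n) L M) 0 (s≤s z≤n) λ c c<n →
      h0 (ℕP.+-mono-<-≤ (ℕP.≤-<-trans (antitoneTo-≤ Ma z≤n c<n) M0<L0) (ℕP.m∸n≤m (suc n) c))))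
    where
    h0 : ∀ {a b} → b < a → H 0 a b ≡ 0ℚ
    h0 {a} {b} p = trans (H-≥ 0 (ℕP.<⇒≤ p)) (cong (h 0) (ℕP.+-∸-assoc 1 p))
  ... | inj₂ M0≡L0 = begin
    incSum 0 (L 0 ∸ M 0) (λ w → ind (colStrictᵇ p p [] (M 0) (L 0) w) * rowSum 0 n (M ∘ suc) (L ∘ suc) (M 0) (L 0) w)
      ≡⟨ cong (λ k → incSum 0 k (λ w → ind (colStrictᵇ p p [] (M 0) (L 0) w) * rowSum 0 n (M ∘ suc) (L ∘ suc) (M 0) (L 0) w))
          (trans (cong (L 0 ∸_) M0≡L0) (ℕP.n∸n≡0 (L 0))) ⟩
    1ℚ * (ind (colStrictᵇ p p [] (M 0) (L 0) []) * rowSum 0 n (M ∘ suc) (L ∘ suc) (M 0) (L 0) [])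
      ≡⟨ ℚP.*-identityˡ _ ⟩
    ind (colStrictᵇ p p [] (M 0) (L 0) []) * rowSum 0 n (M ∘ suc) (L ∘ suc) (M 0) (L 0) []
      ≡⟨ cong₂ _*_ (ind-yes (colStrict-intro p p [] (M 0) (L 0) [] λ j a b _ _ → ⊥-elim (ℕP.<⇒≱ b a)))
          (cong (λ x → rowSum 0 n (M ∘ suc) (L ∘ suc) x (L 0) []) M0≡L0) ⟩
    1ℚ * rowSum 0 n (M ∘ suc) (L ∘ suc) (L 0) (L 0) []
      ≡⟨ cong (1ℚ *_) (JT-zero n (L ∘ suc) (M ∘ suc) (L 0) (La ∘ suc) (λ j q → M≤L (suc j) (s≤s q)) (λ j q → Ma (suc j) (s≤s q))) ⟩
    altSign 0 * dt n (minor 0 0 (JT 0 (suc n) L M))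
      ≡⟨ sym (dt-unitRow n (JT 0 (suc n) L M) 0 0 (s≤s z≤n) (s≤s z≤n) diag off) ⟩
    dt (suc n) (JT 0 (suc n) L M) ∎
    where
    open ≡-Reasoning
    diag : JT 0 (suc n) L M 0 0 ≡ 1ℚ
    diag = trans (H-≥ 0 (ℕP.+-monoˡ-≤ (suc n) (ℕP.≤-reflexive M0≡L0)))
      (cong (h 0) (trans (cong (λ x → L 0 ℕ.+ suc n ∸ (x ℕ.+ suc n)) M0≡L0) (ℕP.n∸n≡0 (L 0 ℕ.+ suc n))))
    off : ∀ k → k < suc n → k ≢ 0 → JT 0 (suc n) L M 0 k ≡ 0ℚ
    off zero _ ne = ⊥-elim (ne refl)
    off (suc k) k<n _ = trans (H-≥ 0 (ℕP.<⇒≤ lt)) (cong (h 0) (ℕP.+-∸-assoc 1 lt))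
      where
      lt : M (suc k) ℕ.+ (n ∸ k) < L 0 ℕ.+ suc n
      lt = ℕP.+-mono-≤-< (ℕP.≤-trans (antitoneTo-≤ Ma z≤n k<n) (ℕP.≤-reflexive M0≡L0)) (s≤s (ℕP.m∸n≤m n k))

  belowᵇ-elim : ∀ n ν L → T (belowᵇ n ν L) → Below n ν L
  belowᵇ-elim (suc n) ν L t zero _ = ℕP.≤ᵇ⇒≤ (ν 0) (L 0) (proj₁ (∧-elim t))
  belowᵇ-elim (suc n) ν L t (suc j) (s≤s q) = belowᵇ-elim n (ν ∘ suc) (L ∘ suc) (proj₂ (∧-elim {ν 0 ≤ᵇ L 0} t)) j q

  belowᵇ-false : ∀ n ν L → belowᵇ n ν L ≡ false → Σ ℕ λ j → j < n × L j < ν j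
  belowᵇ-false (suc n) ν L e with ν 0 ≤ᵇ L 0 in eq
  ... | false = 0 , s≤s z≤n , ℕP.≰⇒> λ le → subst T eq (ℕP.≤⇒≤ᵇ le)
  ... | true = let (j , a , b) = belowᵇ-false n (ν ∘ suc) (L ∘ suc) e in suc j , s≤s a , b

  -- Both sides branch over the same ν. If `ν i > L i` for some `i`, the indicator removes ν from
  -- the count, and in the determinant the rows from `i` on vanish on the columns up to `i`, as all
  -- degrees there are negative.
  jacobiTrudi : ∀ t n L M → Antitone L → Below n M L → AntitoneTo n M →
    rowSum t n M L (L 0) (L 0) [] ≡ dt n (JT t n L M)
  jacobiTrudi zero n L M La M≤L Ma = JT-zero n L M (L 0) La M≤L Ma
  jacobiTrudi (suc t) zero L M La M≤L Ma = refl
  jacobiTrudi (suc t) n@(suc _) L M La M≤L Ma = begin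
    rowSum (suc t) n M L (L 0) (L 0) []
      ≡⟨ cong (λ k → rowSum (suc t) n M L (L 0) (L 0) (replicate k 1 ++ [])) (sym (ℕP.n∸n≡0 (L 0))) ⟩
    rowSum (suc t) n M L (L 0) (L 0) (replicate (L 0 ∸ L 0) 1 ++ [])
      ≡⟨ rowSum-suc t n M L M≤L Ma La ℕP.≤-refl ℕP.≤-refl (sym (ℕP.n∸n≡0 (L 0))) (λ _ → M≤L 0 (s≤s z≤n)) ℕP.≤-refl ⟩
    MSum n M (width (L 0) M) (λ ν → ind (belowᵇ n ν L) * rowSum t n ν L (L 0) (L 0) [])
      ≡⟨ MSum-cong n (λ _ _ → refl) each ⟩
    MSum n M (width (L 0) M) (λ ν → dt n (JT t n L ν))
      ≡⟨ sym (JT-suc t n L M La (M≤L 0 (s≤s z≤n)) Ma) ⟩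
    dt n (JT (suc t) n L M) ∎
    where
    open ≡-Reasoning
    antitone-range : ∀ ν → (∀ j → j < n → M j ≤ ν j × ν j < M j ℕ.+ width (L 0) M j) → AntitoneTo n ν
    antitone-range ν range j p = ℕP.≤-trans (ℕ.s≤s⁻¹ (subst (ν (suc j) <_)
      (trans (ℕP.+-suc (M (suc j)) _) (cong suc (ℕP.m+[n∸m]≡n (Ma j p)))) (proj₂ (range (suc j) p))))
      (proj₁ (range j (ℕP.<-trans (ℕP.n<1+n j) p)))
    each : ∀ ν → (∀ j → j < n → M j ≤ ν j × ν j < M j ℕ.+ width (L 0) M j) →
      ind (belowᵇ n ν L) * rowSum t n ν L (L 0) (L 0) [] ≡ dt n (JT t n L ν)
    each ν range with belowᵇ n ν L in eq
    ... | true = trans (ℚP.*-identityˡ _)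
      (jacobiTrudi t n L ν La (belowᵇ-elim n ν L (subst T (sym eq) _)) (antitone-range ν range))
    ... | false with belowᵇ-false n ν L eq
    ... | i , i<n , Li<νi = trans (ℚP.*-zeroˡ (rowSum t n ν L (L 0) (L 0) []))
      (sym (dt-zeroBlock n (JT t n L ν) i i<n λ r c i≤r c≤i → H-< t (ℕP.+-mono-<-≤
        (ℕP.≤-<-trans (antitone-≤ La i≤r) (ℕP.<-≤-trans Li<νi (antitoneTo-≤ (antitone-range ν range) c≤i i<n)))
        (ℕP.∸-monoʳ-≤ n (ℕP.≤-trans c≤i i≤r)))))

open JacobiTrudi

-- The matrix of leading coefficients and its reduction to a Cauchy matrix

module LeadingMatrix where

  open import Data.Rational using (_+_; _*_; -_; _-_)

  Matched : ℕ → (ℕ → ℕ) → ℕ → Set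
  Matched n B a = Σ ℕ λ j → j < n × a ≡ B j

  matched? : ∀ n B a → Dec (Matched n B a)
  matched? n B a with ℕP.anyUpTo? (λ j → a ℕP.≟ B j) n
  ... | yes (j , p) = yes (j , p)
  ... | no ¬p = no λ (j , p) → ¬p (j , p)

  -- the order at t = 0 of the row of the Jacobi–Trudi matrix that belongs to a
  unmatched : ℕ → (ℕ → ℕ) → ℕ → ℕ
  unmatched n B a with matched? n B a
  ... | yes _ = 0
  ... | no _ = 1

  unmatched≤1 : ∀ n B a → unmatched n B a ≤ 1
  unmatched≤1 n B a with matched? n B a
  ... | yes _ = z≤n
  ... | no _ = ℕP.≤-refl

  unmatched≡1⇒ : ∀ {n B a} → unmatched n B a ≡ 1 → ¬ Matched n B a
  unmatched≡1⇒ {n} {B} {a} e m with matched? n B a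
  unmatched≡1⇒ {n} {B} {a} () m | yes _
  ... | no ¬m = ¬m m

  cauchyEntry : ℕ → ℕ → ℚ
  cauchyEntry a b with b ℕP.<? a
  ... | yes _ = recip (ℤ.+ (a ∸ b))
  ... | no _ = 0ℚ

  δ : ℕ → ℕ → ℚ
  δ a b with a ℕP.≟ b
  ... | yes _ = 1ℚ
  ... | no _ = 0ℚ

  -- the coefficient of t^(unmatched n B a) in h_{a-b}(1^t), for b among the values of B
  leadEntry : ℕ → (ℕ → ℕ) → ℕ → ℕ → ℚ
  leadEntry n B a b with matched? n B a
  ... | yes _ = δ a b
  ... | no _ = cauchyEntry a b

  leadMatrix : ℕ → (A B : ℕ → ℕ) → Matrix
  leadMatrix n A B i j = leadEntry n B (A i) (B j)

  Lead-lower : ∀ {r c f} → Lead (suc r) c f → Lead r 0ℚ f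
  Lead-lower {r} {c} (lead q e) = lead (c ∷ q) λ t → trans (e t)
    (trans (cong (_* (c + ι t * evalPoly q (ι t))) (ι-^-suc t r)) (rearr (ι t) (ι (t ℕ.^ r)) _))
    where
    rearr : ∀ x y z → x * y * z ≡ y * (0ℚ + x * z)
    rearr = solve-∀ ringℚ

  H-Lead-< : ∀ {a b} → b < a → Lead 1 (recip (ℤ.+ (a ∸ b))) (λ t → H t a b)
  H-Lead-< {a} {b} p = subst (λ k → Lead 1 (recip (ℤ.+ k)) (λ t → H t a b)) (sym e)
    (Lead-cong refl (λ t → trans (H-≥ t (ℕP.<⇒≤ p)) (cong (h t) e)) (h-Lead (a ∸ suc b)))
    where
    e : a ∸ b ≡ suc (a ∸ suc b)
    e = ℕP.+-∸-assoc 1 p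

  H-Lead-> : ∀ {a b} r → a < b → Lead r 0ℚ (λ t → H t a b)
  H-Lead-> r p = Lead-cong refl (λ t → H-< t p) (Lead-zero r)

  -- In a matched row only constant terms count, and h_0 alone has one. In an unmatched row h_0 does
  -- not occur, so every entry has order at least 1.
  entry-Lead : ∀ n B a j → j < n → Lead (unmatched n B a) (leadEntry n B a (B j)) (λ t → H t a (B j))
  entry-Lead n B a j j<n with matched? n B a
  entry-Lead n B a j j<n | yes _ with a ℕP.≟ B j
  ... | yes refl = Lead-cong refl (λ t → trans (H-≥ t (ℕP.≤-refl {B j})) (cong (h t) (ℕP.n∸n≡0 (B j)))) (Lead-const 1ℚ)
  ... | no ne with ℕP.<-cmp a (B j)
  ... | tri< lt _ _ = H-Lead-> 0 lt
  ... | tri≈ _ e _ = contradiction e ne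
  ... | tri> _ _ gt = Lead-lower (H-Lead-< gt)
  entry-Lead n B a j j<n | no ¬m with B j ℕP.<? a
  ... | yes lt = H-Lead-< lt
  ... | no ≮ = H-Lead-> 1 (ℕP.≤∧≢⇒< (ℕP.≮⇒≥ ≮) λ e → ¬m (j , j<n , e))

  StrictTo : ℕ → (ℕ → ℕ) → Set
  StrictTo n A = ∀ {i j} → i < j → j < n → A j < A i

  strict-injective : ∀ {n A} → StrictTo n A → ∀ {i j} → i < n → j < n → A i ≡ A j → i ≡ j
  strict-injective s {i} {j} i<n j<n e with ℕP.<-cmp i j
  ... | tri< lt _ _ = ⊥-elim (ℕP.<-irrefl (sym e) (s lt j<n))
  ... | tri≈ _ e' _ = e'
  ... | tri> _ _ gt = ⊥-elim (ℕP.<-irrefl e (s gt i<n))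

  δ-refl : ∀ a → δ a a ≡ 1ℚ
  δ-refl a with a ℕP.≟ a
  ... | yes _ = refl
  ... | no ne = contradiction refl ne

  δ-≢ : ∀ {a b} → a ≢ b → δ a b ≡ 0ℚ
  δ-≢ {a} {b} ne with a ℕP.≟ b
  ... | yes e = contradiction e ne
  ... | no _ = refl

  leadEntry-matched : ∀ {n B a} b → Matched n B a → leadEntry n B a b ≡ δ a b
  leadEntry-matched {n} {B} {a} b m with matched? n B a
  ... | yes _ = refl
  ... | no ¬m = contradiction m ¬m

  leadEntry-unmatched : ∀ {n B a} b → ¬ Matched n B a → leadEntry n B a b ≡ cauchyEntry a b
  leadEntry-unmatched {n} {B} {a} b ¬m with matched? n B a
  ... | yes m = contradiction m ¬m
  ... | no _ = refl

  leadEntry-cong : ∀ {n n' B B' a} b → (Matched n B a → Matched n' B' a) → (Matched n' B' a → Matched n B a) →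
    leadEntry n B a b ≡ leadEntry n' B' a b
  leadEntry-cong {n} {n'} {B} {B'} {a} b f g with matched? n B a
  ... | yes m = sym (leadEntry-matched b (f m))
  ... | no ¬m = sym (leadEntry-unmatched b (¬m ∘ g))

  -- Row `i` is the unit vector at `j`. Deleting both changes the status of no other row: as the
  -- values of `A` are distinct, none of them was matched with `B j`.
  dt-leadMatrix-matched : ∀ n A B i j → StrictTo (suc n) A → StrictTo (suc n) B → i < suc n → j < suc n → A i ≡ B j →
    dt (suc n) (leadMatrix (suc n) A B) ≡ altSign (i ℕ.+ j) * dt n (leadMatrix n (A ∘ skip i) (B ∘ skip j))
  dt-leadMatrix-matched n A B i j sA sB i<n j<n e = trans
    (dt-unitRow n (leadMatrix (suc n) A B) i j i<n j<n
      (trans (leadEntry-matched (B j) (j , j<n , e)) (trans (cong (λ a → δ a (B j)) e) (δ-refl (B j))))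
      λ k k<n k≢j → trans (leadEntry-matched (B k) (j , j<n , e))
        (δ-≢ λ e' → k≢j (strict-injective {suc n} {B} sB k<n j<n (trans (sym e') e))))
    (cong (altSign (i ℕ.+ j) *_) (dt-cong n λ r c r<n c<n → leadEntry-cong (B (skip j c))
      (λ (l , l<n , e') →
        let j≢l = λ j≡l → skip-≢ i r (strict-injective {suc n} {A} sA (skip-bound i r<n) i<n
                      (trans e' (trans (cong B (sym j≡l)) (sym e))))
            (l' , eq , bound) = unskip j l j≢l
        in l' , bound j<n l<n , trans e' (cong B (sym eq)))
      (λ (l , l<n , e') → skip j l , skip-bound j l<n , e')))

  strict-skip : ∀ {n A} i → StrictTo (suc n) A → StrictTo n (A ∘ skip i)
  strict-skip i s p q = s (skip-mono-< i p) (skip-bound i q)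

  cancel-sign : ∀ ε {x} → ε * ε ≡ 1ℚ → ε * x ≡ 0ℚ → x ≡ 0ℚ
  cancel-sign ε {x} sq e = trans (sym (ℚP.*-identityˡ x)) (trans (cong (_* x) (sym sq))
    (trans (ℚP.*-assoc ε ε x) (trans (cong (ε *_) e) (ℚP.*-zeroʳ ε))))

  module _ {n : ℕ} (A B : ℕ → ℕ) (s : ℤ) (a b : Fin n → ℤ)
    (ea : ∀ i → a i ≡ ℤ.+ A (toℕ i) ℤ.+ s) (eb : ∀ j → b j ≡ ℤ.+ B (n ∸ suc (toℕ j)) ℤ.+ s) where

    cauchy≡cauchyEntry : ∀ i j → cauchy a b i j ≡ cauchyEntry (A (toℕ i)) (B (n ∸ suc (toℕ j)))
    cauchy≡cauchyEntry i j with b j ℤ.<? a i | B (n ∸ suc (toℕ j)) ℕP.<? A (toℕ i)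
    ... | yes p | yes q = cong recip (begin
      a i ℤ.- b j ≡⟨ cong₂ ℤ._-_ (ea i) (eb j) ⟩
      (x ℤ.+ s) ℤ.- (y ℤ.+ s) ≡⟨ cong (λ z → (x ℤ.+ s) ℤ.+ z) (ℤP.neg-distrib-+ y s) ⟩
      (x ℤ.+ s) ℤ.+ (ℤ.- y ℤ.- s) ≡⟨ ℤP.+-assoc x s _ ⟩
      x ℤ.+ (s ℤ.+ (ℤ.- y ℤ.- s)) ≡⟨ cong (λ z → x ℤ.+ z) (trans (ℤP.+-comm s _) (trans (ℤP.+-assoc (ℤ.- y) (ℤ.- s) s)
        (trans (cong (λ z → (ℤ.- y) ℤ.+ z) (ℤP.+-inverseˡ s)) (ℤP.+-identityʳ (ℤ.- y))))) ⟩
      x ℤ.- y ≡⟨ ℤP.m-n≡m⊖n (A (toℕ i)) (B (n ∸ suc (toℕ j))) ⟩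
      A (toℕ i) ℤ.⊖ B (n ∸ suc (toℕ j)) ≡⟨ ℤP.⊖-≥ (ℕP.<⇒≤ q) ⟩
      ℤ.+ (A (toℕ i) ∸ B (n ∸ suc (toℕ j))) ∎)
      where
      open ≡-Reasoning
      x = ℤ.+ A (toℕ i)
      y = ℤ.+ B (n ∸ suc (toℕ j))
    ... | no _ | no _ = refl
    ... | yes p | no q = contradiction (subst₂ ℤ._≤_ (sym (ea i)) (sym (eb j)) (ℤP.+-monoˡ-≤ s (ℤ.+≤+ (ℕP.≮⇒≥ q)))) (ℤP.<⇒≱ p)
    ... | no p | yes q = contradiction (subst₂ ℤ._<_ (sym (eb j)) (sym (ea i)) (ℤP.+-monoˡ-< s (ℤ.+<+ q))) p

    -- `b` increases while `B` decreases, so the columns come in reverse order, at the price of a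
    -- sign; the common shift `s` cancels in the differences.
    det-cauchy : (∀ i → i < n → ¬ Matched n B (A i)) →
      det n (cauchy a b) ≡ reverseSign n * dt n (leadMatrix n A B)
    det-cauchy ¬m = trans (det≡dt n (cauchy a b) (λ i j → cauchyEntry (A i) (B (n ∸ suc j))) cauchy≡cauchyEntry)
      (trans (dt-reverse n (λ i j → cauchyEntry (A i) (B j)))
        (cong (reverseSign n *_) (dt-cong n λ i j i<n _ → sym (leadEntry-unmatched (B j) (¬m i i<n)))))

  opposite-reverse : ∀ {n} (i : Fin n) → n ∸ suc (toℕ (opposite i)) ≡ toℕ i
  opposite-reverse i = trans (sym (FinP.opposite-prop (opposite i))) (cong toℕ (FinP.opposite-involutive i))

  -- Matched pairs are deleted one at a time, each costing only a sign, until a restricted Cauchy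
  -- matrix is left.
  leadMatrix-nonsingular : RestrictedCauchyNonsingular → ∀ n A B → StrictTo n A → StrictTo n B →
    (∀ i → i < n → B i ≤ A i) → dt n (leadMatrix n A B) ≢ 0ℚ
  leadMatrix-nonsingular rcn n A B sA sB B≤A z with ℕP.anyUpTo? (λ i → matched? n B (A i)) n
  leadMatrix-nonsingular rcn (suc n) A B sA sB B≤A z | yes (i , i<n , j , j<n , e) =
    leadMatrix-nonsingular rcn n (A ∘ skip i) (B ∘ skip j) (strict-skip {n} {A} i sA) (strict-skip {n} {B} j sB) B≤A'
      (cancel-sign (altSign (i ℕ.+ j)) (altSign² (i ℕ.+ j)) (trans (sym (dt-leadMatrix-matched n A B i j sA sB i<n j<n e)) z))
    where
    -- Otherwise `B j < B i ≤ A i = B j`. Hence the deletion never moves `A` on while `B` stays; for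
    -- `j ≤ k < i` only `B` moves on, and `B (suc k) < B k ≤ A k`.
    j≤i : j ≤ i
    j≤i = ℕP.≮⇒≥ λ i<j → ℕP.<⇒≱ (sB i<j j<n) (ℕP.≤-trans (B≤A i i<n) (ℕP.≤-reflexive e))
    B≤A' : ∀ k → k < n → B (skip j k) ≤ A (skip i k)
    B≤A' k k<n with ℕP.<-≤-connex k i | ℕP.<-≤-connex k j
    ... | inj₁ k<i | inj₁ k<j rewrite skip-< k<i | skip-< k<j = B≤A k (ℕP.m≤n⇒m≤1+n k<n)
    ... | inj₁ k<i | inj₂ j≤k rewrite skip-< k<i | skip-≥ j≤k =
      ℕP.<⇒≤ (ℕP.<-≤-trans (sB (ℕP.n<1+n k) (s≤s k<n)) (B≤A k (ℕP.m≤n⇒m≤1+n k<n)))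
    ... | inj₂ i≤k | inj₁ k<j = ⊥-elim (ℕP.<⇒≱ k<j (ℕP.≤-trans j≤i i≤k))
    ... | inj₂ i≤k | inj₂ j≤k rewrite skip-≥ i≤k | skip-≥ j≤k = B≤A (suc k) (s≤s k<n)
  leadMatrix-nonsingular rcn n A B sA sB B≤A z | no ¬m = rcn n a b
    ( (λ i j i<j → ℤ.+<+ (sA i<j (FinP.toℕ<n j)))
    , (λ i j i<j → ℤ.+<+ (sB (ℕP.∸-monoʳ-< (s≤s i<j) (FinP.toℕ<n j)) (ℕP.∸-monoʳ-< (s≤s z≤n) (FinP.toℕ<n i))))
    -- Column `opposite i` holds `B i`, and without matches `B i ≤ A i` is strict.
    , (λ i → ℤ.+<+ (subst (λ k → B k < A (toℕ i)) (sym (opposite-reverse i))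
        (ℕP.≤∧≢⇒< (B≤A (toℕ i) (FinP.toℕ<n i)) λ e → ¬m (toℕ i , FinP.toℕ<n i , toℕ i , FinP.toℕ<n i , sym e))))
    , λ i j e → ¬m (toℕ i , FinP.toℕ<n i , n ∸ suc (toℕ j) , ℕP.∸-monoʳ-< (s≤s z≤n) (FinP.toℕ<n j) , ℤP.+-injective e))
    (trans (det-cauchy A B ℤ.0ℤ a b (λ i → sym (ℤP.+-identityʳ (a i))) (λ j → sym (ℤP.+-identityʳ (b j)))
        λ i i<n (j , j<n , e) → ¬m (i , i<n , j , j<n , e))
      (trans (cong (reverseSign n *_) z) (ℚP.*-zeroʳ (reverseSign n))))
    where
    a b : Fin n → ℤ
    a i = ℤ.+ A (toℕ i)
    b j = ℤ.+ B (n ∸ suc (toℕ j))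

  -- Positivity of the number of fillings

  1≰0 : ¬ (1ℚ ℚ.≤ 0ℚ)
  1≰0 p = ℚP.<-irrefl refl (ℚP.<-≤-trans (ℚP.positive⁻¹ 1ℚ) p)

  0≤1 : 0ℚ ℚ.≤ 1ℚ
  0≤1 = ℚP.nonNegative⁻¹ 1ℚ

  ind-*-nonneg : ∀ b {x} → 0ℚ ℚ.≤ x → 0ℚ ℚ.≤ ind b * x
  ind-*-nonneg true {x} p = subst (0ℚ ℚ.≤_) (sym (ℚP.*-identityˡ x)) p
  ind-*-nonneg false {x} p = ℚP.≤-reflexive (sym (ℚP.*-zeroˡ x))

  sumTo-nonneg : ∀ n {f} → (∀ i → 0ℚ ℚ.≤ f i) → 0ℚ ℚ.≤ sumTo n f
  sumTo-nonneg zero p = ℚP.≤-refl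
  sumTo-nonneg (suc n) {f} p = subst (ℚ._≤ f 0 + sumTo n (f ∘ suc)) (ℚP.+-identityˡ 0ℚ) (ℚP.+-mono-≤ (p 0) (sumTo-nonneg n (p ∘ suc)))

  sumTo-≥ : ∀ n {f} → (∀ i → 0ℚ ℚ.≤ f i) → ∀ i → i < n → f i ℚ.≤ sumTo n f
  sumTo-≥ (suc n) {f} p zero _ = subst (ℚ._≤ f 0 + sumTo n (f ∘ suc)) (ℚP.+-identityʳ (f 0)) (ℚP.+-mono-≤ (ℚP.≤-refl {f 0}) (sumTo-nonneg n (p ∘ suc)))
  sumTo-≥ (suc n) {f} p (suc i) (s≤s q) = subst (ℚ._≤ f 0 + sumTo n (f ∘ suc)) (ℚP.+-identityˡ (f (suc i))) (ℚP.+-mono-≤ (p 0) (sumTo-≥ n (p ∘ suc) i q))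

  wordSum-nonneg : ∀ t k {f} → (∀ w → 0ℚ ℚ.≤ f w) → 0ℚ ℚ.≤ wordSum t k f
  wordSum-nonneg t zero p = p []
  wordSum-nonneg t (suc k) p = sumTo-nonneg t λ x → wordSum-nonneg t k λ w → p (suc x ∷ w)

  wordSum-≥ : ∀ t k {f} → (∀ w → 0ℚ ℚ.≤ f w) → ∀ v → v < t → f (replicate k (suc v)) ℚ.≤ wordSum t k f
  wordSum-≥ t zero p v v<t = ℚP.≤-refl
  wordSum-≥ t (suc k) p v v<t = ℚP.≤-trans (wordSum-≥ t k (λ w → p (suc v ∷ w)) v v<t)
    (sumTo-≥ t (λ x → wordSum-nonneg t k λ w → p (suc x ∷ w)) v v<t)

  weaklyInc-replicate : ∀ k v → T (weaklyIncᵇ (replicate k v))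
  weaklyInc-replicate zero v = _
  weaklyInc-replicate (suc zero) v = _
  weaklyInc-replicate (suc (suc k)) v = ∧-intro (ℕP.≤⇒≤ᵇ (ℕP.≤-refl {v})) (weaklyInc-replicate (suc k) v)

  rowSum-nonneg : ∀ t n M L mp lp wp → 0ℚ ℚ.≤ rowSum t n M L mp lp wp
  rowSum-nonneg t zero M L mp lp wp = 0≤1
  rowSum-nonneg t (suc n) M L mp lp wp = wordSum-nonneg t (L 0 ∸ M 0) λ w →
    ind-*-nonneg (weaklyIncᵇ w) (ind-*-nonneg (colStrictᵇ mp lp wp (M 0) (L 0) w) (rowSum-nonneg t n _ _ _ _ w))

  !-replicate-≡ : ∀ k v {i} → i < k → replicate k v ! i ≡ v
  !-replicate-≡ (suc k) v {zero} _ = refl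
  !-replicate-≡ (suc k) v {suc i} (s≤s p) = !-replicate-≡ k v p

  !-replicate-≤ : ∀ k v i → replicate k v ! i ≤ v
  !-replicate-≤ zero v i = z≤n
  !-replicate-≤ (suc k) v zero = ℕP.≤-refl
  !-replicate-≤ (suc k) v (suc i) = !-replicate-≤ k v i

  -- witnessed by constant rows with increasing entries
  rowSum-≥1 : ∀ t n M L mp lp wp v → v ℕ.+ n ≤ t → (∀ i → wp ! i ≤ v) → 1ℚ ℚ.≤ rowSum t n M L mp lp wp
  rowSum-≥1 t zero M L mp lp wp v _ _ = ℚP.≤-refl
  rowSum-≥1 t (suc n) M L mp lp wp v v+n≤t wp≤v = ℚP.≤-trans
    (ℚP.≤-trans (rowSum-≥1 t n (M ∘ suc) (L ∘ suc) (M 0) (L 0) row (suc v) (subst (_≤ t) (ℕP.+-suc v n) v+n≤t)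
        (!-replicate-≤ (L 0 ∸ M 0) (suc v)))
      (ℚP.≤-reflexive (sym (trans (cong₂ (λ x y → x * (y * rest)) (ind-yes (weaklyInc-replicate (L 0 ∸ M 0) (suc v)))
          (ind-yes (colStrict-intro mp lp wp (M 0) (L 0) row λ j _ _ M≤j j<L →
            subst (wp ! (j ∸ mp) <_) (sym (!-replicate-≡ (L 0 ∸ M 0) (suc v) (ℕP.∸-monoˡ-< j<L M≤j))) (s≤s (wp≤v (j ∸ mp))))))
        (trans (ℚP.*-identityˡ (1ℚ * rest)) (ℚP.*-identityˡ rest))))))
    (wordSum-≥ t (L 0 ∸ M 0) (λ w →
      ind-*-nonneg (weaklyIncᵇ w) (ind-*-nonneg (colStrictᵇ mp lp wp (M 0) (L 0) w) (rowSum-nonneg t n _ _ _ _ w)))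
      v (ℕP.≤-trans (subst (suc v ≤_) (sym (ℕP.+-suc v n)) (s≤s (ℕP.m≤m+n v n))) v+n≤t))
    where
    row = replicate (L 0 ∸ M 0) (suc v)
    rest = rowSum t n (M ∘ suc) (L ∘ suc) (M 0) (L 0) row

open LeadingMatrix

-- Lower bound for the rank: strips that have to end

module RankLowerBound where

  open import Data.Nat using (_+_; _*_)

  bit : {P : Set} → Dec P → ℕ
  bit (yes _) = 1
  bit (no _) = 0

  bit-yes : ∀ {P : Set} (d : Dec P) → P → bit d ≡ 1
  bit-yes (yes _) p = refl
  bit-yes (no ¬p) p = contradiction p ¬p

  bit-no : ∀ {P : Set} (d : Dec P) → ¬ P → bit d ≡ 0
  bit-no (yes p) ¬p = contradiction p ¬p
  bit-no (no _) _ = refl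

  bit-mono : ∀ {P Q : Set} (p : Dec P) (q : Dec Q) → (P → Q) → bit p ≤ bit q
  bit-mono (yes p) q f = ℕP.≤-reflexive (sym (bit-yes q (f p)))
  bit-mono (no _) q f = z≤n

  bit≤1 : ∀ {P : Set} (d : Dec P) → bit d ≤ 1
  bit≤1 (yes _) = ℕP.≤-refl
  bit≤1 (no _) = z≤n

  sumℕ-cong : ∀ n {f g : ℕ → ℕ} → (∀ i → i < n → f i ≡ g i) → sumℕ n f ≡ sumℕ n g
  sumℕ-cong zero e = refl
  sumℕ-cong (suc n) e = cong₂ _+_ (e 0 (s≤s z≤n)) (sumℕ-cong n λ i i<n → e (suc i) (s≤s i<n))

  sumℕ-mono : ∀ n {f g : ℕ → ℕ} → (∀ i → i < n → f i ≤ g i) → sumℕ n f ≤ sumℕ n g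
  sumℕ-mono zero e = z≤n
  sumℕ-mono (suc n) e = ℕP.+-mono-≤ (e 0 (s≤s z≤n)) (sumℕ-mono n λ i i<n → e (suc i) (s≤s i<n))

  sumℕ-zero : ∀ n {f : ℕ → ℕ} → (∀ i → i < n → f i ≡ 0) → sumℕ n f ≡ 0
  sumℕ-zero zero e = refl
  sumℕ-zero (suc n) e = cong₂ _+_ (e 0 (s≤s z≤n)) (sumℕ-zero n λ i i<n → e (suc i) (s≤s i<n))

  count : ∀ n {P : ℕ → Set} → (∀ i → Dec (P i)) → ℕ
  count n P? = sumℕ n (λ i → bit (P? i))

  module _ {P : ℕ → Set} (P? : ∀ i → Dec (P i)) where

    count-≤ : ∀ n → count n P? ≤ n
    count-≤ n = go n P?
      where
      go : ∀ n {P : ℕ → Set} (P? : ∀ i → Dec (P i)) → count n P? ≤ n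
      go zero P? = z≤n
      go (suc n) P? = ℕP.+-mono-≤ (bit≤1 (P? 0)) (go n (P? ∘ suc))

  DownClosed : (ℕ → Set) → Set
  DownClosed P = ∀ i → P (suc i) → P i

  downClosed-0 : ∀ {P} → DownClosed P → ∀ i → P i → P 0
  downClosed-0 d zero p = p
  downClosed-0 d (suc i) p = downClosed-0 d i (d i p)

  -- A down-closed predicate holds on an initial segment, so its count below `n` is the length of
  -- that segment, cut off at `n`.
  <count⇒ : ∀ n {P : ℕ → Set} (P? : ∀ i → Dec (P i)) → DownClosed P → ∀ {i} → i < count n P? → P i
  <count⇒ (suc n) P? d {i} lt with P? 0
  <count⇒ (suc n) P? d {zero} lt | yes p = p
  <count⇒ (suc n) P? d {suc i} (s≤s lt) | yes p = <count⇒ n (P? ∘ suc) (d ∘ suc) lt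
  ... | no ¬p = contradiction (subst (i <_) (sumℕ-zero n λ j _ → bit-no (P? (suc j)) λ q → ¬p (downClosed-0 d (suc j) q)) lt) ℕP.n≮0

  ⇒<count : ∀ n {P : ℕ → Set} (P? : ∀ i → Dec (P i)) → DownClosed P → ∀ {i} → i < n → P i → i < count n P?
  ⇒<count (suc n) P? d {i} i<n p with P? 0
  ⇒<count (suc n) P? d {zero} i<n p | yes _ = s≤s z≤n
  ⇒<count (suc n) P? d {suc i} (s≤s i<n) p | yes _ = s≤s (⇒<count n (P? ∘ suc) (d ∘ suc) i<n p)
  ... | no ¬p = contradiction (downClosed-0 d i p) ¬p

  -- The last component says that exactly `x` ones precede `i`; it makes the enumeration injective
  -- and ties `i` to its position.
  nth : ∀ n (ρ : ℕ → ℕ) → (∀ i → ρ i ≤ 1) → ∀ x → x < sumℕ n ρ →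
    Σ ℕ λ i → i < n × ρ i ≡ 1 × sumℕ i ρ ≡ x
  nth (suc n) ρ b x lt with ρ 0 in e | b 0
  nth (suc n) ρ b zero lt | 1 | _ = 0 , s≤s z≤n , e , refl
  nth (suc n) ρ b (suc x) (s≤s lt) | 1 | _ =
    let (i , i<n , e₁ , e₂) = nth n (ρ ∘ suc) (b ∘ suc) x lt in suc i , s≤s i<n , e₁ , cong₂ _+_ e e₂
  nth (suc n) ρ b x lt | 0 | _ =
    let (i , i<n , e₁ , e₂) = nth n (ρ ∘ suc) (b ∘ suc) x lt in suc i , s≤s i<n , e₁ , cong₂ _+_ e e₂
  nth (suc n) ρ b x lt | suc (suc _) | s≤s ()

  sumℕ-injection : ∀ n (ρ : ℕ → ℕ) → (∀ i → ρ i ≤ 1) → ∀ s (R : ℕ → ℕ → Set) →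
    (∀ i → i < n → ρ i ≡ 1 → Σ ℕ λ ℓ → ℓ < s × R i ℓ) →
    (∀ {i i' ℓ} → i < n → i' < n → ℓ < s → R i ℓ → R i' ℓ → i ≡ i') → sumℕ n ρ ≤ s
  sumℕ-injection n ρ b s R f inj = ℕP.≮⇒≥ λ s<r →
    let (x , x' , x<x' , same) = FinP.pigeonhole s<r label
        (i , i<n , _ , ex) = index x
        (i' , i'<n , _ , ex') = index x'
        (ℓ<s , r) = related x
        (_ , r') = related x'
        i≡i' = inj i<n i'<n ℓ<s r (subst (λ ℓ → R i' (toℕ ℓ)) (sym same) r')
    in ℕP.<-irrefl (trans (sym ex) (trans (cong (λ i → sumℕ i ρ) i≡i') ex')) x<x'
    where
    index : (x : Fin (sumℕ n ρ)) → Σ ℕ λ i → i < n × ρ i ≡ 1 × sumℕ i ρ ≡ toℕ x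
    index x = nth n ρ b (toℕ x) (FinP.toℕ<n x)
    image : (x : Fin (sumℕ n ρ)) → Σ ℕ λ ℓ → ℓ < s × R (proj₁ (index x)) ℓ
    image x = f (proj₁ (index x)) (proj₁ (proj₂ (index x))) (proj₁ (proj₂ (proj₂ (index x))))
    label : Fin (sumℕ n ρ) → Fin s
    label x = fromℕ< (proj₁ (proj₂ (image x)))
    related : (x : Fin (sumℕ n ρ)) → toℕ (label x) < s × R (proj₁ (index x)) (toℕ (label x))
    related x = FinP.toℕ<n (label x) ,
      subst (R (proj₁ (index x))) (sym (FinP.toℕ-fromℕ< (proj₁ (proj₂ (image x))))) (proj₂ (proj₂ (image x)))

  !-applyUpTo : ∀ (f : ℕ → ℕ) n {i} → i < n → applyUpTo f n ! i ≡ f i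
  !-applyUpTo f (suc n) {zero} _ = refl
  !-applyUpTo f (suc n) {suc i} (s≤s p) = !-applyUpTo (f ∘ suc) n p

  !-applyUpTo-≥ : ∀ (f : ℕ → ℕ) n {i} → n ≤ i → applyUpTo f n ! i ≡ 0
  !-applyUpTo-≥ f zero _ = refl
  !-applyUpTo-≥ f (suc n) {suc i} (s≤s p) = !-applyUpTo-≥ (f ∘ suc) n p

  applyUpTo-partition : ∀ f n → (∀ i → suc i < n → f (suc i) ≤ f i) → IsPartition (applyUpTo f n)
  applyUpTo-partition f n a i with ℕP.<-≤-connex (suc i) n
  ... | inj₁ p = subst₂ _≤_ (sym (!-applyUpTo f n p)) (sym (!-applyUpTo f n (ℕP.<-trans (ℕP.n<1+n i) p))) (a i p)
  ... | inj₂ q = subst (_≤ applyUpTo f n ! i) (sym (!-applyUpTo-≥ f n q)) z≤n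

  module _ (S : Cell → Set) (S? : ∀ c → Dec (S c)) (n w : ℕ) (bounded : ∀ {i j} → S (i , j) → i < n × j < w)
    (convex : ∀ {i j i' j' i'' j''} → S (i , j) → S (i'' , j'') → i ≤ i' → i' ≤ i'' → j ≤ j' → j' ≤ j'' → S (i' , j')) where

    private
      Down : ℕ → ℕ → Set
      Down i j = Σ ℕ λ i' → i' < n × Σ ℕ λ j' → j' < w × i ≤ i' × j ≤ j' × S (i' , j')

      Down? : ∀ i j → Dec (Down i j)
      Down? i j = map′ (λ (i' , p , j' , q , r) → i' , p , j' , q , r) (λ (i' , p , j' , q , r) → i' , p , j' , q , r)
        (ℕP.anyUpTo? (λ i' → ℕP.anyUpTo? (λ j' → i ℕP.≤? i' ×-dec j ℕP.≤? j' ×-dec S? (i' , j')) w) n)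

      down : ∀ {i j i' j'} → i ≤ i' → j ≤ j' → Down i' j' → Down i j
      down p q (a , la , b , lb , x , y , s) = a , la , b , lb , ℕP.≤-trans p x , ℕP.≤-trans q y , s

      S⇒Down : ∀ {i j} → S (i , j) → Down i j
      S⇒Down {i} {j} s = i , proj₁ (bounded s) , j , proj₂ (bounded s) , ℕP.≤-refl , ℕP.≤-refl , s

      Gap : ℕ → ℕ → Set
      Gap i j = Down i j × ¬ S (i , j)

      Gap? : ∀ i j → Dec (Gap i j)
      Gap? i j = Down? i j ×-dec ¬? (S? (i , j))

      -- Convexity enters here: if `(i , j)` were in `S`, then `(i' , j')` would lie between it and
      -- the cell that witnesses `Down i' j'`.
      gap : ∀ {i j i' j'} → i ≤ i' → j ≤ j' → Gap i' j' → Gap i j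
      gap p q (d@(a , la , b , lb , x , y , s') , ¬s) = down p q d , λ s → ¬s (convex s s' p x q y)

      -- S is the difference of its down-closure and the part of it outside S.
      outer inner : ℕ → ℕ
      outer i = count w (Down? i)
      inner i = count w (Gap? i)

    convex⇒skewShape : IsSkewShape S
    convex⇒skewShape = applyUpTo outer n , applyUpTo inner n ,
      ( applyUpTo-partition outer n (λ i _ → sumℕ-mono w λ j _ → bit-mono (Down? (suc i) j) (Down? i j) (down (ℕP.n≤1+n i) ℕP.≤-refl))
      , applyUpTo-partition inner n (λ i _ → sumℕ-mono w λ j _ → bit-mono (Gap? (suc i) j) (Gap? i j) (gap (ℕP.n≤1+n i) ℕP.≤-refl))
      , contained ) ,
      λ c → to c , from c
      where
      contained : applyUpTo inner n ⊆ₚ applyUpTo outer n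
      contained i with ℕP.<-≤-connex i n
      ... | inj₁ p = subst₂ _≤_ (sym (!-applyUpTo inner n p)) (sym (!-applyUpTo outer n p))
        (sumℕ-mono w λ j _ → bit-mono (Gap? i j) (Down? i j) proj₁)
      ... | inj₂ q = subst (_≤ applyUpTo outer n ! i) (sym (!-applyUpTo-≥ inner n q)) z≤n
      to : ∀ c → S c → InSkew (applyUpTo outer n) (applyUpTo inner n) c
      to (i , j) s = let (i<n , j<w) = bounded s in
        subst (_≤ j) (sym (!-applyUpTo inner n i<n))
          (ℕP.≮⇒≥ λ lt → proj₂ (<count⇒ w (Gap? i) (λ _ → gap ℕP.≤-refl (ℕP.n≤1+n _)) lt) s) ,
        subst (j <_) (sym (!-applyUpTo outer n i<n))
          (⇒<count w (Down? i) (λ _ → down ℕP.≤-refl (ℕP.n≤1+n _)) j<w (S⇒Down s))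
      from : ∀ c → InSkew (applyUpTo outer n) (applyUpTo inner n) c → S c
      from (i , j) (lo , hi) with ℕP.<-≤-connex i n
      ... | inj₂ q = ⊥-elim (ℕP.n≮0 (subst (j <_) (!-applyUpTo-≥ outer n q) hi))
      ... | inj₁ i<n with S? (i , j)
      ... | yes s = s
      ... | no ¬s = ⊥-elim (ℕP.<⇒≱ (⇒<count w (Gap? i) (λ _ → gap ℕP.≤-refl (ℕP.n≤1+n _)) j<w (d , ¬s))
          (subst (_≤ j) (!-applyUpTo inner n i<n) lo))
        where
        hi' = subst (j <_) (!-applyUpTo outer n i<n) hi
        d = <count⇒ w (Down? i) (λ _ → down ℕP.≤-refl (ℕP.n≤1+n _)) hi'
        j<w = ℕP.<-≤-trans hi' (count-≤ (Down? i) w)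

  -- In a skew shape, two cells in strict south-east position force the whole rectangle between
  -- them, in particular the 2×2 square at `(i , j)`. So a border strip has at most one cell on each
  -- diagonal.
  borderStrip-diagonal : ∀ {S i j i' j'} → IsBorderStrip S → S (i , j) → S (i' , j') → i < i' → j < j' → ⊥
  borderStrip-diagonal {S} {i} {j} {i'} {j'} (_ , (nu , rho , (nuP , rhoP , _) , S⇔) , _ , no2x2) s s' i<i' j<j' =
    no2x2 i j (s , in-S (ℕP.≤-trans (rhoP i) lo) (ℕP.<-trans (ℕP.n<1+n j) sj<) ,
      in-S (ℕP.m≤n⇒m≤1+n lo) (ℕP.<-≤-trans sj< (nuP i)) , in-S (ℕP.≤-trans (rhoP i) (ℕP.m≤n⇒m≤1+n lo)) sj<)
    where
    lo = proj₁ (proj₁ (S⇔ (i , j)) s)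
    sj< : suc j < nu ! suc i
    sj< = ℕP.<-≤-trans (ℕP.≤-<-trans j<j' (proj₂ (proj₁ (S⇔ (i' , j')) s'))) (antitone-≤ {nu !_} nuP i<i')
    in-S : ∀ {x y} → rho ! x ≤ y → y < nu ! x → S (x , y)
    in-S {x} {y} p q = proj₂ (S⇔ (x , y)) (p , q)

  module _ (la mu : List ℕ) (skew : IsSkewPartition la mu) where

    private
      N = length la
      laP = proj₁ skew
      muP = proj₁ (proj₂ skew)
      mu≤la = proj₂ (proj₂ skew)

    -- Diagonals are numbered j - i + N; row i meets those from lower i up to, but excluding, upper i.
    upper lower : ℕ → ℕ
    upper i = la ! i + (N ∸ i)
    lower i = mu ! i + (N ∸ i)

    diagonal : Cell → ℕ
    diagonal (i , j) = j + (N ∸ i)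

    upper-strict : StrictTo N upper
    upper-strict {i} {j} i<j j<N = ℕP.+-mono-≤-< (antitone-≤ {la !_} laP (ℕP.<⇒≤ i<j)) (ℕP.∸-monoʳ-< i<j (ℕP.<⇒≤ j<N))

    lower-strict : StrictTo N lower
    lower-strict {i} {j} i<j j<N = ℕP.+-mono-≤-< (antitone-≤ {mu !_} muP (ℕP.<⇒≤ i<j)) (ℕP.∸-monoʳ-< i<j (ℕP.<⇒≤ j<N))

    lower≤upper : ∀ i → lower i ≤ upper i
    lower≤upper i = ℕP.+-monoˡ-≤ (N ∸ i) (mu≤la i)

    unmatchedCount : ℕ
    unmatchedCount = sumℕ N (λ i → unmatched N lower (upper i))

    row<N : ∀ {i j} → InSkew la mu (i , j) → i < N
    row<N {i} {j} (_ , j<) = ℕP.≰⇒> λ N≤i → ℕP.n≮0 (subst (j <_) (!-overflow la N≤i) j<)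

    diagonal-bounds : ∀ {c} → InSkew la mu c → lower (proj₁ c) ≤ diagonal c × diagonal c < upper (proj₁ c)
    diagonal-bounds {i , j} (lo , hi) = ℕP.+-monoˡ-≤ (N ∸ i) lo , ℕP.+-monoˡ-< (N ∸ i) hi

    cellAt : ℕ → ℕ → Cell
    cellAt i k = i , k ∸ (N ∸ i)

    cellAt-inSkew : ∀ {i k} → lower i ≤ k → k < upper i → InSkew la mu (cellAt i k)
    cellAt-inSkew {i} {k} lo hi =
      subst (_≤ k ∸ (N ∸ i)) (ℕP.m+n∸n≡m (mu ! i) (N ∸ i)) (ℕP.∸-monoˡ-≤ (N ∸ i) lo) ,
      subst (k ∸ (N ∸ i) <_) (ℕP.m+n∸n≡m (la ! i) (N ∸ i))
        (ℕP.∸-monoˡ-< hi (ℕP.≤-trans (ℕP.m≤n+m (N ∸ i) (mu ! i)) lo))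

    diagonal-cellAt : ∀ {i k} → lower i ≤ k → diagonal (cellAt i k) ≡ k
    diagonal-cellAt {i} {k} lo = ℕP.m∸n+n≡m (ℕP.≤-trans (ℕP.m≤n+m (N ∸ i) (mu ! i)) lo)

    cellAt-diagonal : ∀ c → cellAt (proj₁ c) (diagonal c) ≡ c
    cellAt-diagonal (i , j) = cong (i ,_) (ℕP.m+n∸n≡m j (N ∸ i))

    sameDiagonal-< : ∀ {i j i' j'} → i < i' → i' < N → j + (N ∸ i) ≡ j' + (N ∸ i') → j < j'
    sameDiagonal-< {i} {j} {i'} {j'} i<i' i'<N e = ℕP.≰⇒> λ j'≤j →
      ℕP.<-irrefl (sym e) (ℕP.+-mono-≤-< j'≤j (ℕP.∸-monoʳ-< i<i' (ℕP.<⇒≤ i'<N)))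

    diagonal-adj : ∀ {c d} → Adj c d → diagonal d ≤ suc (diagonal c)
    diagonal-adj {i , j} (inj₁ (refl , inj₁ refl)) = ℕP.≤-refl
    diagonal-adj {i , .(suc j')} {_ , j'} (inj₁ (refl , inj₂ refl)) = ℕP.m≤n⇒m≤1+n (ℕP.n≤1+n _)
    diagonal-adj {i , j} (inj₂ (refl , inj₁ refl)) = ℕP.m≤n⇒m≤1+n (ℕP.+-monoʳ-≤ j (ℕP.∸-monoʳ-≤ N (ℕP.n≤1+n i)))
    diagonal-adj {.(suc i') , j} {i' , _} (inj₂ (refl , inj₂ refl)) =
      subst (j + (N ∸ i') ≤_) (ℕP.+-suc j _) (ℕP.+-monoʳ-≤ j (ℕP.m≤n+o⇒m∸n≤o N i' (ℕP.≤-trans (ℕP.m≤n+m∸n N (suc i'))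
        (ℕP.≤-reflexive (sym (ℕP.+-suc i' (N ∸ suc i')))))))

    -- A discrete intermediate value theorem: the diagonal rises by at most one per step.
    path-crosses : ∀ {S c d k} → Path S c d → diagonal c < k → k ≤ diagonal d → Σ Cell λ e → S e × diagonal e ≡ k
    path-crosses here lt le = ⊥-elim (ℕP.<⇒≱ lt le)
    path-crosses {k = k} (step {d = e} adj s p) lt le with ℕP.<-≤-connex (diagonal e) k
    ... | inj₁ lt' = path-crosses p lt' le
    ... | inj₂ ge = e , s , ℕP.≤-antisym (ℕP.≤-trans (diagonal-adj adj) lt) ge

    module _ {s : ℕ} (D : BorderStripDecomp la mu s) where

      private
        col = proj₁ D
        col< = proj₁ (proj₂ D)

        Strip : ℕ → Cell → Set
        Strip ℓ c = InSkew la mu c × col c ≡ ℓ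

        strip : ∀ ℓ → ℓ < s → IsBorderStrip (Strip ℓ)
        strip = proj₂ (proj₂ D)

      EndsAt : ℕ → ℕ → Set
      EndsAt ℓ k = Σ Cell (λ c → Strip ℓ c × suc (diagonal c) ≡ k) × (∀ c → Strip ℓ c → diagonal c ≢ k)

      -- A strip that ends at `k'` has a cell on diagonal `k' - 1 ≥ k`, so by connectedness it meets
      -- `k` on the way from `k - 1`. Hence each strip accounts for at most one end.
      ends-≮ : ∀ {ℓ k k'} → ℓ < s → EndsAt ℓ k → EndsAt ℓ k' → k < k' → ⊥
      ends-≮ {ℓ} {k} {k'} ℓ<s ((c , sc , e) , none) ((c' , sc' , e') , _) k<k' =
        let (d , sd , ed) = path-crosses {k = k} (proj₁ (proj₂ (proj₂ (strip ℓ ℓ<s))) c c' sc sc') (ℕP.≤-reflexive e)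
                              (ℕ.s≤s⁻¹ (subst (k <_) (sym e') k<k'))
        in none d sd ed

      ends-unique : ∀ {ℓ k k'} → ℓ < s → EndsAt ℓ k → EndsAt ℓ k' → k ≡ k'
      ends-unique {ℓ} {k} {k'} ℓ<s p q with ℕP.<-cmp k k'
      ... | tri< lt _ _ = ⊥-elim (ends-≮ ℓ<s p q lt)
      ... | tri≈ _ e _ = e
      ... | tri> _ _ gt = ⊥-elim (ends-≮ ℓ<s q p gt)

      sameStrip-sameDiagonal : ∀ {ℓ c c'} → ℓ < s → Strip ℓ c → Strip ℓ c' → diagonal c ≡ diagonal c' → proj₁ c < proj₁ c' → ⊥
      sameStrip-sameDiagonal {ℓ} {c} {c'} ℓ<s sc sc' e lt =
        borderStrip-diagonal (strip ℓ ℓ<s) sc sc' lt (sameDiagonal-< lt (row<N (proj₁ sc')) e)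

      -- Rows p..m meet diagonal k - 1 and rows p..m-1 meet diagonal k = upper m,
      -- so not every strip can pass from the former to the latter.
      strip-ending : ∀ m → m < N → ¬ Matched N lower (upper m) → Σ ℕ λ ℓ → ℓ < s × EndsAt ℓ (upper m)
      strip-ending m m<N ¬matched = go (upper m) refl
        where
        go : ∀ k → upper m ≡ k → Σ ℕ λ ℓ → ℓ < s × EndsAt ℓ k
        go zero e = contradiction (ℕP.m<n⇒0<n∸m m<N) (ℕP.<⇒≱ (s≤s (ℕP.≤-trans (ℕP.m≤n+m (N ∸ m) (la ! m)) (ℕP.≤-reflexive e))))
        go (suc k) e = result (FinP.all? passes?)
          where
          p : ℕ
          p = count m (λ i → suc k ℕP.≤? lower i)
          Low : ℕ → Set
          Low i = lower i < suc k
          -- Unmatchedness enters here: no row starts on diagonal `suc k`, so every row that meets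
          -- it also meets `k`.
          lower≢ : ∀ {i} → i < N → lower i ≢ suc k
          lower≢ {i} i<N e' = ¬matched (i , i<N , trans e (sym e'))
          low-m : Low m
          low-m = ℕP.≤∧≢⇒< (subst (lower m ≤_) e (lower≤upper m)) (lower≢ m<N)
          lower-antitone : ∀ i → lower (suc i) ≤ lower i
          lower-antitone i = ℕP.+-mono-≤ (muP i) (ℕP.∸-monoʳ-≤ N (ℕP.n≤1+n i))
          closed : DownClosed (λ i → suc k ≤ lower i)
          closed i q = ℕP.≤-trans q (lower-antitone i)
          p≤m : p ≤ m
          p≤m = count-≤ (λ i → suc k ℕP.≤? lower i) m
          high : ∀ {i} → i < p → suc k ≤ lower i
          high = <count⇒ m (λ i → suc k ℕP.≤? lower i) closed
          low : ∀ {i} → p ≤ i → i ≤ m → Low i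
          low {i} p≤i i≤m with ℕP.m≤n⇒m<n∨m≡n i≤m
          ... | inj₂ refl = low-m
          ... | inj₁ i<m = ℕP.≰⇒> λ q → ℕP.<⇒≱ (⇒<count m (λ i → suc k ℕP.≤? lower i) closed i<m q) p≤i
          d = m ∸ p
          p+x≤m : ∀ {x} → x ≤ d → p + x ≤ m
          p+x≤m {x} q = subst (p + x ≤_) (ℕP.m+[n∸m]≡n p≤m) (ℕP.+-monoʳ-≤ p q)
          upper-≥ : ∀ {i} → i ≤ m → suc k ≤ upper i
          upper-≥ {i} i≤m = subst (_≤ upper i) e (ℕP.+-mono-≤ (antitone-≤ {la !_} laP i≤m) (ℕP.∸-monoʳ-≤ N i≤m))
          before : ∀ x → x ≤ d → InSkew la mu (cellAt (p + x) k)
          before x q = cellAt-inSkew (ℕ.s≤s⁻¹ (low (ℕP.m≤m+n p x) (p+x≤m q))) (upper-≥ (p+x≤m q))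
          diagonal-before : ∀ x → x ≤ d → diagonal (cellAt (p + x) k) ≡ k
          diagonal-before x q = diagonal-cellAt {p + x} (ℕ.s≤s⁻¹ (low (ℕP.m≤m+n p x) (p+x≤m q)))
          Passes : Fin (suc d) → Set
          Passes x = Σ (Fin d) λ y → col (cellAt (p + toℕ y) (suc k)) ≡ col (cellAt (p + toℕ x) k)
          passes? : ∀ x → Dec (Passes x)
          passes? x = FinP.any? λ y → col (cellAt (p + toℕ y) (suc k)) ℕP.≟ col (cellAt (p + toℕ x) k)
          ≤d : ∀ (x : Fin (suc d)) → toℕ x ≤ d
          ≤d x = ℕ.s≤s⁻¹ (FinP.toℕ<n x)
          result : Dec (∀ x → Passes x) → Σ ℕ λ ℓ → ℓ < s × EndsAt ℓ (suc k)
          result (yes all) =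
            -- The `suc d` cells on diagonal `k` would be sent to the `d` cells on `suc k`; a
            -- collision puts two cells of one diagonal into the same strip.
            let (x , x' , x<x' , same) = FinP.pigeonhole (ℕP.n<1+n d) (proj₁ ∘ all)
                ℓ = col (cellAt (p + toℕ x) k)
            in ⊥-elim (sameStrip-sameDiagonal (col< _ (before (toℕ x) (≤d x)))
                 (before (toℕ x) (≤d x) , refl)
                 (before (toℕ x') (≤d x') ,
                   trans (sym (proj₂ (all x'))) (trans (cong (λ y → col (cellAt (p + toℕ y) (suc k))) (sym same)) (proj₂ (all x))))
                 (trans (diagonal-before (toℕ x) (≤d x)) (sym (diagonal-before (toℕ x') (≤d x'))))
                 (ℕP.+-monoʳ-< p x<x'))
          result (no ¬all) =
            let (x , ¬passes) = FinP.¬∀⟶∃¬ (suc d) Passes passes? ¬all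
                c = cellAt (p + toℕ x) k
            in col c , col< c (before (toℕ x) (≤d x)) ,
               (c , (before (toℕ x) (≤d x) , refl) , cong suc (diagonal-before (toℕ x) (≤d x))) ,
               λ { c'@(i , j) (inS , col≡) diag≡ →
                 let (lo , hi) = diagonal-bounds {c'} inS
                     lo' = subst (lower i ≤_) diag≡ lo
                     hi' = subst (_< upper i) diag≡ hi
                     i<m = ℕP.≰⇒> λ m≤i → ℕP.<⇒≱ hi' (subst (upper i ≤_) e
                             (ℕP.+-mono-≤ (antitone-≤ {la !_} laP m≤i) (ℕP.∸-monoʳ-≤ N m≤i)))
                     p≤i = ℕP.≮⇒≥ λ i<p → lower≢ (row<N inS) (ℕP.≤-antisym lo' (high i<p))
                     i∸p<d = ℕP.∸-monoˡ-< i<m p≤i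
                     y = fromℕ< i∸p<d
                     row≡ = trans (cong (p +_) (FinP.toℕ-fromℕ< i∸p<d)) (ℕP.m+[n∸m]≡n p≤i)
                 in ¬passes (y , trans (cong col (trans (cong₂ cellAt row≡ (sym diag≡)) (cellAt-diagonal c'))) col≡) }

      unmatchedCount≤ : unmatchedCount ≤ s
      unmatchedCount≤ = sumℕ-injection N (λ i → unmatched N lower (upper i)) (λ i → unmatched≤1 N lower (upper i)) s (λ i ℓ → EndsAt ℓ (upper i))
        (λ i i<N e → strip-ending i i<N (unmatched≡1⇒ {N} {lower} e))
        (λ i<N i'<N ℓ<s p q → strict-injective {N} {upper} upper-strict i<N i'<N (ends-unique ℓ<s p q))

open RankLowerBound

-- A border strip decomposition with as many strips as unmatched ends

module RankUpperBound where

  open import Data.Nat using (_+_; _*_)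
  open import Data.Nat.Tactic.RingSolver using () renaming (solve-∀ to solveℕ-∀)

  sumℕ-+ : ∀ n (f g : ℕ → ℕ) → sumℕ n (λ i → f i + g i) ≡ sumℕ n f + sumℕ n g
  sumℕ-+ zero f g = refl
  sumℕ-+ (suc n) f g = trans (cong (f 0 + g 0 +_) (sumℕ-+ n (f ∘ suc) (g ∘ suc))) (rearr (f 0) (g 0) _ _)
    where
    rearr : ∀ a b c d → a + b + (c + d) ≡ a + c + (b + d)
    rearr = solveℕ-∀

  sumℕ-*ˡ : ∀ n c (f : ℕ → ℕ) → sumℕ n (λ i → c * f i) ≡ c * sumℕ n f
  sumℕ-*ˡ zero c f = sym (ℕP.*-zeroʳ c)
  sumℕ-*ˡ (suc n) c f = trans (cong (c * f 0 +_) (sumℕ-*ˡ n c (f ∘ suc))) (sym (ℕP.*-distribˡ-+ c (f 0) _))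

  sumℕ-swap : ∀ m n (f : ℕ → ℕ → ℕ) → sumℕ m (λ i → sumℕ n (f i)) ≡ sumℕ n (λ j → sumℕ m (λ i → f i j))
  sumℕ-swap zero n f = sym (sumℕ-zero n λ _ _ → refl)
  sumℕ-swap (suc m) n f = trans (cong (sumℕ n (f 0) +_) (sumℕ-swap m n (f ∘ suc))) (sym (sumℕ-+ n (f 0) _))

  sumℕ-≥ : ∀ n (f : ℕ → ℕ) {i} → i < n → f i ≤ sumℕ n f
  sumℕ-≥ (suc n) f {zero} _ = ℕP.m≤m+n (f 0) _
  sumℕ-≥ (suc n) f {suc i} (s≤s p) = ℕP.≤-trans (sumℕ-≥ n (f ∘ suc) p) (ℕP.m≤n+m _ (f 0))

  sumℕ-truncate : ∀ {m n} (f g : ℕ → ℕ) → m ≤ n → (∀ i → i < m → g i ≡ f i) → (∀ i → m ≤ i → g i ≡ 0) →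
    sumℕ n g ≡ sumℕ m f
  sumℕ-truncate {zero} {n} f g _ e z = sumℕ-zero n λ i _ → z i z≤n
  sumℕ-truncate {suc m} {suc n} f g (s≤s p) e z = cong₂ _+_ (e 0 (s≤s z≤n))
    (sumℕ-truncate (f ∘ suc) (g ∘ suc) p (λ i q → e (suc i) (s≤s q)) (λ i q → z (suc i) (s≤s q)))

  sumℕ-last : ∀ n (f : ℕ → ℕ) → sumℕ (suc n) f ≡ sumℕ n f + f n
  sumℕ-last zero f = ℕP.+-identityʳ (f 0)
  sumℕ-last (suc n) f = trans (cong (f 0 +_) (sumℕ-last n (f ∘ suc))) (sym (ℕP.+-assoc (f 0) _ _))

  bit≡1⇒ : ∀ {P : Set} (d : Dec P) → bit d ≡ 1 → P
  bit≡1⇒ (yes p) _ = p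

  count-≤1 : ∀ n {P : ℕ → Set} (P? : ∀ i → Dec (P i)) → (∀ {i j} → i < n → j < n → P i → P j → i ≡ j) → count n P? ≤ 1
  count-≤1 n {P} P? u = sumℕ-injection n (λ i → bit (P? i)) (λ i → bit≤1 (P? i)) 1 (λ i _ → P i)
    (λ i _ e → 0 , s≤s z≤n , bit≡1⇒ (P? i) e) (λ i<n j<n _ → u i<n j<n)

  split-≤1 : ∀ a {e} → e ≤ 1 → a ≡ a * (1 ∸ e) + a * e
  split-≤1 a {zero} _ = sym (trans (cong₂ _+_ (ℕP.*-identityʳ a) (ℕP.*-zeroʳ a)) (ℕP.+-identityʳ a))
  split-≤1 a {suc zero} _ = sym (cong₂ _+_ (ℕP.*-zeroʳ a) (ℕP.*-identityʳ a))
  split-≤1 a {suc (suc _)} (s≤s ())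

  Adj-sym : ∀ {c d} → Adj c d → Adj d c
  Adj-sym (inj₁ (e , inj₁ p)) = inj₁ (sym e , inj₂ (sym p))
  Adj-sym (inj₁ (e , inj₂ p)) = inj₁ (sym e , inj₁ (sym p))
  Adj-sym (inj₂ (e , inj₁ p)) = inj₂ (sym e , inj₂ (sym p))
  Adj-sym (inj₂ (e , inj₂ p)) = inj₂ (sym e , inj₁ (sym p))

  module _ (la mu : List ℕ) (skew : IsSkewPartition la mu) where

    private
      N = length la
      laP = proj₁ skew
      muP = proj₁ (proj₂ skew)
      A = upper la mu skew
      B = lower la mu skew
      D = diagonal la mu skew
      cell = cellAt la mu skew
      A-strict = upper-strict la mu skew
      B-strict = lower-strict la mu skew
      r = unmatchedCount la mu skew

      above : ℕ → ℕ → ℕ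
      above k a = bit (k ℕP.<? a)

      above-antitone : ∀ k a → above (suc k) a ≤ above k a
      above-antitone k a = bit-mono (suc k ℕP.<? a) (k ℕP.<? a) (ℕP.<-trans (ℕP.n<1+n k))

      eq : ℕ → ℕ → ℕ
      eq i j = bit (A i ℕP.≟ B j)

      -- The indicator of being matched, written as a count so that double sums over pairs can be
      -- interchanged.
      eA eB : ℕ → ℕ
      eA i = count N (λ j → A i ℕP.≟ B j)
      eB j = count N (λ i → A i ℕP.≟ B j)

      eA≤1 : ∀ i → eA i ≤ 1
      eA≤1 i = count-≤1 N (λ j → A i ℕP.≟ B j) λ i<N j<N p q → strict-injective {N} {B} B-strict i<N j<N (trans (sym p) q)

      eB≤1 : ∀ j → eB j ≤ 1
      eB≤1 j = count-≤1 N (λ i → A i ℕP.≟ B j) λ i<N j<N p q → strict-injective {N} {A} A-strict i<N j<N (trans p (sym q))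

      unmatched≡ : ∀ i → unmatched N B (A i) ≡ 1 ∸ eA i
      unmatched≡ i with matched? N B (A i)
      ... | yes (j , j<N , e) = sym (ℕP.m≤n⇒m∸n≡0 (ℕP.≤-trans (ℕP.≤-reflexive (sym (bit-yes (A i ℕP.≟ B j) e)))
                                  (sumℕ-≥ N (eq i) j<N)))
      ... | no ¬m = sym (cong (1 ∸_) (sumℕ-zero N λ j j<N → bit-no (A i ℕP.≟ B j) λ e → ¬m (j , j<N , e)))

      -- how many ends (upper i) and starts (lower j) of rows lie beyond diagonal k
      allA allB matchedA matchedB unmatchedA unmatchedB : ℕ → ℕ
      allA k = sumℕ N (λ i → above k (A i))
      allB k = sumℕ N (λ j → above k (B j))
      matchedA k = sumℕ N (λ i → above k (A i) * eA i)
      matchedB k = sumℕ N (λ j → above k (B j) * eB j)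
      unmatchedA k = sumℕ N (λ i → above k (A i) * (1 ∸ eA i))
      unmatchedB k = sumℕ N (λ j → above k (B j) * (1 ∸ eB j))

      allA≡ : ∀ k → allA k ≡ unmatchedA k + matchedA k
      allA≡ k = trans (sumℕ-cong N λ i _ → split-≤1 (above k (A i)) (eA≤1 i)) (sumℕ-+ N _ _)

      -- Both are the number of pairs `A i ≡ B j` with common value beyond `k`, summed in the two
      -- orders.
      matchedB≡matchedA : ∀ k → matchedB k ≡ matchedA k
      matchedB≡matchedA k = trans (sumℕ-cong N λ j _ → sym (sumℕ-*ˡ N (above k (B j)) (λ i → eq i j)))
        (trans (sumℕ-swap N N (λ j i → above k (B j) * eq i j))
          (sumℕ-cong N λ i _ → trans (sumℕ-cong N λ j _ → same i j) (sumℕ-*ˡ N (above k (A i)) (eq i))))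
        where
        same : ∀ i j → above k (B j) * eq i j ≡ above k (A i) * eq i j
        same i j with A i ℕP.≟ B j
        ... | yes e = cong (λ a → above k a * 1) (sym e)
        ... | no _ = trans (ℕP.*-zeroʳ (above k (B j))) (sym (ℕP.*-zeroʳ (above k (A i))))

      allB≡ : ∀ k → allB k ≡ unmatchedB k + matchedA k
      allB≡ k = trans (sumℕ-cong N λ j _ → split-≤1 (above k (B j)) (eB≤1 j))
        (trans (sumℕ-+ N _ _) (cong (unmatchedB k +_) (matchedB≡matchedA k)))

      antitone : ∀ (f : ℕ → ℕ) → (∀ k → f (suc k) ≤ f k) → ∀ {k k'} → k ≤ k' → f k' ≤ f k
      antitone f a p = antitone-≤ a p

      unmatchedA-antitone : ∀ k → unmatchedA (suc k) ≤ unmatchedA k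
      unmatchedA-antitone k = sumℕ-mono N λ i _ → ℕP.*-monoˡ-≤ (1 ∸ eA i) (above-antitone k (A i))

      unmatchedB-antitone : ∀ k → unmatchedB (suc k) ≤ unmatchedB k
      unmatchedB-antitone k = sumℕ-mono N λ i _ → ℕP.*-monoˡ-≤ (1 ∸ eB i) (above-antitone k (B i))

      matchedA-antitone : ∀ k → matchedA (suc k) ≤ matchedA k
      matchedA-antitone k = sumℕ-mono N λ i _ → ℕP.*-monoˡ-≤ (eA i) (above-antitone k (A i))

      A-antitone : ∀ i → A (suc i) ≤ A i
      A-antitone i = ℕP.+-mono-≤ (laP i) (ℕP.∸-monoʳ-≤ N (ℕP.n≤1+n i))

      B-antitone : ∀ i → B (suc i) ≤ B i
      B-antitone i = ℕP.+-mono-≤ (muP i) (ℕP.∸-monoʳ-≤ N (ℕP.n≤1+n i))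

      <allA⇒ : ∀ {k x} → x < allA k → k < A x
      <allA⇒ {k} = <count⇒ N (λ i → k ℕP.<? A i) λ i p → ℕP.<-≤-trans p (A-antitone i)

      ⇒<allA : ∀ {k x} → x < N → k < A x → x < allA k
      ⇒<allA {k} = ⇒<count N (λ i → k ℕP.<? A i) λ i p → ℕP.<-≤-trans p (A-antitone i)

      <allB⇒ : ∀ {k x} → x < allB k → k < B x
      <allB⇒ {k} = <count⇒ N (λ i → k ℕP.<? B i) λ i p → ℕP.<-≤-trans p (B-antitone i)

      ⇒<allB : ∀ {k x} → x < N → k < B x → x < allB k
      ⇒<allB {k} = ⇒<count N (λ i → k ℕP.<? B i) λ i p → ℕP.<-≤-trans p (B-antitone i)

      allA≤N : ∀ k → allA k ≤ N
      allA≤N k = count-≤ (λ i → k ℕP.<? A i) N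

      allA-suc : ∀ k → allA k ≤ suc (allA (suc k))
      allA-suc k = ℕP.≮⇒≥ λ lt →
        let x = allA (suc k)
            sx<N = ℕP.<-≤-trans lt (allA≤N k)
        in ℕP.<-irrefl refl (⇒<allA {suc k} {x} (ℕP.<-trans (ℕP.n<1+n x) sx<N)
             (ℕP.≤-<-trans (<allA⇒ lt) (A-strict (ℕP.n<1+n x) sx<N)))

      -- The ends are distinct, so `allA` drops by at most one, and `unmatchedA` never grows with
      -- `k`; this bounds the drop of `matchedA`. A strip therefore climbs at most one row per
      -- diagonal.
      matchedA-suc : ∀ k → matchedA k ≤ suc (matchedA (suc k))
      matchedA-suc k = ℕP.+-cancelˡ-≤ (unmatchedA k) _ _ (begin
        unmatchedA k + matchedA k ≡⟨ sym (allA≡ k) ⟩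
        allA k ≤⟨ allA-suc k ⟩
        suc (allA (suc k)) ≡⟨ cong suc (allA≡ (suc k)) ⟩
        suc (unmatchedA (suc k) + matchedA (suc k)) ≡⟨ sym (ℕP.+-suc (unmatchedA (suc k)) (matchedA (suc k))) ⟩
        unmatchedA (suc k) + suc (matchedA (suc k)) ≤⟨ ℕP.+-monoˡ-≤ (suc (matchedA (suc k))) (unmatchedA-antitone k) ⟩
        unmatchedA k + suc (matchedA (suc k)) ∎)
        where open ℕP.≤-Reasoning

      -- On a strip, `k + matchedA k` is the column up to a constant, so columns never decrease as
      -- the diagonal grows.
      k+matchedA-monotone : ∀ {k k'} → k ≤ k' → k + matchedA k ≤ k' + matchedA k'
      k+matchedA-monotone {k} {k'} p = subst (λ x → k + matchedA k ≤ x + matchedA x) (ℕP.m∸n+n≡m p) (go (k' ∸ k))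
        where
        go : ∀ d → k + matchedA k ≤ d + k + matchedA (d + k)
        go zero = ℕP.≤-refl
        go (suc d) = ℕP.≤-trans (go d) (ℕP.≤-trans (ℕP.+-monoʳ-≤ (d + k) (matchedA-suc (d + k))) (ℕP.≤-reflexive (ℕP.+-suc (d + k) _)))

    -- A strip stays in its row, except that at a diagonal where one row ends and another starts
    -- all strips move up by one row.
    stripIndex : Cell → ℕ
    stripIndex c = proj₁ c ∸ matchedA (D c)

    module _ (ℓ : ℕ) where

      private
        S : Cell → Set
        S c = InSkew la mu c × stripIndex c ≡ ℓ

        S? : ∀ c → Dec (S c)
        S? (i , j) = (mu ! i ℕP.≤? j ×-dec j ℕP.<? la ! i) ×-dec (stripIndex (i , j) ℕP.≟ ℓ)

        -- The condition for strip `ℓ` to have a cell on diagonal `k`: the range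
        -- `allB k ≤ i < allA k` of the rows there, lowered by `matchedA k`.
        Live : ℕ → Set
        Live k = unmatchedB k ≤ ℓ × ℓ < unmatchedA k

        row : ℕ → ℕ
        row k = ℓ + matchedA k

        pos : ℕ → Cell
        pos k = cell (row k) k

      live-between : ∀ {k k' k''} → Live k → Live k'' → k ≤ k' → k' ≤ k'' → Live k'
      live-between (b , _) (_ , a) p q =
        ℕP.≤-trans (antitone unmatchedB unmatchedB-antitone p) b , ℕP.<-≤-trans a (antitone unmatchedA unmatchedA-antitone q)

      allB≤row : ∀ {c} → InSkew la mu c → allB (D c) ≤ proj₁ c
      allB≤row {c} s = ℕP.≮⇒≥ λ lt → ℕP.<⇒≱ (<allB⇒ lt) (proj₁ (diagonal-bounds la mu skew {c} s))

      row<allA : ∀ {c} → InSkew la mu c → proj₁ c < allA (D c)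
      row<allA {c} s = ⇒<allA (row<N la mu skew s) (proj₂ (diagonal-bounds la mu skew {c} s))

      matchedA≤row : ∀ {c} → InSkew la mu c → matchedA (D c) ≤ proj₁ c
      matchedA≤row {c} s = ℕP.≤-trans (ℕP.≤-trans (ℕP.m≤n+m _ (unmatchedB (D c))) (ℕP.≤-reflexive (sym (allB≡ (D c))))) (allB≤row s)

      S-row : ∀ {c} → S c → proj₁ c ≡ row (D c)
      S-row {c} (s , refl) = sym (ℕP.m∸n+n≡m (matchedA≤row {c} s))

      S-live : ∀ {c} → S c → Live (D c)
      S-live {c} sc@(s , _) =
        ℕP.+-cancelʳ-≤ (matchedA (D c)) _ _ (subst₂ _≤_ (allB≡ (D c)) (S-row {c} sc) (allB≤row {c} s)) ,
        ℕP.+-cancelʳ-< (matchedA (D c)) _ _ (subst₂ _<_ (S-row {c} sc) (allA≡ (D c)) (row<allA {c} s))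

      S-pos : ∀ {c} → S c → pos (D c) ≡ c
      S-pos {c} s = trans (cong (λ x → cell x (D c)) (sym (S-row {c} s))) (cellAt-diagonal la mu skew c)

      live-row : ∀ {k} → Live k → row k < N × B (row k) ≤ k × k < A (row k)
      live-row {k} (b , a) = row<N' , ℕP.≮⇒≥ (λ lt → ℕP.<⇒≱ (⇒<allB row<N' lt) allB≤) , <allA⇒ <allA
        where
        <allA : row k < allA k
        <allA = subst (row k <_) (sym (allA≡ k)) (ℕP.+-monoˡ-< (matchedA k) a)
        allB≤ : allB k ≤ row k
        allB≤ = subst (_≤ row k) (sym (allB≡ k)) (ℕP.+-monoˡ-≤ (matchedA k) b)
        row<N' = ℕP.<-≤-trans <allA (allA≤N k)

      D-pos : ∀ {k} → Live k → D (pos k) ≡ k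
      D-pos l = diagonal-cellAt la mu skew (proj₁ (proj₂ (live-row l)))

      live-S : ∀ {k} → Live k → S (pos k)
      live-S {k} l = cellAt-inSkew la mu skew (proj₁ (proj₂ (live-row l))) (proj₂ (proj₂ (live-row l))) ,
        trans (cong (λ d → row k ∸ matchedA d) (D-pos l)) (ℕP.m+n∸n≡m ℓ (matchedA k))

      N∸row≤ : ∀ {k} → Live k → N ∸ row k ≤ k
      N∸row≤ {k} l = ℕP.≤-trans (ℕP.m≤n+m (N ∸ row k) (mu ! row k)) (proj₁ (proj₂ (live-row l)))

      -- Where `matchedA` is constant the strip moves one column to the right; where it drops by one
      -- the strip moves one row up within its column.
      adjacent : ∀ {k} → Live k → Live (suc k) → Adj (pos k) (pos (suc k))
      adjacent {k} l l' with ℕP.m≤n⇒m<n∨m≡n (matchedA-antitone k)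
      ... | inj₂ e = inj₁ (cong (ℓ +_) (sym e) ,
        inj₁ (trans (sym (ℕP.+-∸-assoc 1 (N∸row≤ l))) (cong (λ m → suc k ∸ (N ∸ (ℓ + m))) (sym e))))
      ... | inj₁ lt = inj₂ (columns , inj₂ rows)
        where
        rows : row k ≡ suc (row (suc k))
        rows = trans (cong (ℓ +_) (ℕP.≤-antisym (matchedA-suc k) lt)) (ℕP.+-suc ℓ _)
        columns : k ∸ (N ∸ row k) ≡ suc k ∸ (N ∸ row (suc k))
        columns = trans (cong (λ x → k ∸ (N ∸ x)) rows) (cong (suc k ∸_)
          (sym (ℕP.+-∸-assoc 1 (subst (_≤ N) rows (ℕP.<⇒≤ (proj₁ (live-row l)))))))

      pathUp : ∀ d k → Live k → Live (d + k) → Path S (pos k) (pos (d + k))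
      pathUp zero k l l' = here
      pathUp (suc d) k l l' = step (adjacent l l₁) (live-S l₁)
        (subst (λ x → Path S (pos (suc k)) (pos x)) (ℕP.+-suc d k) (pathUp d (suc k) l₁ (subst Live (sym (ℕP.+-suc d k)) l')))
        where l₁ = live-between l l' (ℕP.n≤1+n k) (s≤s (ℕP.m≤n+m k d))

      pathDown : ∀ d k → Live k → Live (d + k) → Path S (pos (d + k)) (pos k)
      pathDown zero k l l' = here
      pathDown (suc d) k l l' = step (Adj-sym (adjacent l₁ l')) (live-S l₁) (pathDown d k l l₁)
        where l₁ = live-between l l' (ℕP.m≤n+m k d) (ℕP.n≤1+n (d + k))

      S-connected : Connected S
      S-connected c d sc sd = subst₂ (Path S) (S-pos {c} sc) (S-pos {d} sd) (path (ℕP.≤-total (D c) (D d)))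
        where
        path : D c ≤ D d ⊎ D d ≤ D c → Path S (pos (D c)) (pos (D d))
        path (inj₁ p) = subst (λ x → Path S (pos (D c)) (pos x)) (ℕP.m∸n+n≡m p)
          (pathUp (D d ∸ D c) (D c) (S-live {c} sc) (subst Live (sym (ℕP.m∸n+n≡m p)) (S-live {d} sd)))
        path (inj₂ p) = subst (λ x → Path S (pos x) (pos (D d))) (ℕP.m∸n+n≡m p)
          (pathDown (D c ∸ D d) (D d) (S-live {d} sd) (subst Live (sym (ℕP.m∸n+n≡m p)) (S-live {c} sc)))

      -- Opposite corners of the square share a diagonal, while the row of a cell of `S` is
      -- determined by its diagonal.
      S-no2x2 : No2x2 S
      S-no2x2 i j (s , _ , _ , s') = ℕP.1+n≢n (trans (S-row {suc i , suc j} s')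
        (trans (cong row (sym diag)) (sym (S-row {i , j} s))))
        where
        diag : j + (N ∸ i) ≡ suc j + (N ∸ suc i)
        diag = trans (cong (j +_) (ℕP.+-∸-assoc 1 (ℕP.<⇒≤ (row<N la mu skew (proj₁ s'))))) (ℕP.+-suc j _)

      S-bounded : ∀ {i j} → S (i , j) → i < N × j < la ! 0
      S-bounded {i} (s , _) = row<N la mu skew s , ℕP.<-≤-trans (proj₂ s) (antitone-≤ {la !_} laP z≤n)

      D+row : ∀ {i j} → i ≤ N → D (i , j) + i ≡ j + N
      D+row {i} {j} p = trans (ℕP.+-assoc j (N ∸ i) i) (cong (j +_) (ℕP.m∸n+n≡m p))

      S-from-row : ∀ c → Live (D c) → row (D c) ≡ proj₁ c → S c
      S-from-row c l e = subst S (trans (cong (λ x → cell x (D c)) e) (cellAt-diagonal la mu skew c)) (live-S l)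

      -- As the diagonal grows along a strip, the row index weakly falls and the column weakly
      -- grows. Two cells of it in weak south-east position therefore share a row (first case) or a
      -- column (second case), and the cell between them is squeezed.
      S-convex : ∀ {i j i' j' i'' j''} → S (i , j) → S (i'' , j'') → i ≤ i' → i' ≤ i'' → j ≤ j' → j' ≤ j'' → S (i' , j')
      S-convex {i} {j} {i'} {j'} {i''} {j''} s s'' i≤i' i'≤i'' j≤j' j'≤j'' with ℕP.≤-total (D (i , j)) (D (i'' , j''))
      ... | inj₁ k≤k'' = S-from-row (i' , j') (live-between (S-live {i , j} s) (S-live {i'' , j''} s'') k≤k' k'≤k'')
          (ℕP.≤-antisym (ℕP.≤-trans (ℕP.+-monoʳ-≤ ℓ (antitone matchedA matchedA-antitone k≤k'))
                          (ℕP.≤-trans (ℕP.≤-reflexive (sym (S-row {i , j} s))) i≤i'))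
                        (ℕP.≤-trans i'≤i'' (ℕP.≤-trans (ℕP.≤-reflexive (S-row {i'' , j''} s''))
                          (ℕP.+-monoʳ-≤ ℓ (antitone matchedA matchedA-antitone k'≤k'')))))
        where
        i''≤i : i'' ≤ i
        i''≤i = subst₂ _≤_ (sym (S-row {i'' , j''} s'')) (sym (S-row {i , j} s)) (ℕP.+-monoʳ-≤ ℓ (antitone matchedA matchedA-antitone k≤k''))
        k≤k' : D (i , j) ≤ D (i' , j')
        k≤k' = ℕP.+-mono-≤ j≤j' (ℕP.∸-monoʳ-≤ N (ℕP.≤-trans i'≤i'' i''≤i))
        k'≤k'' : D (i' , j') ≤ D (i'' , j'')
        k'≤k'' = ℕP.+-mono-≤ j'≤j'' (ℕP.∸-monoʳ-≤ N (ℕP.≤-trans i''≤i i≤i'))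
      ... | inj₂ k''≤k = S-from-row (i' , j') (live-between (S-live {i'' , j''} s'') (S-live {i , j} s) k''≤k' k'≤k) (ℕP.≤-antisym row≤ row≥)
        where
        k = D (i , j)
        k' = D (i' , j')
        k'' = D (i'' , j'')
        i''≤N = ℕP.<⇒≤ (row<N la mu skew (proj₁ s''))
        i≤N = ℕP.≤-trans i≤i' (ℕP.≤-trans i'≤i'' i''≤N)
        shift : ∀ k → k + row k ≡ ℓ + (k + matchedA k)
        shift k = rearr k ℓ (matchedA k)
          where
          rearr : ∀ a b c → a + (b + c) ≡ b + (a + c)
          rearr = solveℕ-∀
        row-monotone : ∀ {k k'} → k ≤ k' → k + row k ≤ k' + row k'
        row-monotone {k} {k'} p = subst₂ _≤_ (sym (shift k)) (sym (shift k')) (ℕP.+-monoʳ-≤ ℓ (k+matchedA-monotone p))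
        level : ∀ {x y} → S (x , y) → x ≤ N → D (x , y) + row (D (x , y)) ≡ y + N
        level {x} {y} s x≤N = trans (cong (D (x , y) +_) (sym (S-row {x , y} s))) (D+row {x} {y} x≤N)
        j''≤j : j'' ≤ j
        j''≤j = ℕP.+-cancelʳ-≤ N _ _ (subst₂ _≤_ (level s'' i''≤N) (level s i≤N) (row-monotone k''≤k))
        k''≤k' : k'' ≤ k'
        k''≤k' = ℕP.+-mono-≤ (ℕP.≤-trans j''≤j j≤j') (ℕP.∸-monoʳ-≤ N i'≤i'')
        k'≤k : k' ≤ k
        k'≤k = ℕP.+-mono-≤ (ℕP.≤-trans j'≤j'' j''≤j) (ℕP.∸-monoʳ-≤ N i≤i')
        level' : k' + i' ≡ j' + N
        level' = D+row {i'} {j'} (ℕP.≤-trans i'≤i'' i''≤N)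
        row≤ : row k' ≤ i'
        row≤ = ℕP.+-cancelˡ-≤ k' _ _ (ℕP.≤-trans (row-monotone k'≤k) (ℕP.≤-trans (ℕP.≤-reflexive (level s i≤N))
          (ℕP.≤-trans (ℕP.+-monoˡ-≤ N j≤j') (ℕP.≤-reflexive (sym level')))))
        row≥ : i' ≤ row k'
        row≥ = ℕP.+-cancelˡ-≤ k' _ _ (ℕP.≤-trans (ℕP.≤-reflexive level') (ℕP.≤-trans (ℕP.+-monoˡ-≤ N j'≤j'')
          (ℕP.≤-trans (ℕP.≤-reflexive (sym (level s'' i''≤N))) (row-monotone k''≤k'))))

      -- The witness is the last cell of the row `i` with the `ℓ`-th unmatched end, counted from 0.
      -- Beyond its diagonal lie `suc i` ends, of which `suc ℓ` are unmatched, so `i` exceeds the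
      -- number of matched ones by `ℓ`.
      S-nonempty : ℓ < r → ∃ S
      S-nonempty ℓ<r with nth N (λ i → unmatched N B (A i)) (λ i → unmatched≤1 N B (A i)) ℓ ℓ<r
      ... | i , i<N , one , prefix = go (A i) refl
        where
        go : ∀ a → A i ≡ a → ∃ S
        go zero e = contradiction (ℕP.m<n⇒0<n∸m i<N) (ℕP.<⇒≱ (s≤s (ℕP.≤-trans (ℕP.m≤n+m (N ∸ i) (la ! i)) (ℕP.≤-reflexive e))))
        go (suc k) e = cell i k , inSkew , trans (cong (λ d → i ∸ matchedA d) (diagonal-cellAt la mu skew {i} lo))
            (trans (cong (_∸ matchedA k) i≡) (ℕP.m+n∸n≡m ℓ (matchedA k)))
          where
          ¬matched : ¬ Matched N B (A i)
          ¬matched = unmatched≡1⇒ {N} {B} one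
          lo : B i ≤ k
          lo = ℕ.s≤s⁻¹ (subst (B i <_) e (ℕP.≤∧≢⇒< (lower≤upper la mu skew i) λ e' → ¬matched (i , i<N , sym e')))
          hi : k < A i
          hi = ℕP.≤-reflexive (sym e)
          inSkew : InSkew la mu (cell i k)
          inSkew = cellAt-inSkew la mu skew {i} lo hi
          allA-k : allA k ≡ suc i
          allA-k = ℕP.≤-antisym
            (ℕP.≮⇒≥ λ lt → ℕP.<⇒≱ (<allA⇒ lt) (ℕ.s≤s⁻¹ (subst (A (suc i) <_) e
              (A-strict (ℕP.n<1+n i) (ℕP.<-≤-trans lt (allA≤N k))))))
            (⇒<allA i<N hi)
          unmatchedA-k : unmatchedA k ≡ suc ℓ
          unmatchedA-k = trans
            (sumℕ-truncate (λ i → unmatched N B (A i)) (λ i → above k (A i) * (1 ∸ eA i)) i<N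
              (λ x x≤i → trans (cong₂ _*_ (bit-yes (k ℕP.<? A x) (ℕP.<-≤-trans hi (antitone A A-antitone (ℕ.s≤s⁻¹ x≤i)))) (sym (unmatched≡ x)))
                (ℕP.*-identityˡ _))
              (λ x i<x → cong (_* (1 ∸ eA x)) (bit-no (k ℕP.<? A x) λ lt → ℕP.<-irrefl refl
                (ℕP.<-≤-trans (⇒<allA {k} (bound x lt) lt) (ℕP.≤-trans (ℕP.≤-reflexive allA-k) i<x)))))
            (trans (sumℕ-last i (λ i → unmatched N B (A i))) (trans (cong₂ _+_ prefix one) (ℕP.+-comm ℓ 1)))
            where
            bound : ∀ x → k < A x → x < N
            bound x lt = ℕP.≰⇒> λ N≤x → ℕP.n≮0 (subst (k <_) (cong₂ _+_ (!-overflow la N≤x) (ℕP.m≤n⇒m∸n≡0 N≤x)) lt)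
          i≡ : i ≡ ℓ + matchedA k
          i≡ = ℕP.suc-injective (trans (sym allA-k) (trans (allA≡ k) (cong (_+ matchedA k) unmatchedA-k)))

      S-borderStrip : ℓ < r → IsBorderStrip S
      S-borderStrip ℓ<r = S-nonempty ℓ<r , convex⇒skewShape S S? N (la ! 0) S-bounded S-convex , S-connected , S-no2x2

    decomposition : BorderStripDecomp la mu r
    decomposition = stripIndex , index<r , S-borderStrip
      where
      index<r : ∀ c → InSkew la mu c → stripIndex c < r
      index<r c s = ℕP.<-≤-trans (proj₂ (S-live (stripIndex c) {c} (s , refl)))
        (sumℕ-mono N λ i _ → ℕP.≤-trans (ℕP.*-monoˡ-≤ (1 ∸ eA i) (bit≤1 (D c ℕP.<? A i)))
          (ℕP.≤-reflexive (trans (ℕP.*-identityˡ _) (sym (unmatched≡ i)))))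

    isRank-unmatchedCount : IsRank la mu r
    isRank-unmatchedCount = decomposition , λ s d → unmatchedCount≤ la mu skew d

open RankUpperBound

-- The order of the count at t = 0 compared with the rank

module _ (la mu : List ℕ) (skew : IsSkewPartition la mu) where

  private
    N = length la
    A = upper la mu skew
    B = lower la mu skew
    r = unmatchedCount la mu skew

  ssytCount-Lead : Lead r (dt N (leadMatrix N A B)) (λ t → ι (ssytCount la mu t))
  ssytCount-Lead = Lead-cong refl
    (λ t → trans (ssytCount≡rowSum la mu t) (jacobiTrudi t N (la !_) (mu !_) (proj₁ skew)
      (λ j _ → proj₂ (proj₂ skew) j) (λ j _ → proj₁ (proj₂ skew) j)))
    (dt-Lead N (λ i → unmatched N B (A i)) (leadMatrix N A B) (λ t → JT t N (la !_) (mu !_))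
      λ i j _ j<N → entry-Lead N B (A i) j j<N)

  -- With `N` letters every row can be constant, with a larger letter in each next row.
  ssytCount≢0 : ι (ssytCount la mu N) ≢ 0ℚ
  ssytCount≢0 e = 1≰0 (subst (1ℚ ℚ.≤_) (trans (sym (ssytCount≡rowSum la mu N)) e)
    (rowSum-≥1 N N (mu !_) (la !_) (la ! 0) (la ! 0) [] 0 ℕP.≤-refl λ _ → z≤n))

Lead⇒TPowDivides : ∀ {la mu r c} → Lead r c (λ t → ι (ssytCount la mu t)) → TPowDivides la mu r
Lead⇒TPowDivides {c = c} (lead q e) = c ∷ q , λ t → sym (e t)

Lead-0⇒suc : ∀ {r f} → Lead r 0ℚ f → Σ ℚ λ c → Lead (suc r) c f
Lead-0⇒suc {r} (lead [] e) = 0ℚ , lead [] λ t → trans (e t) (trans (rearr (ι (t ℕ.^ r)) (ι t)) (sym (rearr (ι (t ℕ.^ suc r)) (ι t))))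
  where
  rearr : ∀ x y → x ℚ.* (0ℚ ℚ.+ y ℚ.* 0ℚ) ≡ 0ℚ
  rearr x y = trans (cong (λ z → x ℚ.* (0ℚ ℚ.+ z)) (ℚP.*-zeroʳ y)) (ℚP.*-zeroʳ x)
Lead-0⇒suc {r} (lead (c ∷ q) e) = c , lead q λ t → trans (e t)
  (trans (cong (ι (t ℕ.^ r) ℚ.*_) (ℚP.+-identityˡ _))
    (trans (sym (ℚP.*-assoc (ι (t ℕ.^ r)) (ι t) _))
      (cong (ℚ._* (c ℚ.+ ι t ℚ.* evalPoly q (ι t))) (trans (ℚP.*-comm (ι (t ℕ.^ r)) (ι t)) (sym (ι-^-suc t r))))))

nonsingular⇒rank≡zrank : RestrictedCauchyNonsingular → RankEqualsZrank
nonsingular⇒rank≡zrank rcn la mu skew r' e (decomp , minimal) ((q , divides) , maximal) = trans r'≡r (ℕP.≤-antisym r≤e e≤r)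
  where
  r = unmatchedCount la mu skew
  r'≡r : r' ≡ r
  r'≡r = ℕP.≤-antisym (minimal r (decomposition la mu skew)) (unmatchedCount≤ la mu skew decomp)
  r≤e : r ≤ e
  r≤e = maximal r (Lead⇒TPowDivides {la} {mu} {r} (ssytCount-Lead la mu skew))
  e≤r : e ≤ r
  e≤r = ℕP.≮⇒≥ λ r<e → leadMatrix-nonsingular rcn (length la) (upper la mu skew) (lower la mu skew)
    (upper-strict la mu skew) (lower-strict la mu skew) (λ i _ → lower≤upper la mu skew i)
    (Lead-divisible⇒0 r (e ∸ suc r) q (ssytCount-Lead la mu skew)
      λ t → trans (cong (λ x → ι (t ℕ.^ x) ℚ.* evalPoly q (ι t))
        (trans (sym (ℕP.+-suc (e ∸ suc r) r)) (ℕP.m∸n+n≡m r<e))) (divides t))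

-- `P` is not assumed decidable, so the maximum is only obtained doubly negated. Without one, every
-- `e` with `P e` is exceeded by another, and `d` bounds the distance left to `K`.
¬¬maximum : ∀ {P : ℕ → Set} K → (∀ f → P f → f < K) → ∀ {x} → P x → ¬ ¬ (Σ ℕ λ e → P e × (∀ f → P f → f ≤ e))
¬¬maximum {P} K bounded {x} px none = go K x (ℕP.m≤n+m K x) px
  where
  go : ∀ d e → K ≤ e ℕ.+ d → ¬ P e
  go zero e K≤e pe = ℕP.<⇒≱ (bounded e pe) (subst (K ≤_) (ℕP.+-identityʳ e) K≤e)
  go (suc d) e K≤e+d pe = none (e , pe , λ f pf → ℕP.≮⇒≥ λ e<f →
    go d f (ℕP.≤-trans K≤e+d (ℕP.≤-trans (ℕP.≤-reflexive (ℕP.+-suc e d)) (ℕP.+-monoˡ-≤ d e<f))) pf)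

-- The exponent `suc r` divides the count, but `RankEqualsZrank` speaks only of an actual maximum.
-- As the goal is a negation, its doubly negated existence is enough.
singular⇒rank≢zrank : ∀ la mu → (skew : IsSkewPartition la mu) →
  dt (length la) (leadMatrix (length la) (upper la mu skew) (lower la mu skew)) ≡ 0ℚ → ¬ RankEqualsZrank
singular⇒rank≢zrank la mu skew z rank≡zrank = ¬¬maximum {TPowDivides la mu} (length Q) bounded {suc r} divisible λ (e , div , max) →
  ℕP.<-irrefl (rank≡zrank la mu skew r e (isRank-unmatchedCount la mu skew) (div , max)) (max (suc r) divisible)
  where
  r = unmatchedCount la mu skew
  L = Lead-0⇒suc (Lead-cong z (λ _ → refl) (ssytCount-Lead la mu skew))
  divisible : TPowDivides la mu (suc r)
  divisible = Lead⇒TPowDivides {la} {mu} {suc r} (proj₂ L)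
  -- The coefficients of the count itself; an exponent of at least `length Q` would make it vanish
  -- everywhere.
  Q : List ℚ
  Q = replicate (suc r) 0ℚ ++ proj₁ divisible
  bounded : ∀ f → TPowDivides la mu f → f < length Q
  bounded f (q , e) = ℕP.≰⇒> λ le → ssytCount≢0 la mu skew
    (highDivisible⇒0 Q f {λ t → ι (ssytCount la mu t)} q le
      (λ t → sym (trans (eval-shift (suc r) (proj₁ divisible) t) (proj₂ divisible t))) e (length la))

-- Restricted Cauchy matrices as leading matrices of skew partitions

parts : ℕ → (ℕ → ℕ) → List ℕ
parts n A = applyUpTo (λ i → A i ∸ (n ∸ i)) n

parts-⊆ : ∀ n A B → (∀ i → i < n → B i ≤ A i) → parts n B ⊆ₚ parts n A
parts-⊆ n A B le i with ℕP.<-≤-connex i n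
... | inj₁ i<n = subst₂ _≤_ (sym (!-applyUpTo _ n i<n)) (sym (!-applyUpTo _ n i<n)) (ℕP.∸-monoˡ-≤ (n ∸ i) (le i i<n))
... | inj₂ n≤i = subst (_≤ parts n A ! i) (sym (!-applyUpTo-≥ _ n n≤i)) z≤n

module _ (n : ℕ) (A : ℕ → ℕ) (strict : StrictTo n A) (pos : ∀ i → i < n → 1 ≤ A i) where

  -- From index `i` on there are `n ∸ i` distinct positive values, the greatest of them `A i`. Hence
  -- the truncated subtraction in `parts` loses nothing.
  staircase≤ : ∀ i → i < n → n ∸ i ≤ A i
  staircase≤ i i<n = go (n ∸ i) i (ℕP.m+[n∸m]≡n (ℕP.<⇒≤ i<n))
    where
    go : ∀ d i → i ℕ.+ d ≡ n → d ≤ A i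
    go zero i e = z≤n
    go (suc zero) i e = pos i (ℕP.≤-reflexive (trans (sym (ℕP.+-comm i 1)) e))
    go (suc (suc d)) i e = ℕP.≤-trans (s≤s (go (suc d) (suc i) e'))
      (strict (ℕP.n<1+n i) (subst (suc i <_) e' (ℕP.m<m+n (suc i) (s≤s z≤n))))
      where e' = trans (sym (ℕP.+-suc i (suc d))) e

  parts-! : ∀ i → i < n → parts n A ! i ℕ.+ (n ∸ i) ≡ A i
  parts-! i i<n = trans (cong (ℕ._+ (n ∸ i)) (!-applyUpTo _ n i<n)) (ℕP.m∸n+n≡m (staircase≤ i i<n))

  parts-partition : IsPartition (parts n A)
  parts-partition = applyUpTo-partition _ n λ i si<n →
    ℕP.≤-trans (ℕP.∸-monoˡ-≤ (suc (n ∸ suc i)) (strict (ℕP.n<1+n i) si<n))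
      (ℕP.≤-reflexive (cong (A i ∸_) (sym (ℕP.+-∸-assoc 1 (ℕP.<⇒≤ si<n)))))

extend : ∀ {n} → (Fin n → ℕ) → ℕ → ℕ
extend {zero} f i = 0
extend {suc n} f zero = f Fin.zero
extend {suc n} f (suc i) = extend (f ∘ Fin.suc) i

extend-toℕ : ∀ {n} (f : Fin n → ℕ) i → extend f (toℕ i) ≡ f i
extend-toℕ f Fin.zero = refl
extend-toℕ f (Fin.suc i) = extend-toℕ (f ∘ Fin.suc) i

extend-fromℕ< : ∀ {n} (f : Fin n → ℕ) {i} (i<n : i < n) → extend f i ≡ f (fromℕ< i<n)
extend-fromℕ< f {i} i<n = trans (cong (extend f) (sym (FinP.toℕ-fromℕ< i<n))) (extend-toℕ f (fromℕ< i<n))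

-- `upper` and `lower` depend on `length la`, which for `parts n A` is only propositionally `n`.
-- With `la` and `n` as variables the equation can be matched by `refl`.
singularCauchy⇒rank≢zrank : ∀ {n} (a b : Fin n → ℤ) s la mu (skew : IsSkewPartition la mu) → length la ≡ n →
  (∀ i → a i ≡ ℤ.+ (la ! toℕ i ℕ.+ (n ∸ toℕ i)) ℤ.+ s) →
  (∀ i → b (opposite i) ≡ ℤ.+ (mu ! toℕ i ℕ.+ (n ∸ toℕ i)) ℤ.+ s) →
  (∀ i j → a i ≢ b j) → det n (cauchy a b) ≡ 0ℚ → ¬ RankEqualsZrank
singularCauchy⇒rank≢zrank {n} a b s la mu skew refl ea eb disjoint z = singular⇒rank≢zrank la mu skew
  (cancel-sign (reverseSign n) (reverseSign² n) (trans (sym (det-cauchy (upper la mu skew) (lower la mu skew) s a b ea eb' ¬matched)) z))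
  where
  eb' : ∀ j → b j ≡ ℤ.+ lower la mu skew (n ∸ suc (toℕ j)) ℤ.+ s
  eb' j = trans (cong b (sym (FinP.opposite-involutive j))) (trans (eb (opposite j))
    (cong (λ k → ℤ.+ lower la mu skew k ℤ.+ s) (FinP.opposite-prop j)))
  ¬matched : ∀ i → i < n → ¬ Matched n (lower la mu skew) (upper la mu skew i)
  ¬matched i i<n (j , j<n , e) = disjoint (fromℕ< i<n) (opposite (fromℕ< j<n)) (trans (ea (fromℕ< i<n))
    (trans (cong (λ x → ℤ.+ x ℤ.+ s) (trans (cong (upper la mu skew) (FinP.toℕ-fromℕ< i<n))
      (trans e (cong (lower la mu skew) (sym (FinP.toℕ-fromℕ< j<n))))))
      (sym (eb (fromℕ< j<n)))))

rank≡zrank⇒nonsingular : RankEqualsZrank → RestrictedCauchyNonsingular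
-- The empty determinant is 1; only for positive size is there a least value `b₀` to shift by.
rank≡zrank⇒nonsingular rank≡zrank zero a b _ ()
rank≡zrank⇒nonsingular rank≡zrank (suc m) a b (a-dec , b-inc , b<a , a≢b) z =
  singularCauchy⇒rank≢zrank a b s la mu skew (ListP.length-applyUpTo (λ i → A i ∸ (n ∸ i)) n)
    (λ i → trans (a≡ i) (cong (λ x → ℤ.+ x ℤ.+ s) (sym (trans (parts-! n A A-strict A-pos (toℕ i) (FinP.toℕ<n i)) (extend-toℕ α i)))))
    (λ i → trans (b≡ (opposite i)) (cong (λ x → ℤ.+ x ℤ.+ s) (sym (trans (parts-! n B B-strict B-pos (toℕ i) (FinP.toℕ<n i)) (extend-toℕ (β ∘ opposite) i)))))
    a≢b z rank≡zrank
  where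
  n = suc m
  b₀ = b Fin.zero
  s = b₀ ℤ.- ℤ.1ℤ
  b₀≤b : ∀ j → b₀ ℤ.≤ b j
  b₀≤b Fin.zero = ℤP.≤-refl
  b₀≤b (Fin.suc j) = ℤP.<⇒≤ (b-inc Fin.zero (Fin.suc j) (s≤s z≤n))
  b₀≤a : ∀ i → b₀ ℤ.≤ a i
  b₀≤a i = ℤP.≤-trans (b₀≤b (opposite i)) (ℤP.<⇒≤ (b<a i))
  -- Shifting by s makes the least value, b₀, equal to 1, so that μ ends in 0.
  shifted : ℤ → ℕ
  shifted x = suc ℤ.∣ x ℤ.- b₀ ∣
  shifted≡ : ∀ {x} → b₀ ℤ.≤ x → x ≡ ℤ.+ shifted x ℤ.+ s
  shifted≡ {x} p = trans (rearr x b₀) (cong (λ y → ℤ.1ℤ ℤ.+ y ℤ.+ s) (sym (ℤP.0≤i⇒+∣i∣≡i (ℤP.i≤j⇒0≤j-i p))))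
    where
    rearr : ∀ x b → x ≡ ℤ.1ℤ ℤ.+ (x ℤ.- b) ℤ.+ (b ℤ.- ℤ.1ℤ)
    rearr = ℤSolver.solve-∀
  shifted-< : ∀ {x y} → b₀ ℤ.≤ x → b₀ ℤ.≤ y → x ℤ.< y → shifted x < shifted y
  shifted-< {x} {y} p q x<y = ℕP.≰⇒> λ le → ℤP.<⇒≱ x<y
    (subst₂ ℤ._≤_ (sym (shifted≡ q)) (sym (shifted≡ p)) (ℤP.+-monoˡ-≤ s (ℤ.+≤+ le)))
  α β : Fin n → ℕ
  α = shifted ∘ a
  β = shifted ∘ b
  a≡ : ∀ i → a i ≡ ℤ.+ α i ℤ.+ s
  a≡ i = shifted≡ (b₀≤a i)
  b≡ : ∀ j → b j ≡ ℤ.+ β j ℤ.+ s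
  b≡ j = shifted≡ (b₀≤b j)
  A B : ℕ → ℕ
  A = extend α
  B = extend (β ∘ opposite)
  extend-strict : ∀ (f : Fin n → ℕ) → (∀ i j → i Fin.< j → f j < f i) → StrictTo n (extend f)
  extend-strict f dec {i} {j} i<j j<n = subst₂ _<_ (sym (extend-fromℕ< f j<n)) (sym (extend-fromℕ< f i<n))
    (dec (fromℕ< i<n) (fromℕ< j<n) (subst₂ _<_ (sym (FinP.toℕ-fromℕ< i<n)) (sym (FinP.toℕ-fromℕ< j<n)) i<j))
    where i<n = ℕP.<-trans i<j j<n
  A-strict : StrictTo n A
  A-strict = extend-strict α λ i j i<j → shifted-< (b₀≤a j) (b₀≤a i) (a-dec i j i<j)
  B-strict : StrictTo n B
  B-strict = extend-strict (β ∘ opposite) λ i j i<j → shifted-< (b₀≤b (opposite j)) (b₀≤b (opposite i))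
    (b-inc (opposite j) (opposite i) (subst₂ _<_ (sym (FinP.opposite-prop j)) (sym (FinP.opposite-prop i))
      (ℕP.∸-monoʳ-< (s≤s i<j) (FinP.toℕ<n j))))
  A-pos : ∀ i → i < n → 1 ≤ A i
  A-pos i i<n = subst (1 ≤_) (sym (extend-fromℕ< α i<n)) (s≤s z≤n)
  B-pos : ∀ i → i < n → 1 ≤ B i
  B-pos i i<n = subst (1 ≤_) (sym (extend-fromℕ< (β ∘ opposite) i<n)) (s≤s z≤n)
  B≤A : ∀ i → i < n → B i ≤ A i
  B≤A i i<n = subst₂ _≤_ (sym (extend-fromℕ< (β ∘ opposite) i<n)) (sym (extend-fromℕ< α i<n))
    (ℕP.<⇒≤ (shifted-< (b₀≤b (opposite (fromℕ< i<n))) (b₀≤a (fromℕ< i<n)) (b<a (fromℕ< i<n))))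
  la mu : List ℕ
  la = parts n A
  mu = parts n B
  skew : IsSkewPartition la mu
  skew = parts-partition n A A-strict A-pos , parts-partition n B B-strict B-pos ,
    parts-⊆ n A B B≤A

theorem5p2 : (RankEqualsZrank → RestrictedCauchyNonsingular) × (RestrictedCauchyNonsingular → RankEqualsZrank)
theorem5p2 = rank≡zrank⇒nonsingular , nonsingular⇒rank≡zrank
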